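{- Let $p \geq 5$ be a prime and define $$w_1(p):= a_1\left( \frac{5(p^2-1)}{24}\right) + \left( \frac{ -6}{p}\right)_{L} \left( \frac{ -5(p^2-1)/24}{p}\right)_{L}.$$ (i) If $w_1(p) \equiv 0 \pmod2$, then for all integers $n,k \geq 0$ with $p \nmid n$, $B_{4,3} \left( p^{4k+3}n+ \frac{5 ( p^{4k+4}-1)}{24} \right) \equiv 0 \pmod2$. (ii) If $w_1(p) \not \equiv 0 \pmod2$, then for all integers $n,k \geq 0$ with $p \nmid n$, $B_{4,3} \left( p^{6k+5}n+ \frac{5 ( p^{6k+6}-1)}{24} \right) \equiv 0 \pmod2$. (iii) If $w_1(p) \not \equiv 0 \pmod2$, then for all integers $n,k \geq 0$ with $w_1(p)\equiv \left( \frac{ -6n-1+ \frac{p^2-1}{4}}{p}\right)_{L}\pmod2$, $B_{4,3} \left( p^{6k+2}n+ \frac{5 ( p^{6k+2}-1)}{24} \right) \equiv 0 \pmod2$.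
   Context: $a_1(n)$ is defined by $\sum_{n\ge0}a_1(n)q^n=(q;q)_\infty^2(q^3;q^3)_\infty$, where $(q^t;q^t)_\infty=\prod_{k\ge1}(1-q^{tk})$. $\left(\frac{a}{p}\right)_L$ is the Legendre symbol ($0$ if $p\mid a$). For integers $u,v\ge 2$, $B_{u,v}(n)$ is the number of bipartitions $(\alpha,\beta)$ of $n$ with $\alpha$ having no part divisible by $u$ and $\beta$ having no part divisible by $v$; $\sum_{n\ge0}B_{u,v}(n)q^n=\frac{(q^u;q^u)_\infty(q^v;q^v)_\infty}{(q;q)_\infty^2}$. -}

module Defs where

open import Data.Bool using (Bool; true; false; if_then_else_; not)
open import Data.Nat as ℕ using (ℕ; zero; suc; _∸_; _≤ᵇ_; _≡ᵇ_)
open import Data.Nat.DivMod as ℕD using ()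
open import Data.Integer as ℤ using (ℤ; +_; 0ℤ; 1ℤ)
open import Data.Integer.DivMod using (_%ℕ_)
open import Data.List using (List; []; _∷_; _++_; map; concatMap; length; filterᵇ; upTo; replicate)
open import Data.Bool.ListAction using (all; any)
open import Data.Nat.Divisibility using (_∣?_)
open import Relation.Nullary using (does)

Series : Set
Series = ℕ → ℤ

one : Series
one zero    = 1ℤ
one (suc _) = 0ℤ

mul1m : ℕ → Series → Series
mul1m j f n = f n ℤ.- (if j ≤ᵇ n then f (n ∸ j) else 0ℤ)

prodA : ℕ → Series → Series
prodA zero    f = f
prodA (suc m) f = mul1m (suc m) (mul1m (suc m) (mul1m (3 ℕ.* suc m) (prodA m f)))

-- a₁(n) = coefficient of q^n in (q;q)∞² (q³;q³)∞.
-- Factors with k > n do not affect the coefficient of q^n, so the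
-- truncated product ∏_{k=1}^{n} gives the exact coefficient.
a₁ : ℕ → ℤ
a₁ n = prodA n one n

-- all partitions of m with all parts ≤ k, as (nonincreasing) lists of parts
partsLE : ℕ → ℕ → List (List ℕ)
partsLE zero    zero    = [] ∷ []
partsLE zero    (suc _) = []
partsLE (suc k) m =
  concatMap (λ c → map (replicate c (suc k) ++_) (partsLE k (m ∸ c ℕ.* suc k)))
            (filterᵇ (λ c → c ℕ.* suc k ≤ᵇ m) (upTo (suc m)))

partitions : ℕ → List (List ℕ)
partitions m = partsLE m m

noPartDiv : ℕ → List ℕ → Bool
noPartDiv u α = all (λ x → not (does (u ∣? x))) α

data Bipartition : Set where
  _,_ : List ℕ → List ℕ → Bipartition

bipartitions : ℕ → List Bipartition
bipartitions n =
  concatMap (λ i → concatMap (λ α → map (α ,_) (partitions (n ∸ i))) (partitions i))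
            (upTo (suc n))

okBi : ℕ → ℕ → Bipartition → Bool
okBi u v (α , β) = noPartDiv u α Data.Bool.∧ noPartDiv v β
  where import Data.Bool

-- B_{u,v}(n): number of bipartitions (α,β) of n with no part of α divisible
-- by u and no part of β divisible by v  (intended for u, v ≥ 2).
B : ℕ → ℕ → ℕ → ℕ
B u v n = length (filterᵇ (okBi u v) (bipartitions n))

legendre : ℤ → ℕ → ℤ
legendre a zero = 0ℤ
legendre a p@(suc _) =
  if (a %ℕ p) ≡ᵇ 0 then 0ℤ
  else (if any (λ x → ((+ (x ℕ.* x)) ℤ.- a) %ℕ p ≡ᵇ 0) (upTo p) then 1ℤ else ℤ.-1ℤ)

-- w₁(p) := a₁(5(p²-1)/24) + (-6/p)_L ((-5(p²-1)/24)/p)_L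
-- (for primes p ≥ 5, 24 ∣ p² - 1, so the ℕ-division is exact)

w₁ : ℕ → ℤ
w₁ p = a₁ (5 ℕ.* (p ℕ.* p ∸ 1) ℕD./ 24)
       ℤ.+ legendre (ℤ.- (+ 6)) p ℤ.* legendre (ℤ.- (+ (5 ℕ.* (p ℕ.* p ∸ 1) ℕD./ 24))) p

{-# OPTIONS --safe #-}

-- Write f_k = (q^k; q^k)_∞.  Modulo 2 one has f₁² ≡ f₂, hence f₄f₃/f₁² ≡ f₁²f₃ ≡ f₂f₃: B_{4,3}(n) and
-- a₁(n) have the same parity, and by the pentagonal number theorem it is the parity of the number of
-- (X, Y) ∈ ℤ² with 2X² + 3Y² = 24n + 5 and X ≡ Y ≡ 1 (mod 3).
--
-- Let M = 24n + 5 and let e be the exponent of p in M.  If p = 𝔭𝔭̄ splits in ℤ[√-6], then 𝔭² is generated by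
-- some u + v√-6 of norm p².  On the solutions of 2X² + 3Y² = M with X ≡ 1 (mod 3), multiplying
-- 2X + Y√-6 by (u + v√-6)/p raises the 𝔭-adic valuation by one and translates Y mod 3 by 2v; it is defined
-- unless the valuation is already maximal, so the solutions fall into chains of length e + 1.
-- If 3 ∤ v and 3 ∣ e + 1, then Y is equidistributed modulo 3 on every chain, and the solutions with Y ≡ 0 pair
-- off under Y ↦ -Y.  If 3 ∣ v and e is odd, then Y mod 3 is constant on chains of even length.  If p is inert
-- and e is odd, there is no solution at all.
-- The case n = 5(p² - 1)/24, that is M = 5p², shows that w₁(p) is odd exactly when p splits and 3 ∤ v.
module Submission where

-- Why `𝔭²` is principal: a root of -6 modulo p gives a binary form of determinant 6 representing p,
-- and every reduced form of determinant 6 is diagonal, so p = dx² + fy² with df = 6. Then p² = (dx²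
-- - fy²)² + 6(2xy)². Ideals are replaced by congruences: divisibility by the i-th power of `𝔭` is
-- tested modulo q^i with a root s of -6 in place of √-6, and Hensel lifting makes s precise enough.
-- Here q is whichever of p and -p is 1 modulo 3, and u is 1 modulo 3 as well, so that dividing by q
-- disturbs neither X ≡ 1 nor the translation of Y. A rotation exists only where q divides the
-- product, so counting goes through injective relations between duplicate-free lists rather than
-- functions. For M = 5p² there are three levels. If 3 divides v, the outer two have equal size, and
-- the middle one consists of the solutions divisible by p, that is, of the one coming from (1, 1),
-- the only solution for M = 5. If p is inert, that one is all there is. So the count is odd, and
-- the Legendre product in `w₁`, being ±1, makes `w₁` even. For p = 5 this product vanishes and
-- `w₁ 5` is evaluated directly.

module Counting where

  open import Data.Nat using (suc; _+_; _≤_; z≤n; s≤s)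
  open import Data.Nat.Properties using (≤-antisym; ≤-trans; ≤-reflexive; +-suc; +-identityʳ; *-comm)
  open import Data.Nat.Divisibility using (_∣_; divides)
  open import Data.List using (List; []; _∷_; _++_; length; filter)
  open import Data.List.Properties using (length-++)
  open import Data.List.Membership.Propositional using (_∈_)
  open import Data.List.Membership.Propositional.Properties using (∈-∃++; ∈-++⁻; ∈-++⁺ˡ; ∈-++⁺ʳ; ∈-filter⁺; ∈-filter⁻)
  open import Data.List.Relation.Unary.Any using (here; there)
  open import Data.List.Relation.Unary.All as All using ()
  open import Data.List.Relation.Unary.AllPairs using ([]; _∷_)
  open import Data.List.Relation.Unary.Unique.Propositional using (Unique)
  open import Data.List.Relation.Unary.Unique.Propositional.Properties using () renaming (filter⁺ to filter-unique)
  open import Data.Product using (∃; _×_; _,_)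
  open import Data.Sum using (inj₁; inj₂)
  open import Relation.Nullary using (¬_; yes; no; contradiction; ¬?)
  open import Relation.Unary using (Decidable)
  open import Relation.Binary.PropositionalEquality using (_≡_; refl; sym; trans; cong)

  -- Pigeonhole, deleting from `ys` the partner of each head. A relation is used because the
  -- rotations counted along later are only partially defined; it has to determine x from y.
  length-≤ : {A C : Set} (R : A → C → Set) {xs : List A} {ys : List C} → Unique xs →
    (∀ {x} → x ∈ xs → ∃ λ y → y ∈ ys × R x y) →
    (∀ {x x′ y} → R x y → R x′ y → x ≡ x′) → length xs ≤ length ys
  length-≤ R {[]} _ tot inj = z≤n
  length-≤ R {x ∷ xs} {ys} (x∉ ∷ uniq) tot inj with tot (here refl)
  ... | y , y∈ , Rxy with ∈-∃++ y∈
  ... | as , bs , refl = ≤-trans (s≤s (length-≤ R uniq tot′ inj)) (≤-reflexive length-eq)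
    where
    length-eq : suc (length (as ++ bs)) ≡ length (as ++ y ∷ bs)
    length-eq = trans (cong suc (length-++ as)) (sym (trans (length-++ as) (+-suc (length as) (length bs))))
    tot′ : ∀ {z} → z ∈ xs → ∃ λ y′ → y′ ∈ as ++ bs × R z y′
    tot′ z∈ with tot (there z∈)
    ... | y′ , y′∈ , Rzy′ with ∈-++⁻ as y′∈
    ... | inj₁ m = y′ , ∈-++⁺ˡ m , Rzy′
    ... | inj₂ (there m) = y′ , ∈-++⁺ʳ as m , Rzy′
    ... | inj₂ (here refl) = contradiction (inj Rxy Rzy′) (All.lookup x∉ z∈)

  length-≡ : {A C : Set} (R : A → C → Set) {xs : List A} {ys : List C} → Unique xs → Unique ys →
    (∀ {x} → x ∈ xs → ∃ λ y → y ∈ ys × R x y) →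
    (∀ {y} → y ∈ ys → ∃ λ x → x ∈ xs × R x y) →
    (∀ {x x′ y} → R x y → R x′ y → x ≡ x′) →
    (∀ {x y y′} → R x y → R x y′ → y ≡ y′) → length xs ≡ length ys
  length-≡ R uxs uys tot surj inj fun =
    ≤-antisym (length-≤ R uxs tot inj) (length-≤ (λ y x → R x y) uys surj fun)

  length-partition : {A : Set} {P : A → Set} (P? : Decidable P) (xs : List A) →
    length (filter P? xs) + length (filter (λ x → ¬? (P? x)) xs) ≡ length xs
  length-partition P? [] = refl
  length-partition P? (x ∷ xs) with P? x
  ... | yes _ = cong suc (length-partition P? xs)
  ... | no _ = trans (+-suc _ _) (cong suc (length-partition P? xs))

  -- The part satisfying `P` and its complement inject into each other, so they have equal length.
  -- Two injections in opposite directions take the place of a fixed-point-free involution.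
  2∣length : {A : Set} {P : A → Set} (P? : Decidable P) (R S : A → A → Set) {xs : List A} → Unique xs →
    (∀ {x} → x ∈ xs → P x → ∃ λ y → y ∈ xs × ¬ P y × R x y) →
    (∀ {x} → x ∈ xs → ¬ P x → ∃ λ y → y ∈ xs × P y × S x y) →
    (∀ {x x′ y} → R x y → R x′ y → x ≡ x′) →
    (∀ {x x′ y} → S x y → S x′ y → x ≡ x′) → 2 ∣ length xs
  2∣length {P = P} P? R S {xs} uniq f g injR injS = divides (length ps) (trans (sym (length-partition P? xs))
      (trans (cong (length ps +_) (sym ps≡qs)) (trans (cong (length ps +_) (sym (+-identityʳ _))) (*-comm 2 (length ps)))))
    where
    ps = filter P? xs
    qs = filter (λ x → ¬? (P? x)) xs
    ps≡qs : length ps ≡ length qs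
    ps≡qs = ≤-antisym
      (length-≤ R (filter-unique P? uniq)
        (λ x∈ → let x∈xs , px = ∈-filter⁻ P? x∈; y , y∈ , ¬py , r = f x∈xs px in y , ∈-filter⁺ _ y∈ ¬py , r) injR)
      (length-≤ S (filter-unique _ uniq)
        (λ x∈ → let x∈xs , ¬px = ∈-filter⁻ (λ x → ¬? (P? x)) x∈; y , y∈ , py , s = g x∈xs ¬px in y , ∈-filter⁺ P? y∈ py , s) injS)

-- Power series modulo 2.

module SeriesMod2 where

  open import Data.Nat using (ℕ; zero; suc; _+_; _*_; _≤_; _<_; s≤s)
  open import Data.Nat.Properties using (+-comm; +-suc; +-identityʳ; *-distribˡ-+; ≤-trans; ≤-refl; n≤1+n; m≤n*m; *-zeroʳ; ≤-reflexive)
  open import Data.Nat.Induction using (<-rec)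
  open import Data.Nat.Tactic.RingSolver using () renaming (solve-∀ to solve-ℕ)
  open import Data.Integer using (ℤ; +_; -[1+_])
  open import Data.List using (List; []; _∷_)
  open import Data.Parity.Base as ℙ using (Parity; 0ℙ; 1ℙ)
  open import Data.Parity.Properties using () renaming (+-*-commutativeRing to ℙ-commutativeRing; +-comm to ℙ-comm)
  open import Data.Maybe using (just; nothing)
  open import Level using (0ℓ)
  open import Tactic.RingSolver.Core.AlmostCommutativeRing using (AlmostCommutativeRing; fromCommutativeRing)
  open import Tactic.RingSolver using (solve-∀)
  open import Relation.Binary.PropositionalEquality using (_≡_; _≗_; refl; sym; trans; cong; cong₂; module ≡-Reasoning)

  ℙ-ring : AlmostCommutativeRing 0ℓ 0ℓ
  ℙ-ring = fromCommutativeRing ℙ-commutativeRing λ { 0ℙ → just refl ; 1ℙ → nothing }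

  Series₂ : Set
  Series₂ = ℕ → Parity

  infixl 6 _⊕_
  _⊕_ : Series₂ → Series₂ → Series₂
  (f ⊕ g) n = f n ℙ.+ g n

  -- Multiplication by q. Accordingly `shift k` multiplies by q^k, and `mul1+ k` by 1 + q^k, which
  -- is 1 - q^k modulo 2.
  shift₁ : Series₂ → Series₂
  shift₁ f zero    = 0ℙ
  shift₁ f (suc n) = f n

  shift : ℕ → Series₂ → Series₂
  shift zero    f = f
  shift (suc k) f = shift₁ (shift k f)

  mul1+ : ℕ → Series₂ → Series₂
  mul1+ k f = f ⊕ shift k f

  one₂ : Series₂
  one₂ zero    = 1ℙ
  one₂ (suc _) = 0ℙ

  shift₁-cong : ∀ {f g} n → (∀ i → i ≤ n → f i ≡ g i) → ∀ i → i ≤ n → shift₁ f i ≡ shift₁ g i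
  shift₁-cong n e zero    _   = refl
  shift₁-cong n e (suc i) i<n = e i (≤-trans (n≤1+n i) i<n)

  shift-cong : ∀ {f g} k n → (∀ i → i ≤ n → f i ≡ g i) → ∀ i → i ≤ n → shift k f i ≡ shift k g i
  shift-cong zero    n e = e
  shift-cong (suc k) n e = shift₁-cong n (shift-cong k n e)

  mul1+-cong : ∀ {f g} k n → (∀ i → i ≤ n → f i ≡ g i) → ∀ i → i ≤ n → mul1+ k f i ≡ mul1+ k g i
  mul1+-cong k n e i i≤n = cong₂ ℙ._+_ (e i i≤n) (shift-cong k n e i i≤n)

  infix 2 _≈[_]_
  -- Congruence modulo q^(n+1): infinite products occur only through truncations that agree up to
  -- the degree in question.
  _≈[_]_ : Series₂ → ℕ → Series₂ → Set
  f ≈[ n ] g = ∀ i → i ≤ n → f i ≡ g i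

  ≗⇒≈ : ∀ {f g n} → f ≗ g → f ≈[ n ] g
  ≗⇒≈ e i _ = e i

  ≈-trans : ∀ {f g h n} → f ≈[ n ] g → g ≈[ n ] h → f ≈[ n ] h
  ≈-trans e₁ e₂ i i≤n = trans (e₁ i i≤n) (e₂ i i≤n)

  ≈-sym : ∀ {f g n} → f ≈[ n ] g → g ≈[ n ] f
  ≈-sym e i i≤n = sym (e i i≤n)

  shift-≗ : ∀ {f g} k → f ≗ g → shift k f ≗ shift k g
  shift-≗ k e i = shift-cong k i (≗⇒≈ e) i ≤-refl

  mul1+-≗ : ∀ {f g} k → f ≗ g → mul1+ k f ≗ mul1+ k g
  mul1+-≗ k e i = mul1+-cong k i (≗⇒≈ e) i ≤-refl

  shift₁-⊕ : ∀ f g → shift₁ (f ⊕ g) ≗ shift₁ f ⊕ shift₁ g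
  shift₁-⊕ f g zero    = refl
  shift₁-⊕ f g (suc n) = refl

  shift-⊕ : ∀ k f g → shift k (f ⊕ g) ≗ shift k f ⊕ shift k g
  shift-⊕ zero    f g n = refl
  shift-⊕ (suc k) f g n = trans (shift-≗ 1 (shift-⊕ k f g) n) (shift₁-⊕ (shift k f) (shift k g) n)

  shift-⊕₄ : ∀ k f g h e → shift k (f ⊕ g ⊕ h ⊕ e) ≗ shift k f ⊕ shift k g ⊕ shift k h ⊕ shift k e
  shift-⊕₄ k f g h e n = trans (shift-⊕ k (f ⊕ g ⊕ h) e n)
    (cong (ℙ._+ shift k e n) (trans (shift-⊕ k (f ⊕ g) h n) (cong (ℙ._+ shift k h n) (shift-⊕ k f g n))))

  shift-shift : ∀ j k f → shift j (shift k f) ≡ shift (j + k) f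
  shift-shift zero    k f = refl
  shift-shift (suc j) k f = cong shift₁ (shift-shift j k f)

  shift-comm : ∀ j k f → shift j (shift k f) ≡ shift k (shift j f)
  shift-comm j k f = trans (shift-shift j k f) (trans (cong (λ i → shift i f) (+-comm j k)) (sym (shift-shift k j f)))

  shift-< : ∀ {k n} f → n < k → shift k f n ≡ 0ℙ
  shift-< {suc k} {zero}  f _         = refl
  shift-< {suc k} {suc n} f (s≤s n<k) = shift-< f n<k

  shift-+ : ∀ k n f → shift k f (k + n) ≡ f n
  shift-+ zero    n f = refl
  shift-+ (suc k) n f = shift-+ k n f

  shift-mul1+ : ∀ k j f → shift k (mul1+ j f) ≗ mul1+ j (shift k f)
  shift-mul1+ k j f n = trans (shift-⊕ k f (shift j f) n) (cong (λ g → shift k f n ℙ.+ g n) (shift-comm k j f))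

  mul1+-comm : ∀ j k f → mul1+ j (mul1+ k f) ≗ mul1+ k (mul1+ j f)
  mul1+-comm j k f n = begin
    f n ℙ.+ shift k f n ℙ.+ shift j (f ⊕ shift k f) n
      ≡⟨ cong (mul1+ k f n ℙ.+_) (shift-mul1+ j k f n) ⟩
    f n ℙ.+ shift k f n ℙ.+ (shift j f n ℙ.+ shift k (shift j f) n)
      ≡⟨ interchange (f n) (shift k f n) (shift j f n) _ ⟩
    f n ℙ.+ shift j f n ℙ.+ (shift k f n ℙ.+ shift k (shift j f) n)
      ≡⟨ cong (mul1+ j f n ℙ.+_) (shift-⊕ k f (shift j f) n) ⟨
    mul1+ k (mul1+ j f) n ∎
    where
    open ≡-Reasoning
    interchange : ∀ a b c d → a ℙ.+ b ℙ.+ (c ℙ.+ d) ≡ a ℙ.+ c ℙ.+ (b ℙ.+ d)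
    interchange = solve-∀ ℙ-ring

  -- Squaring is additive in characteristic 2.
  mul1+-square : ∀ j f → mul1+ j (mul1+ j f) ≗ mul1+ (j + j) f
  mul1+-square j f n = begin
    f n ℙ.+ shift j f n ℙ.+ shift j (f ⊕ shift j f) n
      ≡⟨ cong (mul1+ j f n ℙ.+_) (shift-⊕ j f (shift j f) n) ⟩
    f n ℙ.+ shift j f n ℙ.+ (shift j f n ℙ.+ shift j (shift j f) n)
      ≡⟨ cancel (f n) (shift j f n) _ ⟩
    f n ℙ.+ shift j (shift j f) n
      ≡⟨ cong (λ g → f n ℙ.+ g n) (shift-shift j j f) ⟩
    mul1+ (j + j) f n ∎
    where
    open ≡-Reasoning
    cancel : ∀ a b c → a ℙ.+ b ℙ.+ (b ℙ.+ c) ≡ a ℙ.+ c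
    cancel = solve-∀ ℙ-ring

  mul1+-> : ∀ {n} k f → n < k → mul1+ k f ≈[ n ] f
  mul1+-> k f n<k i i≤n = trans (cong (f i ℙ.+_) (shift-< f (≤-trans (s≤s i≤n) n<k))) (ℙ-comm (f i) 0ℙ)

  -- The factor 1 + q^(k+1) has constant term 1, so it cancels coefficient by coefficient. The
  -- successor keeps out 1 + q^0 = 0.
  mul1+-cancel : ∀ k {f g n} → mul1+ (suc k) f ≈[ n ] mul1+ (suc k) g → f ≈[ n ] g
  mul1+-cancel k {f} {g} {n} e = <-rec (λ i → i ≤ n → f i ≡ g i) step
    where
    cancelʳ : ∀ {a b c d} → a ℙ.+ b ≡ c ℙ.+ d → b ≡ d → a ≡ c
    cancelʳ {a} {b} {c} e refl = trans (sym (twice a b)) (trans (cong (ℙ._+ b) e) (twice c b))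
      where
      twice : ∀ a b → a ℙ.+ b ℙ.+ b ≡ a
      twice = solve-∀ ℙ-ring
    tail : ∀ i → (∀ {j} → j < i → j ≤ n → f j ≡ g j) → i ≤ n → shift (suc k) f i ≡ shift (suc k) g i
    tail zero    rec i≤n = refl
    tail (suc i) rec i<n = shift-cong k i (λ j j≤i → rec (s≤s j≤i) (≤-trans j≤i (≤-trans (n≤1+n i) i<n))) i ≤-refl
    step : ∀ i → (∀ {j} → j < i → j ≤ n → f j ≡ g j) → i ≤ n → f i ≡ g i
    step i rec i≤n = cancelʳ (e i i≤n) (tail i rec i≤n)

  -- Finite products and the pentagonal number theorem modulo 2.

  -- prod b s d f = ∏_{j=s+1}^{s+d} (1 + q^{bj}) f
  prod : ℕ → ℕ → ℕ → Series₂ → Series₂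
  prod b s zero    f = f
  prod b s (suc d) f = mul1+ (b * (s + suc d)) (prod b s d f)

  prod-cong : ∀ b s d {f g n} → f ≈[ n ] g → prod b s d f ≈[ n ] prod b s d g
  prod-cong b s zero    e = e
  prod-cong b s (suc d) e = mul1+-cong (b * (s + suc d)) _ (prod-cong b s d e)

  prod-≗ : ∀ b s d {f g} → f ≗ g → prod b s d f ≗ prod b s d g
  prod-≗ b s d e i = prod-cong b s d (≗⇒≈ e) i ≤-refl

  prod-mul1+ : ∀ b s d k f → prod b s d (mul1+ k f) ≗ mul1+ k (prod b s d f)
  prod-mul1+ b s zero    k f i = refl
  prod-mul1+ b s (suc d) k f i = trans (mul1+-≗ (b * (s + suc d)) (prod-mul1+ b s d k f) i) (mul1+-comm (b * (s + suc d)) k (prod b s d f) i)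

  -- Splits off the factor of lowest index, whereas the recursion of `prod` splits off the highest;
  -- the induction in `shanks-suc` raises s and needs this form.
  prod-suc : ∀ b s d f → mul1+ (b * suc s) (prod b (suc s) d f) ≗ prod b s (suc d) f
  prod-suc b s zero    f i = cong (λ j → mul1+ (b * j) f i) (sym (trans (+-suc s 0) (cong suc (+-identityʳ s))))
  prod-suc b s (suc d) f i = begin
    mul1+ (b * suc s) (mul1+ (b * (suc s + suc d)) (prod b (suc s) d f)) i
      ≡⟨ mul1+-comm (b * suc s) (b * (suc s + suc d)) (prod b (suc s) d f) i ⟩
    mul1+ (b * (suc s + suc d)) (mul1+ (b * suc s) (prod b (suc s) d f)) i
      ≡⟨ mul1+-≗ (b * (suc s + suc d)) (prod-suc b s d f) i ⟩
    mul1+ (b * (suc s + suc d)) (prod b s (suc d) f) i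
      ≡⟨ cong (λ j → mul1+ (b * j) (prod b s (suc d) f) i) (sym (+-suc s (suc d))) ⟩
    prod b s (suc (suc d)) f i ∎
    where open ≡-Reasoning

  -- Shanks' finite form of the pentagonal number theorem:
  -- shanks b 0 n = ∑_{r=0}^{n} q^{b(rn+r(r+1)/2)} ∏_{j=r+1}^{n} (1+q^{bj}) telescopes in n.
  -- shanks b s d is the part r ≥ s of the sum with n = s + d, divided by q^{b(sn+s(s+1)/2)}.
  shanks : ℕ → ℕ → ℕ → Series₂ → Series₂
  shanks b s zero    f = f
  shanks b s (suc d) f = prod b s (suc d) f ⊕ shift (b * (2 * s + d + 2)) (shanks b (suc s) d f)

  -- pent⁻ s d = n(3n-1)/2 - s(n-1) - s(s+1)/2 for n = s + d + 1
  pent⁻ : ℕ → ℕ → ℕ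
  pent⁻ s zero    = 2 * s + 1
  pent⁻ s (suc d) = (2 * s + d + 2) + pent⁻ (suc s) d

  -- The telescoping step from n = s + d to n + 1, for the tail r ≥ s; the shift by bs reconciles
  -- the two normalisations. What is wanted is s = 0, where the product term carries the factor 1 +
  -- q^0 = 0 and just two pentagonal terms are added, but the induction on d passes from s to s + 1.
  shanks-suc : ∀ b s d f → shift (b * s) (shanks b s (suc d) f) ≗
    shanks b s d f ⊕ mul1+ (b * s) (prod b s d f) ⊕ shift (b * pent⁻ s d) f ⊕ shift (b * (pent⁻ s d + (s + d + 1))) f
  shanks-suc b s zero f i = begin
    shift (b * s) ((f ⊕ shift (b * (s + 1)) f) ⊕ shift (b * (2 * s + 0 + 2)) f) i
      ≡⟨ shift-⊕ (b * s) _ _ i ⟩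
    shift (b * s) (f ⊕ shift (b * (s + 1)) f) i ℙ.+ shift (b * s) (shift (b * (2 * s + 0 + 2)) f) i
      ≡⟨ cong₂ ℙ._+_ (shift-⊕ (b * s) _ _ i) (cong (λ g → g i) (shift-shift (b * s) _ f)) ⟩
    shift (b * s) f i ℙ.+ shift (b * s) (shift (b * (s + 1)) f) i ℙ.+ shift (b * s + b * (2 * s + 0 + 2)) f i
      ≡⟨ cong₂ (λ x y → shift (b * s) f i ℙ.+ x i ℙ.+ shift y f i)
           (trans (shift-shift (b * s) _ f) (cong (λ j → shift j f) (e₁ b s))) (e₂ b s) ⟩
    shift (b * s) f i ℙ.+ shift (b * (2 * s + 1)) f i ℙ.+ shift (b * (2 * s + 1 + (s + 0 + 1))) f i
      ≡⟨ ring (f i) _ _ _ ⟩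
    f i ℙ.+ (f i ℙ.+ shift (b * s) f i) ℙ.+ shift (b * (2 * s + 1)) f i ℙ.+ shift (b * (2 * s + 1 + (s + 0 + 1))) f i ∎
    where
    open ≡-Reasoning
    e₁ : ∀ b s → b * s + b * (s + 1) ≡ b * (2 * s + 1)
    e₁ = solve-ℕ
    e₂ : ∀ b s → b * s + b * (2 * s + 0 + 2) ≡ b * (2 * s + 1 + (s + 0 + 1))
    e₂ = solve-ℕ
    ring : ∀ x a b c → a ℙ.+ b ℙ.+ c ≡ x ℙ.+ (x ℙ.+ a) ℙ.+ b ℙ.+ c
    ring = solve-∀ ℙ-ring
  shanks-suc b s (suc d) f i = begin
    shift (b * s) (mul1+ (b * (s + suc (suc d))) P ⊕ shift (b * (2 * s + suc d + 2)) U′) i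
      ≡⟨ shift-⊕ (b * s) _ _ i ⟩
    shift (b * s) (P ⊕ shift (b * (s + suc (suc d))) P) i ℙ.+ shift (b * s) (shift (b * (2 * s + suc d + 2)) U′) i
      ≡⟨ cong₂ ℙ._+_ (trans (shift-⊕ (b * s) _ _ i) (cong (shift (b * s) P i ℙ.+_) (shift-eq (b * s) (b * (s + suc (suc d))) 0 k P (e₁ b s d) i)))
           (shift-eq (b * s) (b * (2 * s + suc d + 2)) k (b * suc s) U′ (e₂ b s d) i) ⟩
    shift (b * s) P i ℙ.+ shift k P i ℙ.+ shift k (shift (b * suc s) U′) i
      ≡⟨ cong (shift (b * s) P i ℙ.+ shift k P i ℙ.+_) rec ⟩
    shift (b * s) P i ℙ.+ shift k P i ℙ.+ (shift k U i ℙ.+ shift k P i ℙ.+ shift (b * pent⁻ s (suc d)) f i ℙ.+ shift (b * (pent⁻ s (suc d) + (s + suc d + 1))) f i)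
      ≡⟨ ring (P i) _ _ _ _ _ ⟩
    (P i ℙ.+ shift k U i) ℙ.+ (P i ℙ.+ shift (b * s) P i) ℙ.+ shift (b * pent⁻ s (suc d)) f i ℙ.+ shift (b * (pent⁻ s (suc d) + (s + suc d + 1))) f i ∎
    where
    open ≡-Reasoning
    P = prod b s (suc d) f
    U = shanks b (suc s) d f
    U′ = shanks b (suc s) (suc d) f
    k = b * (2 * s + d + 2)
    e₁ : ∀ b s d → b * s + b * (s + suc (suc d)) ≡ b * (2 * s + d + 2)
    e₁ = solve-ℕ
    e₂ : ∀ b s d → b * s + b * (2 * s + suc d + 2) ≡ b * (2 * s + d + 2) + b * suc s
    e₂ = solve-ℕ
    e₃ : ∀ b k x y → b * (k + x + y) ≡ b * k + b * (x + y)
    e₃ = solve-ℕ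
    shift-eq : ∀ j k j′ k′ g → j + k ≡ j′ + k′ → shift j (shift k g) ≗ shift j′ (shift k′ g)
    shift-eq j k j′ k′ g e i = cong (λ h → h i) (trans (shift-shift j k g) (trans (cong (λ x → shift x g) e) (sym (shift-shift j′ k′ g))))
    rec : shift k (shift (b * suc s) U′) i ≡
      shift k U i ℙ.+ shift k P i ℙ.+ shift (b * pent⁻ s (suc d)) f i ℙ.+ shift (b * (pent⁻ s (suc d) + (s + suc d + 1))) f i
    rec = begin
      shift k (shift (b * suc s) U′) i
        ≡⟨ shift-≗ k (shanks-suc b (suc s) d f) i ⟩
      shift k (U ⊕ mul1+ (b * suc s) (prod b (suc s) d f) ⊕ shift (b * p) f ⊕ shift (b * (p + (suc s + d + 1))) f) i
        ≡⟨ shift-⊕₄ k U (mul1+ (b * suc s) (prod b (suc s) d f)) (shift (b * p) f) _ i ⟩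
      shift k U i ℙ.+ shift k (mul1+ (b * suc s) (prod b (suc s) d f)) i ℙ.+ shift k (shift (b * p) f) i ℙ.+ shift k (shift (b * (p + (suc s + d + 1))) f) i
        ≡⟨ cong₂ ℙ._+_ (cong₂ ℙ._+_ (cong (shift k U i ℙ.+_) (shift-≗ k (prod-suc b s d f) i))
             (shift-eq k (b * p) 0 _ f (sym (*-distribˡ-+ b (2 * s + d + 2) p)) i))
             (shift-eq k (b * (p + (suc s + d + 1))) 0 _ f (trans (sym (e₃ b (2 * s + d + 2) p (suc s + d + 1))) (cong (λ x → b * (pent⁻ s (suc d) + x)) (cong (_+ 1) (sym (+-suc s d))))) i) ⟩
      shift k U i ℙ.+ shift k P i ℙ.+ shift (b * pent⁻ s (suc d)) f i ℙ.+ shift (b * (pent⁻ s (suc d) + (s + suc d + 1))) f i ∎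
      where p = pent⁻ (suc s) d
    ring : ∀ x a b c d e → a ℙ.+ b ℙ.+ (c ℙ.+ b ℙ.+ d ℙ.+ e) ≡ (x ℙ.+ c) ℙ.+ (x ℙ.+ a) ℙ.+ d ℙ.+ e
    ring = solve-∀ ℙ-ring

  -- The generalised pentagonal number t(3t+1)/2; `pent⁻ 0 d` is its value at t = -(d+1).
  pent : ℤ → ℕ
  pent (+ zero)  = 0
  pent (+ suc d) = pent⁻ 0 d + suc d
  pent -[1+ d ]  = pent⁻ 0 d

  ∑ : {A : Set} → List A → (A → Parity) → Parity
  ∑ []       φ = 0ℙ
  ∑ (x ∷ xs) φ = φ x ℙ.+ ∑ xs φ

  range : ℕ → List ℤ
  range zero    = + 0 ∷ []
  range (suc d) = + suc d ∷ -[1+ d ] ∷ range d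

  shift-0 : ∀ b f → shift (b * 0) f ≡ f
  shift-0 b f = cong (λ k → shift k f) (*-zeroʳ b)

  shanks-∑ : ∀ b d f i → shanks b 0 d f i ≡ ∑ (range d) (λ t → shift (b * pent t) f i)
  shanks-∑ b zero    f i = trans (cong (λ g → g i) (sym (shift-0 b f))) (sym (ℙ-comm _ 0ℙ))
  shanks-∑ b (suc d) f i = begin
    shanks b 0 (suc d) f i
      ≡⟨ cong (λ g → g i) (shift-0 b _) ⟨
    shift (b * 0) (shanks b 0 (suc d) f) i
      ≡⟨ shanks-suc b 0 d f i ⟩
    S ℙ.+ (prod b 0 d f i ℙ.+ shift (b * 0) (prod b 0 d f) i) ℙ.+ A ℙ.+ shift (b * (pent⁻ 0 d + (d + 1))) f i
      ≡⟨ cong₂ (λ g k → S ℙ.+ (prod b 0 d f i ℙ.+ g i) ℙ.+ A ℙ.+ shift (b * (pent⁻ 0 d + k)) f i) (shift-0 b _) (+-comm d 1) ⟩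
    S ℙ.+ (prod b 0 d f i ℙ.+ prod b 0 d f i) ℙ.+ A ℙ.+ shift (b * pent (+ suc d)) f i
      ≡⟨ ring S (prod b 0 d f i) A _ ⟩
    shift (b * pent (+ suc d)) f i ℙ.+ (A ℙ.+ S)
      ≡⟨ cong (λ x → shift (b * pent (+ suc d)) f i ℙ.+ (A ℙ.+ x)) (shanks-∑ b d f i) ⟩
    ∑ (range (suc d)) (λ t → shift (b * pent t) f i) ∎
    where
    open ≡-Reasoning
    S = shanks b 0 d f i
    A = shift (b * pent⁻ 0 d) f i
    ring : ∀ s p a c → s ℙ.+ (p ℙ.+ p) ℙ.+ a ℙ.+ c ≡ c ℙ.+ (a ℙ.+ s)
    ring = solve-∀ ℙ-ring

  -- The summands r ≥ 1 of Shanks' sum start in degree (b+1)(d+1), beyond d, which leaves the full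
  -- product alone.
  prod≈shanks : ∀ b d f → prod (suc b) 0 d f ≈[ d ] shanks (suc b) 0 d f
  prod≈shanks b zero    f i i≤d = refl
  prod≈shanks b (suc d) f i i≤d = sym (trans (cong (prod (suc b) 0 (suc d) f i ℙ.+_)
    (shift-< (shanks (suc b) 1 d f) (≤-trans (s≤s i≤d) (≤-trans (≤-reflexive (+-comm 2 d)) (m≤n*m (d + 2) (suc b)))))) (ℙ-comm _ 0ℙ))

  -- Both sides multiply an arbitrary series f, so the theorem can be applied to one factor of f₂f₃
  -- while the other is carried along.
  pentagonal : ∀ b d f → prod (suc b) 0 d f ≈[ d ] λ i → ∑ (range d) (λ t → shift (suc b * pent t) f i)
  pentagonal b d f i i≤d = trans (prod≈shanks b d f i i≤d) (shanks-∑ (suc b) d f i)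

  ∑-cong : {A : Set} (xs : List A) {φ ψ : A → Parity} → φ ≗ ψ → ∑ xs φ ≡ ∑ xs ψ
  ∑-cong []       e = refl
  ∑-cong (x ∷ xs) e = cong₂ ℙ._+_ (e x) (∑-cong xs e)

  shift-∑ : {A : Set} (k : ℕ) (xs : List A) (φ : A → Series₂) →
    shift k (λ i → ∑ xs (λ x → φ x i)) ≗ λ i → ∑ xs (λ x → shift k (φ x) i)
  shift-∑ k []       φ i = shift-zero k i
    where
    shift-zero : ∀ k i → shift k (λ _ → 0ℙ) i ≡ 0ℙ
    shift-zero zero    i       = refl
    shift-zero (suc k) zero    = refl
    shift-zero (suc k) (suc i) = shift-zero k i
  shift-∑ k (x ∷ xs) φ i = trans (shift-⊕ k (φ x) _ i) (cong (shift k (φ x) i ℙ.+_) (shift-∑ k xs φ i))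

  pentagonal² : ∀ n → prod 2 0 n (prod 3 0 n one₂) n ≡
    ∑ (range n) (λ s → ∑ (range n) (λ t → shift (2 * pent s + 3 * pent t) one₂ n))
  pentagonal² n = trans (pentagonal 1 n (prod 3 0 n one₂) n ≤-refl) (∑-cong (range n) λ s → begin
    shift (2 * pent s) (prod 3 0 n one₂) n
      ≡⟨ shift-cong (2 * pent s) n (pentagonal 2 n one₂) n ≤-refl ⟩
    shift (2 * pent s) (λ i → ∑ (range n) (λ t → shift (3 * pent t) one₂ i)) n
      ≡⟨ shift-∑ (2 * pent s) (range n) (λ t → shift (3 * pent t) one₂) n ⟩
    ∑ (range n) (λ t → shift (2 * pent s) (shift (3 * pent t) one₂) n)
      ≡⟨ ∑-cong (range n) (λ t → cong (λ g → g n) (shift-shift (2 * pent s) (3 * pent t) one₂)) ⟩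
    ∑ (range n) (λ t → shift (2 * pent s + 3 * pent t) one₂ n) ∎)
    where open ≡-Reasoning

-- Parities of `a₁` and of the bipartition count.

module PartitionParity where

  open import Defs
  open SeriesMod2
  open import Data.Bool using (Bool; true; false; if_then_else_; _∧_)
  open import Data.Nat using (ℕ; zero; suc; _+_; _*_; _∸_; _≤_; z≤n; s≤s; parity; _≤ᵇ_; _≤?_)
  open import Data.Nat.Properties
  open import Data.Nat.Divisibility using (_∣_; _∣?_; divides; ∣m+n∣m⇒∣n; ∣⇒≤)
  open import Data.Integer as ℤ using (ℤ; +_; -[1+_]; ∣_∣)
  import Data.Integer.Properties as ℤ
  open import Data.List using (List; []; _∷_; _++_; map; concatMap; length; filterᵇ; upTo; applyUpTo; replicate)
  open import Data.Parity.Base as ℙ using (Parity; 0ℙ; 1ℙ)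
  open import Data.Parity.Properties using (+-homo-+) renaming (+-comm to ℙ-comm; +-assoc to ℙ-assoc; *-zeroʳ to ℙ-*-zeroʳ; *-comm to ℙ-*-comm; *-distribˡ-+ to ℙ-distribˡ; *-distribʳ-+ to ℙ-distribʳ)
  open import Relation.Nullary using (¬_; Dec; yes; no; contradiction)
  open import Relation.Nullary.Decidable using (dec-true; dec-false)
  open import Tactic.RingSolver using (solve-∀)
  open import Function using (_∘_)
  open import Relation.Binary.PropositionalEquality using (_≡_; _≗_; refl; sym; trans; cong; cong₂; subst; module ≡-Reasoning)

  parityℤ : ℤ → Parity
  parityℤ z = parity ∣ z ∣

  parity-⊖ : ∀ m n → parityℤ (m ℤ.⊖ n) ≡ parity m ℙ.+ parity n
  parity-⊖ zero zero = refl
  parity-⊖ zero (suc n) = refl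
  parity-⊖ (suc m) zero = sym (ℙ-comm _ 0ℙ)
  parity-⊖ (suc m) (suc n) = begin
    parityℤ (suc m ℤ.⊖ suc n)          ≡⟨ cong parityℤ (ℤ.[1+m]⊖[1+n]≡m⊖n m n) ⟩
    parityℤ (m ℤ.⊖ n)                  ≡⟨ parity-⊖ m n ⟩
    parity m ℙ.+ parity n              ≡⟨ ring (parity m) (parity n) ⟩
    (1ℙ ℙ.+ parity m) ℙ.+ (1ℙ ℙ.+ parity n) ≡⟨ cong₂ ℙ._+_ (+-homo-+ 1 m) (+-homo-+ 1 n) ⟨
    parity (suc m) ℙ.+ parity (suc n)  ∎
    where
    open ≡-Reasoning
    ring : ∀ a b → a ℙ.+ b ≡ (1ℙ ℙ.+ a) ℙ.+ (1ℙ ℙ.+ b)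
    ring = solve-∀ ℙ-ring

  parityℤ-+ : ∀ x y → parityℤ (x ℤ.+ y) ≡ parityℤ x ℙ.+ parityℤ y
  parityℤ-+ (+ m)    (+ n)    = +-homo-+ m n
  parityℤ-+ (+ m)    -[1+ n ] = parity-⊖ m (suc n)
  parityℤ-+ -[1+ m ] (+ n)    = trans (parity-⊖ n (suc m)) (ℙ-comm (parity n) _)
  parityℤ-+ -[1+ m ] -[1+ n ] = trans (cong parity (cong suc (sym (+-suc m n)))) (+-homo-+ (suc m) (suc n))

  parityℤ-- : ∀ x y → parityℤ (x ℤ.- y) ≡ parityℤ x ℙ.+ parityℤ y
  parityℤ-- x y = trans (parityℤ-+ x (ℤ.- y)) (cong (λ z → parityℤ x ℙ.+ parity z) (ℤ.∣-i∣≡∣i∣ y))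

  ≤ᵇ-false : ∀ {m n} → ¬ (m ≤ n) → (m ≤ᵇ n) ≡ false
  ≤ᵇ-false {m} {n} m≰n = dec-false (m ≤? n) m≰n

  ≤ᵇ-true : ∀ {m n} → m ≤ n → (m ≤ᵇ n) ≡ true
  ≤ᵇ-true {m} {n} m≤n = dec-true (m ≤? n) m≤n

  parity-mul1m : ∀ k (f : Series) → parityℤ ∘ mul1m k f ≗ mul1+ k (parityℤ ∘ f)
  parity-mul1m k f n = trans (parityℤ-- (f n) _) (cong (parityℤ (f n) ℙ.+_) tail)
    where
    tail : parityℤ (if k ≤ᵇ n then f (n ∸ k) else ℤ.0ℤ) ≡ shift k (parityℤ ∘ f) n
    tail with k ≤? n
    ... | yes k≤n rewrite ≤ᵇ-true k≤n = sym (trans (cong (shift k (parityℤ ∘ f)) (sym (m+[n∸m]≡n k≤n))) (shift-+ k (n ∸ k) _))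
    ... | no k≰n rewrite ≤ᵇ-false k≰n = sym (shift-< _ (≰⇒> k≰n))

  -- Signs disappear modulo 2 and each squared factor (1 - q^k)² becomes 1 + q^(2k), already at the
  -- level of truncated products.
  parity-prodA : ∀ m (f : Series) → parityℤ ∘ prodA m f ≗ prod 2 0 m (prod 3 0 m (parityℤ ∘ f))
  parity-prodA zero    f i = refl
  parity-prodA (suc m) f i = begin
    parityℤ (prodA (suc m) f i)
      ≡⟨ parity-mul1m (suc m) (mul1m (suc m) g₃) i ⟩
    mul1+ (suc m) (parityℤ ∘ mul1m (suc m) g₃) i
      ≡⟨ mul1+-≗ (suc m) (parity-mul1m (suc m) g₃) i ⟩
    mul1+ (suc m) (mul1+ (suc m) (parityℤ ∘ g₃)) i
      ≡⟨ mul1+-square (suc m) (parityℤ ∘ g₃) i ⟩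
    mul1+ (suc m + suc m) (parityℤ ∘ g₃) i
      ≡⟨ cong (λ k → mul1+ k (parityℤ ∘ g₃) i) (cong (λ k → suc m + k) (sym (+-identityʳ (suc m)))) ⟩
    mul1+ (2 * suc m) (parityℤ ∘ g₃) i
      ≡⟨ mul1+-≗ (2 * suc m) (parity-mul1m (3 * suc m) (prodA m f)) i ⟩
    mul1+ (2 * suc m) (mul1+ (3 * suc m) (parityℤ ∘ prodA m f)) i
      ≡⟨ mul1+-≗ (2 * suc m) (mul1+-≗ (3 * suc m) (parity-prodA m f)) i ⟩
    mul1+ (2 * suc m) (mul1+ (3 * suc m) (prod 2 0 m (prod 3 0 m (parityℤ ∘ f)))) i
      ≡⟨ mul1+-≗ (2 * suc m) (prod-mul1+ 2 0 m (3 * suc m) (prod 3 0 m (parityℤ ∘ f))) i ⟨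
    prod 2 0 (suc m) (prod 3 0 (suc m) (parityℤ ∘ f)) i ∎
    where
    open ≡-Reasoning
    g₃ = mul1m (3 * suc m) (prodA m f)

  parity-a₁ : ∀ n → parityℤ (a₁ n) ≡ prod 2 0 n (prod 3 0 n one₂) n
  parity-a₁ n = trans (parity-prodA n one n) (prod-≗ 2 0 n (prod-≗ 3 0 n parity-one) n)
    where
    parity-one : parityℤ ∘ one ≗ one₂
    parity-one zero    = refl
    parity-one (suc _) = refl

  -- Generating functions of restricted partitions.

  bit : Bool → Parity
  bit true  = 1ℙ
  bit false = 0ℙ

  bit-∧ : ∀ a b → bit (a ∧ b) ≡ bit a ℙ.* bit b
  bit-∧ true  b = refl
  bit-∧ false b = refl

  ∑-++ : {A : Set} (xs ys : List A) (φ : A → Parity) → ∑ (xs ++ ys) φ ≡ ∑ xs φ ℙ.+ ∑ ys φ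
  ∑-++ []       ys φ = refl
  ∑-++ (x ∷ xs) ys φ = trans (cong (φ x ℙ.+_) (∑-++ xs ys φ)) (sym (ℙ-assoc (φ x) _ _))

  ∑-concatMap : {A C : Set} (h : A → List C) (xs : List A) (φ : C → Parity) → ∑ (concatMap h xs) φ ≡ ∑ xs (λ x → ∑ (h x) φ)
  ∑-concatMap h []       φ = refl
  ∑-concatMap h (x ∷ xs) φ = trans (∑-++ (h x) _ φ) (cong (∑ (h x) φ ℙ.+_) (∑-concatMap h xs φ))

  ∑-map : {A C : Set} (h : A → C) (xs : List A) (φ : C → Parity) → ∑ (map h xs) φ ≡ ∑ xs (φ ∘ h)
  ∑-map h []       φ = refl
  ∑-map h (x ∷ xs) φ = cong (φ (h x) ℙ.+_) (∑-map h xs φ)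

  ∑-filterᵇ : {A : Set} (p : A → Bool) (xs : List A) (φ : A → Parity) → ∑ (filterᵇ p xs) φ ≡ ∑ xs (λ x → bit (p x) ℙ.* φ x)
  ∑-filterᵇ p []       φ = refl
  ∑-filterᵇ p (x ∷ xs) φ with p x
  ... | true  = cong (φ x ℙ.+_) (∑-filterᵇ p xs φ)
  ... | false = ∑-filterᵇ p xs φ

  parity-length-filterᵇ : {A : Set} (p : A → Bool) (xs : List A) → parity (length (filterᵇ p xs)) ≡ ∑ xs (bit ∘ p)
  parity-length-filterᵇ p []       = refl
  parity-length-filterᵇ p (x ∷ xs) with p x
  ... | true  = trans (+-homo-+ 1 (length (filterᵇ p xs))) (cong (1ℙ ℙ.+_) (parity-length-filterᵇ p xs))
  ... | false = parity-length-filterᵇ p xs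

  ∑-*ˡ : {A : Set} (c : Parity) (xs : List A) (φ : A → Parity) → ∑ xs (λ x → c ℙ.* φ x) ≡ c ℙ.* ∑ xs φ
  ∑-*ˡ c []       φ = sym (ℙ-*-zeroʳ c)
  ∑-*ˡ c (x ∷ xs) φ = trans (cong (c ℙ.* φ x ℙ.+_) (∑-*ˡ c xs φ)) (sym (ℙ-distribˡ c _ _))

  ∑< : ℕ → (ℕ → Parity) → Parity
  ∑< zero    φ = 0ℙ
  ∑< (suc n) φ = φ 0 ℙ.+ ∑< n (φ ∘ suc)

  ∑-applyUpTo : {A : Set} (h : ℕ → A) (n : ℕ) (φ : A → Parity) → ∑ (applyUpTo h n) φ ≡ ∑< n (φ ∘ h)
  ∑-applyUpTo h zero    φ = refl
  ∑-applyUpTo h (suc n) φ = cong (φ (h 0) ℙ.+_) (∑-applyUpTo (h ∘ suc) n φ)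

  ∑<-cong : ∀ n {φ ψ} → φ ≗ ψ → ∑< n φ ≡ ∑< n ψ
  ∑<-cong zero    e = refl
  ∑<-cong (suc n) e = cong₂ ℙ._+_ (e 0) (∑<-cong n (e ∘ suc))

  ∑<-zero : ∀ n {φ} → (∀ i → φ i ≡ 0ℙ) → ∑< n φ ≡ 0ℙ
  ∑<-zero zero    e = refl
  ∑<-zero (suc n) e = cong₂ ℙ._+_ (e 0) (∑<-zero n (e ∘ suc))

  ∑<-extend : ∀ m k {φ} → (∀ i → m ≤ i → φ i ≡ 0ℙ) → ∑< (m + k) φ ≡ ∑< m φ
  ∑<-extend zero    k e = ∑<-zero k (λ i → e i z≤n)
  ∑<-extend (suc m) k {φ} e = cong (φ 0 ℙ.+_) (∑<-extend m k (λ i m≤i → e (suc i) (s≤s m≤i)))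

  -- For fixed k this is, modulo 2, the product of the series 1/(1 - q^j) over the j ≤ k not
  -- divisible by u.
  partitionGF : ℕ → ℕ → Series₂
  partitionGF u k m = ∑ (partsLE k m) (bit ∘ noPartDiv u)

  noPartDiv-replicate-∣ : ∀ {u x} c r → u ∣ x → noPartDiv u (replicate (suc c) x ++ r) ≡ false
  noPartDiv-replicate-∣ {u} {x} c r u∣x rewrite dec-true (u ∣? x) u∣x = refl

  noPartDiv-replicate-∤ : ∀ {u x} c r → ¬ (u ∣ x) → noPartDiv u (replicate c x ++ r) ≡ noPartDiv u r
  noPartDiv-replicate-∤ zero r u∤x = refl
  noPartDiv-replicate-∤ {u} {x} (suc c) r u∤x rewrite dec-false (u ∣? x) u∤x = noPartDiv-replicate-∤ c r u∤x

  partitionGF-suc : ∀ u k m → partitionGF u (suc k) m ≡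
    ∑< (suc m) (λ c → bit (c * suc k ≤ᵇ m) ℙ.* ∑ (partsLE k (m ∸ c * suc k)) (λ r → bit (noPartDiv u (replicate c (suc k) ++ r))))
  partitionGF-suc u k m = begin
    ∑ (concatMap h (filterᵇ p (upTo (suc m)))) φ            ≡⟨ ∑-concatMap h (filterᵇ p (upTo (suc m))) φ ⟩
    ∑ (filterᵇ p (upTo (suc m))) (λ c → ∑ (h c) φ)          ≡⟨ ∑-filterᵇ p (upTo (suc m)) (λ c → ∑ (h c) φ) ⟩
    ∑ (upTo (suc m)) (λ c → bit (p c) ℙ.* ∑ (h c) φ)        ≡⟨ ∑-applyUpTo (λ c → c) (suc m) (λ c → bit (p c) ℙ.* ∑ (h c) φ) ⟩
    ∑< (suc m) (λ c → bit (p c) ℙ.* ∑ (h c) φ)              ≡⟨ ∑<-cong (suc m) (λ c → cong (bit (p c) ℙ.*_) (∑-map (replicate c (suc k) ++_) (partsLE k (m ∸ c * suc k)) φ)) ⟩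
    _ ∎
    where
    open ≡-Reasoning
    p = λ c → c * suc k ≤ᵇ m
    h = λ c → map (replicate c (suc k) ++_) (partsLE k (m ∸ c * suc k))
    φ = bit ∘ noPartDiv u

  ∑-zero : {A : Set} (xs : List A) {φ : A → Parity} → (∀ x → φ x ≡ 0ℙ) → ∑ xs φ ≡ 0ℙ
  ∑-zero []       e = refl
  ∑-zero (x ∷ xs) e = cong₂ ℙ._+_ (e x) (∑-zero xs e)

  -- A single part k + 1 divisible by u rules the partition out, so only multiplicity c = 0
  -- survives.
  partitionGF-∣ : ∀ {u k} → u ∣ suc k → partitionGF u (suc k) ≗ partitionGF u k
  partitionGF-∣ {u} {k} u∣ m = trans (partitionGF-suc u k m) (trans
    (cong (partitionGF u k m ℙ.+_) (∑<-zero m (λ c → trans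
      (cong (bit (suc c * suc k ≤ᵇ m) ℙ.*_) (∑-zero (partsLE k (m ∸ suc c * suc k)) (λ r → cong bit (noPartDiv-replicate-∣ {u} c r u∣))))
      (ℙ-*-zeroʳ _))))
    (ℙ-comm _ 0ℙ))

  -- The quotient of g by 1 - q^(k+1), written as a geometric series.
  ∑multiples : Series₂ → ℕ → ℕ → Parity
  ∑multiples g k m = ∑< (suc m) (λ c → bit (c * suc k ≤ᵇ m) ℙ.* g (m ∸ c * suc k))

  +-≤ᵇ : ∀ k x y → (k + x ≤ᵇ k + y) ≡ (x ≤ᵇ y)
  +-≤ᵇ k x y with x ≤? y
  ... | yes x≤y = trans (≤ᵇ-true (+-monoʳ-≤ k x≤y)) (sym (≤ᵇ-true x≤y))
  ... | no x≰y = trans (≤ᵇ-false (x≰y ∘ +-cancelˡ-≤ k x y)) (sym (≤ᵇ-false x≰y))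

  -- Apart from c = 0 the terms form the same sum for m′ = m - (k+1). The ranges of c differ by k
  -- terms, which vanish because c > m′ makes c(k+1) exceed m′.
  ∑multiples-step : ∀ g k m → ∑multiples g k m ≡ g m ℙ.+ shift (suc k) (∑multiples g k) m
  ∑multiples-step g k m with suc k ≤? m
  ... | no k≰m = cong (g m ℙ.+_) (trans (∑<-zero m (λ c → cong (λ b → bit b ℙ.* g (m ∸ suc c * suc k))
      (≤ᵇ-false (λ le → k≰m (≤-trans (m≤m+n (suc k) (c * suc k)) le))))) (sym (shift-< (∑multiples g k) (≰⇒> k≰m))))
  ... | yes k≤m with m ∸ suc k | m+[n∸m]≡n k≤m
  ... | m′ | refl = cong (g (suc k + m′) ℙ.+_) (begin
    ∑< (suc k + m′) (λ c → bit (suc k + c * suc k ≤ᵇ suc k + m′) ℙ.* g (suc k + m′ ∸ (suc k + c * suc k)))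
      ≡⟨ ∑<-cong (suc k + m′) (λ c → cong₂ (λ b x → bit b ℙ.* g x) (+-≤ᵇ (suc k) (c * suc k) m′) ([m+n]∸[m+o]≡n∸o (suc k) m′ (c * suc k))) ⟩
    ∑< (suc k + m′) φ
      ≡⟨ cong (λ n → ∑< n φ) (trans (cong suc (+-comm k m′)) refl) ⟩
    ∑< (suc m′ + k) φ
      ≡⟨ ∑<-extend (suc m′) k (λ c m′<c → cong (λ b → bit b ℙ.* g (m′ ∸ c * suc k))
           (≤ᵇ-false (<⇒≱ (≤-trans m′<c (m≤m*n c (suc k)))))) ⟩
    ∑multiples g k m′
      ≡⟨ shift-+ (suc k) m′ (∑multiples g k) ⟨
    shift (suc k) (∑multiples g k) (suc k + m′) ∎)
    where
    open ≡-Reasoning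
    φ = λ c → bit (c * suc k ≤ᵇ m′) ℙ.* g (m′ ∸ c * suc k)

  partitionGF-∤ : ∀ {u k} → ¬ (u ∣ suc k) → mul1+ (suc k) (partitionGF u (suc k)) ≗ partitionGF u k
  partitionGF-∤ {u} {k} u∤ m = trans
    (cong₂ ℙ._+_ (trans (multiples m) (∑multiples-step (partitionGF u k) k m)) (shift-≗ (suc k) multiples m))
    (ring (partitionGF u k m) (shift (suc k) (∑multiples (partitionGF u k) k) m))
    where
    multiples : partitionGF u (suc k) ≗ ∑multiples (partitionGF u k) k
    multiples m = trans (partitionGF-suc u k m) (∑<-cong (suc m) (λ c → cong (bit (c * suc k ≤ᵇ m) ℙ.*_)
      (∑-cong (partsLE k (m ∸ c * suc k)) (λ r → cong bit (noPartDiv-replicate-∤ {u} c r u∤)))))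
    ring : ∀ a b → a ℙ.+ b ℙ.+ b ≡ a
    ring = solve-∀ ℙ-ring

  -- The factors 1 + q^j with j ≤ k not divisible by u, whose product inverts `partitionGF`. The
  -- complementary factors are in `multiplesProd`, so quotients such as f₄/f₁ are handled without
  -- dividing series.
  partsProd : ℕ → ℕ → Series₂ → Series₂
  partsProd u zero    f = f
  partsProd u (suc k) f with u ∣? suc k
  ... | yes _ = partsProd u k f
  ... | no  _ = mul1+ (suc k) (partsProd u k f)

  multiplesProd : ℕ → ℕ → Series₂ → Series₂
  multiplesProd u zero    f = f
  multiplesProd u (suc k) f with u ∣? suc k
  ... | yes _ = mul1+ (suc k) (multiplesProd u k f)
  ... | no  _ = multiplesProd u k f

  partsProd-≗ : ∀ u k {f g} → f ≗ g → partsProd u k f ≗ partsProd u k g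
  partsProd-≗ u zero    e = e
  partsProd-≗ u (suc k) e with u ∣? suc k
  ... | yes _ = partsProd-≗ u k e
  ... | no  _ = mul1+-≗ (suc k) (partsProd-≗ u k e)

  multiplesProd-≈ : ∀ u k {f g n} → f ≈[ n ] g → multiplesProd u k f ≈[ n ] multiplesProd u k g
  multiplesProd-≈ u zero    e = e
  multiplesProd-≈ u (suc k) e with u ∣? suc k
  ... | yes _ = mul1+-cong (suc k) _ (multiplesProd-≈ u k e)
  ... | no  _ = multiplesProd-≈ u k e

  multiplesProd-≗ : ∀ u k {f g} → f ≗ g → multiplesProd u k f ≗ multiplesProd u k g
  multiplesProd-≗ u k e i = multiplesProd-≈ u k (≗⇒≈ e) i ≤-refl

  partsProd-mul1+ : ∀ u k j f → partsProd u k (mul1+ j f) ≗ mul1+ j (partsProd u k f)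
  partsProd-mul1+ u zero    j f i = refl
  partsProd-mul1+ u (suc k) j f i with u ∣? suc k
  ... | yes _ = partsProd-mul1+ u k j f i
  ... | no  _ = trans (mul1+-≗ (suc k) (partsProd-mul1+ u k j f) i) (mul1+-comm (suc k) j (partsProd u k f) i)

  multiplesProd-mul1+ : ∀ u k j f → multiplesProd u k (mul1+ j f) ≗ mul1+ j (multiplesProd u k f)
  multiplesProd-mul1+ u zero    j f i = refl
  multiplesProd-mul1+ u (suc k) j f i with u ∣? suc k
  ... | no  _ = multiplesProd-mul1+ u k j f i
  ... | yes _ = trans (mul1+-≗ (suc k) (multiplesProd-mul1+ u k j f) i) (mul1+-comm (suc k) j (multiplesProd u k f) i)

  partsProd-partitionGF : ∀ u k → partsProd u k (partitionGF u k) ≗ one₂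
  partsProd-partitionGF u zero zero    = refl
  partsProd-partitionGF u zero (suc m) = refl
  partsProd-partitionGF u (suc k) m with u ∣? suc k
  ... | yes u∣ = trans (partsProd-≗ u k (partitionGF-∣ u∣) m) (partsProd-partitionGF u k m)
  ... | no u∤ = trans (sym (partsProd-mul1+ u k (suc k) (partitionGF u (suc k)) m))
    (trans (partsProd-≗ u k (partitionGF-∤ u∤) m) (partsProd-partitionGF u k m))

  multiplesProd-partsProd : ∀ u k f → multiplesProd u k (partsProd u k f) ≗ prod 1 0 k f
  multiplesProd-partsProd u zero    f i = refl
  multiplesProd-partsProd u (suc k) f i rewrite +-identityʳ k with u ∣? suc k
  ... | yes _ = mul1+-≗ (suc k) (multiplesProd-partsProd u k f) i
  ... | no  _ = trans (multiplesProd-mul1+ u k (suc k) (partsProd u k f) i) (mul1+-≗ (suc k) (multiplesProd-partsProd u k f) i)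

  -- None of the next u indices after a multiple of u + 1 is again a multiple.
  multiplesProd-block : ∀ u q r f → multiplesProd (suc u) (suc u * q) f ≗ prod (suc u) 0 q f →
    r ≤ u → multiplesProd (suc u) (r + suc u * q) f ≗ prod (suc u) 0 q f
  multiplesProd-block u q zero    f e r≤u i = e i
  multiplesProd-block u q (suc r) f e r<u i with suc u ∣? suc (r + suc u * q)
  ... | no  _ = multiplesProd-block u q r f e (≤-trans (n≤1+n r) r<u) i
  ... | yes d = contradiction (≤-trans (∣⇒≤ (∣m+n∣m⇒∣n (subst (suc u ∣_) (+-comm (suc r) (suc u * q)) d) (divides q (*-comm (suc u) q)))) r<u) (<⇒≱ ≤-refl)

  multiplesProd-* : ∀ u q f → multiplesProd (suc u) (suc u * q) f ≗ prod (suc u) 0 q f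
  multiplesProd-* u zero    f i = cong (λ k → multiplesProd (suc u) k f i) (*-zeroʳ u)
  multiplesProd-* u (suc q) f i = trans (cong (λ k → multiplesProd (suc u) k f i) (*-suc (suc u) q)) step
    where
    step : multiplesProd (suc u) (suc (u + suc u * q)) f i ≡ prod (suc u) 0 (suc q) f i
    step with suc u ∣? suc (u + suc u * q)
    ... | no ¬d = contradiction (divides (suc q) (trans (sym (*-suc (suc u) q)) (*-comm (suc u) (suc q)))) ¬d
    ... | yes _ = trans (cong (λ k → mul1+ k (multiplesProd (suc u) (u + suc u * q) f) i) (sym (*-suc (suc u) q)))
                        (mul1+-≗ (suc u * suc q) (multiplesProd-block u q u f (multiplesProd-* u q f) ≤-refl) i)

  multiplesProd-extend : ∀ u n k f → multiplesProd u (k + n) f ≈[ n ] multiplesProd u n f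
  multiplesProd-extend u n zero    f i i≤n = refl
  multiplesProd-extend u n (suc k) f i i≤n with u ∣? suc (k + n)
  ... | no  _ = multiplesProd-extend u n k f i i≤n
  ... | yes _ = trans (mul1+-> (suc (k + n)) (multiplesProd u (k + n) f) (s≤s (m≤n+m n k)) i i≤n) (multiplesProd-extend u n k f i i≤n)

  -- Raising the index bound from n to (u+1)n adds only factors invisible up to degree n, and at
  -- that bound the multiples of u + 1 are exactly the indices in `prod`.
  multiplesProd≈prod : ∀ u n f → multiplesProd (suc u) n f ≈[ n ] prod (suc u) 0 n f
  multiplesProd≈prod u n f i i≤n = trans (sym (multiplesProd-extend (suc u) n (u * n) f i i≤n))
    (trans (cong (λ k → multiplesProd (suc u) k f i) (+-comm (u * n) n)) (multiplesProd-* u n f i))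

  -- Cauchy products and the parity of `B 4 3`.

  conv : Series₂ → Series₂ → Series₂
  conv f g zero    = f 0 ℙ.* g 0
  conv f g (suc n) = f 0 ℙ.* g (suc n) ℙ.+ conv (f ∘ suc) g n

  conv-≗ : ∀ {f g f′ g′} → f ≗ f′ → g ≗ g′ → conv f g ≗ conv f′ g′
  conv-≗ e e′ zero    = cong₂ ℙ._*_ (e 0) (e′ 0)
  conv-≗ e e′ (suc n) = cong₂ ℙ._+_ (cong₂ ℙ._*_ (e 0) (e′ (suc n))) (conv-≗ (e ∘ suc) e′ n)

  conv-⊕ˡ : ∀ f f′ g → conv (f ⊕ f′) g ≗ conv f g ⊕ conv f′ g
  conv-⊕ˡ f f′ g zero    = ℙ-distribʳ (g 0) (f 0) (f′ 0)
  conv-⊕ˡ f f′ g (suc n) = trans (cong₂ ℙ._+_ (ℙ-distribʳ (g (suc n)) (f 0) (f′ 0)) (conv-⊕ˡ (f ∘ suc) (f′ ∘ suc) g n))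
    (interchange (f 0 ℙ.* g (suc n)) (f′ 0 ℙ.* g (suc n)) _ _)
    where
    interchange : ∀ a b c d → a ℙ.+ b ℙ.+ (c ℙ.+ d) ≡ a ℙ.+ c ℙ.+ (b ℙ.+ d)
    interchange = solve-∀ ℙ-ring

  conv-⊕ʳ : ∀ f g g′ → conv f (g ⊕ g′) ≗ conv f g ⊕ conv f g′
  conv-⊕ʳ f g g′ zero    = ℙ-distribˡ (f 0) (g 0) (g′ 0)
  conv-⊕ʳ f g g′ (suc n) = trans (cong₂ ℙ._+_ (ℙ-distribˡ (f 0) (g (suc n)) (g′ (suc n))) (conv-⊕ʳ (f ∘ suc) g g′ n))
    (interchange (f 0 ℙ.* g (suc n)) (f 0 ℙ.* g′ (suc n)) _ _)
    where
    interchange : ∀ a b c d → a ℙ.+ b ℙ.+ (c ℙ.+ d) ≡ a ℙ.+ c ℙ.+ (b ℙ.+ d)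
    interchange = solve-∀ ℙ-ring

  conv-shift₁ˡ : ∀ f g → conv (shift₁ f) g ≗ shift₁ (conv f g)
  conv-shift₁ˡ f g zero    = refl
  conv-shift₁ˡ f g (suc n) = refl

  conv-shift₁ʳ : ∀ f g → conv f (shift₁ g) ≗ shift₁ (conv f g)
  conv-shift₁ʳ f g zero          = ℙ-*-zeroʳ (f 0)
  conv-shift₁ʳ f g (suc zero)    = trans (cong (f 0 ℙ.* g 0 ℙ.+_) (ℙ-*-zeroʳ (f 1))) (ℙ-comm _ 0ℙ)
  conv-shift₁ʳ f g (suc (suc n)) = cong (f 0 ℙ.* g (suc n) ℙ.+_) (conv-shift₁ʳ (f ∘ suc) g (suc n))

  conv-shiftˡ : ∀ k f g → conv (shift k f) g ≗ shift k (conv f g)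
  conv-shiftˡ zero    f g i = refl
  conv-shiftˡ (suc k) f g i = trans (conv-shift₁ˡ (shift k f) g i) (shift-≗ 1 (conv-shiftˡ k f g) i)

  conv-shiftʳ : ∀ k f g → conv f (shift k g) ≗ shift k (conv f g)
  conv-shiftʳ zero    f g i = refl
  conv-shiftʳ (suc k) f g i = trans (conv-shift₁ʳ f (shift k g) i) (shift-≗ 1 (conv-shiftʳ k f g) i)

  conv-mul1+ˡ : ∀ k f g → conv (mul1+ k f) g ≗ mul1+ k (conv f g)
  conv-mul1+ˡ k f g i = trans (conv-⊕ˡ f (shift k f) g i) (cong (conv f g i ℙ.+_) (conv-shiftˡ k f g i))

  conv-mul1+ʳ : ∀ k f g → conv f (mul1+ k g) ≗ mul1+ k (conv f g)
  conv-mul1+ʳ k f g i = trans (conv-⊕ʳ f g (shift k g) i) (cong (conv f g i ℙ.+_) (conv-shiftʳ k f g i))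

  conv-partsProdˡ : ∀ u k f g → conv (partsProd u k f) g ≗ partsProd u k (conv f g)
  conv-partsProdˡ u zero    f g i = refl
  conv-partsProdˡ u (suc k) f g i with u ∣? suc k
  ... | yes _ = conv-partsProdˡ u k f g i
  ... | no  _ = trans (conv-mul1+ˡ (suc k) (partsProd u k f) g i) (mul1+-≗ (suc k) (conv-partsProdˡ u k f g) i)

  conv-partsProdʳ : ∀ u k f g → conv f (partsProd u k g) ≗ partsProd u k (conv f g)
  conv-partsProdʳ u zero    f g i = refl
  conv-partsProdʳ u (suc k) f g i with u ∣? suc k
  ... | yes _ = conv-partsProdʳ u k f g i
  ... | no  _ = trans (conv-mul1+ʳ (suc k) f (partsProd u k g) i) (mul1+-≗ (suc k) (conv-partsProdʳ u k f g) i)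

  conv-one : ∀ g → conv one₂ g ≗ g
  conv-one g zero    = refl
  conv-one g (suc n) = trans (cong (g (suc n) ℙ.+_) (conv-zero n)) (ℙ-comm _ 0ℙ)
    where
    conv-zero : ∀ n → conv (λ _ → 0ℙ) g n ≡ 0ℙ
    conv-zero zero    = refl
    conv-zero (suc n) = conv-zero n

  prod-cancel : ∀ b d {f g n} → prod (suc b) 0 d f ≈[ n ] prod (suc b) 0 d g → f ≈[ n ] g
  prod-cancel b zero    e = e
  prod-cancel b (suc d) e = prod-cancel b d (mul1+-cancel (d + b * suc d) e)

  prod-square : ∀ b d f → prod b 0 d (prod b 0 d f) ≗ prod (b + b) 0 d f
  prod-square b zero    f i = refl
  prod-square b (suc d) f i = begin
    mul1+ (b * suc d) (prod b 0 d (mul1+ (b * suc d) (prod b 0 d f))) i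
      ≡⟨ mul1+-≗ (b * suc d) (prod-mul1+ b 0 d (b * suc d) (prod b 0 d f)) i ⟩
    mul1+ (b * suc d) (mul1+ (b * suc d) (prod b 0 d (prod b 0 d f))) i
      ≡⟨ mul1+-square (b * suc d) (prod b 0 d (prod b 0 d f)) i ⟩
    mul1+ (b * suc d + b * suc d) (prod b 0 d (prod b 0 d f)) i
      ≡⟨ cong (λ k → mul1+ k (prod b 0 d (prod b 0 d f)) i) (*-distribʳ-+ (suc d) b b) ⟨
    mul1+ ((b + b) * suc d) (prod b 0 d (prod b 0 d f)) i
      ≡⟨ mul1+-≗ ((b + b) * suc d) (prod-square b d f) i ⟩
    prod (b + b) 0 (suc d) f i ∎
    where open ≡-Reasoning

  multiplesProd-prod : ∀ u k b d f → multiplesProd u k (prod b 0 d f) ≗ prod b 0 d (multiplesProd u k f)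
  multiplesProd-prod u k b zero    f i = refl
  multiplesProd-prod u k b (suc d) f i = trans (multiplesProd-mul1+ u k (b * suc d) (prod b 0 d f) i)
    (mul1+-≗ (b * suc d) (multiplesProd-prod u k b d f) i)

  -- Multiplying by f₁² turns the generating function f₄f₃/f₁² into f₄f₃ ≡ f₂²f₃.
  conv-partitionGF : ∀ n → conv (partitionGF 4 n) (partitionGF 3 n) ≈[ n ] prod 2 0 n (prod 3 0 n one₂)
  conv-partitionGF n = prod-cancel 1 n (≈-trans (≗⇒≈ lhs) (≈-sym rhs))
    where
    C = conv (partitionGF 4 n) (partitionGF 3 n)
    partsProd-C : partsProd 4 n (partsProd 3 n C) ≗ one₂
    partsProd-C i = begin
      partsProd 4 n (partsProd 3 n C) i
        ≡⟨ partsProd-≗ 4 n (conv-partsProdʳ 3 n (partitionGF 4 n) (partitionGF 3 n)) i ⟨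
      partsProd 4 n (conv (partitionGF 4 n) (partsProd 3 n (partitionGF 3 n))) i
        ≡⟨ conv-partsProdˡ 4 n (partitionGF 4 n) _ i ⟨
      conv (partsProd 4 n (partitionGF 4 n)) (partsProd 3 n (partitionGF 3 n)) i
        ≡⟨ conv-≗ (partsProd-partitionGF 4 n) (partsProd-partitionGF 3 n) i ⟩
      conv one₂ one₂ i
        ≡⟨ conv-one one₂ i ⟩
      one₂ i ∎
      where open ≡-Reasoning
    lhs : prod 2 0 n C ≗ multiplesProd 3 n (multiplesProd 4 n one₂)
    lhs i = begin
      prod 2 0 n C i
        ≡⟨ prod-square 1 n C i ⟨
      prod 1 0 n (prod 1 0 n C) i
        ≡⟨ prod-≗ 1 0 n (multiplesProd-partsProd 3 n C) i ⟨
      prod 1 0 n (multiplesProd 3 n (partsProd 3 n C)) i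
        ≡⟨ multiplesProd-prod 3 n 1 n (partsProd 3 n C) i ⟨
      multiplesProd 3 n (prod 1 0 n (partsProd 3 n C)) i
        ≡⟨ multiplesProd-≗ 3 n (multiplesProd-partsProd 4 n (partsProd 3 n C)) i ⟨
      multiplesProd 3 n (multiplesProd 4 n (partsProd 4 n (partsProd 3 n C))) i
        ≡⟨ multiplesProd-≗ 3 n (multiplesProd-≗ 4 n partsProd-C) i ⟩
      multiplesProd 3 n (multiplesProd 4 n one₂) i ∎
      where open ≡-Reasoning
    rhs : prod 2 0 n (prod 2 0 n (prod 3 0 n one₂)) ≈[ n ] multiplesProd 3 n (multiplesProd 4 n one₂)
    rhs i i≤n = begin
      prod 2 0 n (prod 2 0 n (prod 3 0 n one₂)) i
        ≡⟨ prod-square 2 n (prod 3 0 n one₂) i ⟩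
      prod 4 0 n (prod 3 0 n one₂) i
        ≡⟨ prod-cong 4 0 n (multiplesProd≈prod 2 n one₂) i i≤n ⟨
      prod 4 0 n (multiplesProd 3 n one₂) i
        ≡⟨ multiplesProd-prod 3 n 4 n one₂ i ⟨
      multiplesProd 3 n (prod 4 0 n one₂) i
        ≡⟨ multiplesProd-≈ 3 n (multiplesProd≈prod 3 n one₂) i i≤n ⟨
      multiplesProd 3 n (multiplesProd 4 n one₂) i ∎
      where open ≡-Reasoning

  -- `partitions m` bounds the parts by m itself, a different bound for each coefficient. Parts
  -- above m cannot occur in a partition of m, so one common bound n serves all coefficients up to
  -- n.
  partitionGF-stable : ∀ u k m → partitionGF u (k + m) m ≡ partitionGF u m m
  partitionGF-stable u zero    m = refl
  partitionGF-stable u (suc k) m = trans (step (u ∣? suc (k + m))) (partitionGF-stable u k m)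
    where
    step : Dec (u ∣ suc (k + m)) → partitionGF u (suc (k + m)) m ≡ partitionGF u (k + m) m
    step (yes u∣) = partitionGF-∣ u∣ m
    step (no u∤)  = trans (sym (mul1+-> (suc (k + m)) (partitionGF u (suc (k + m))) (s≤s (m≤n+m m k)) m ≤-refl)) (partitionGF-∤ u∤ m)

  ∑<-conv : ∀ f g n → ∑< (suc n) (λ i → f i ℙ.* g (n ∸ i)) ≡ conv f g n
  ∑<-conv f g zero    = ℙ-comm _ 0ℙ
  ∑<-conv f g (suc n) = cong (f 0 ℙ.* g (suc n) ℙ.+_) (∑<-conv (f ∘ suc) g n)

  conv-≈ : ∀ n {f g f′ g′} → f ≈[ n ] f′ → g ≈[ n ] g′ → conv f g n ≡ conv f′ g′ n
  conv-≈ zero    e e′ = cong₂ ℙ._*_ (e 0 z≤n) (e′ 0 z≤n)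
  conv-≈ (suc n) e e′ = cong₂ ℙ._+_ (cong₂ ℙ._*_ (e 0 z≤n) (e′ (suc n) ≤-refl))
    (conv-≈ n (λ i i≤n → e (suc i) (s≤s i≤n)) (λ i i≤n → e′ i (≤-trans i≤n (n≤1+n n))))

  parity-B : ∀ n → parity (B 4 3 n) ≡ parityℤ (a₁ n)
  parity-B n = begin
    parity (B 4 3 n)
      ≡⟨ parity-length-filterᵇ (okBi 4 3) (bipartitions n) ⟩
    ∑ (bipartitions n) (bit ∘ okBi 4 3)
      ≡⟨ ∑-concatMap pairs (upTo (suc n)) (bit ∘ okBi 4 3) ⟩
    ∑ (upTo (suc n)) (λ i → ∑ (pairs i) (bit ∘ okBi 4 3))
      ≡⟨ ∑-applyUpTo (λ i → i) (suc n) (λ i → ∑ (pairs i) (bit ∘ okBi 4 3)) ⟩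
    ∑< (suc n) (λ i → ∑ (pairs i) (bit ∘ okBi 4 3))
      ≡⟨ ∑<-cong (suc n) product ⟩
    ∑< (suc n) (λ i → partitionGF 4 i i ℙ.* partitionGF 3 (n ∸ i) (n ∸ i))
      ≡⟨ ∑<-conv (λ i → partitionGF 4 i i) (λ i → partitionGF 3 i i) n ⟩
    conv (λ i → partitionGF 4 i i) (λ i → partitionGF 3 i i) n
      ≡⟨ conv-≈ n (stable 4) (stable 3) ⟩
    conv (partitionGF 4 n) (partitionGF 3 n) n
      ≡⟨ conv-partitionGF n n ≤-refl ⟩
    prod 2 0 n (prod 3 0 n one₂) n
      ≡⟨ parity-a₁ n ⟨
    parityℤ (a₁ n) ∎
    where
    open ≡-Reasoning
    pairs : ℕ → List Bipartition
    pairs i = concatMap (λ α → map (α ,_) (partitions (n ∸ i))) (partitions i)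
    product : ∀ i → ∑ (pairs i) (bit ∘ okBi 4 3) ≡ partitionGF 4 i i ℙ.* partitionGF 3 (n ∸ i) (n ∸ i)
    product i = begin
      ∑ (pairs i) (bit ∘ okBi 4 3)
        ≡⟨ ∑-concatMap (λ α → map (α ,_) (partitions (n ∸ i))) (partitions i) (bit ∘ okBi 4 3) ⟩
      ∑ (partitions i) (λ α → ∑ (map (α ,_) (partitions (n ∸ i))) (bit ∘ okBi 4 3))
        ≡⟨ ∑-cong (partitions i) (λ α → trans (∑-map (α ,_) (partitions (n ∸ i)) (bit ∘ okBi 4 3))
             (trans (∑-cong (partitions (n ∸ i)) (λ β → bit-∧ (noPartDiv 4 α) (noPartDiv 3 β)))
             (trans (∑-*ˡ (bit (noPartDiv 4 α)) (partitions (n ∸ i)) (bit ∘ noPartDiv 3)) (ℙ-*-comm (bit (noPartDiv 4 α)) _)))) ⟩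
      ∑ (partitions i) (λ α → partitionGF 3 (n ∸ i) (n ∸ i) ℙ.* bit (noPartDiv 4 α))
        ≡⟨ ∑-*ˡ (partitionGF 3 (n ∸ i) (n ∸ i)) (partitions i) (bit ∘ noPartDiv 4) ⟩
      partitionGF 3 (n ∸ i) (n ∸ i) ℙ.* partitionGF 4 i i
        ≡⟨ ℙ-*-comm _ (partitionGF 4 i i) ⟩
      partitionGF 4 i i ℙ.* partitionGF 3 (n ∸ i) (n ∸ i) ∎
    stable : ∀ u → (λ i → partitionGF u i i) ≈[ n ] partitionGF u n
    stable u i i≤n = trans (sym (partitionGF-stable u (n ∸ i) i)) (cong (λ k → partitionGF u k i) (m∸n+n≡m i≤n))

-- Representations by 2X² + 3Y².

module Representations where

  open import Defs
  open SeriesMod2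
  open PartitionParity
  open Counting
  open import Data.Nat as ℕ using (ℕ; zero; suc; z≤n; s≤s; parity)
  import Data.Nat.Properties as ℕ
  open import Data.Nat.Tactic.RingSolver using () renaming (solve-∀ to solve-ℕ)
  import Data.Nat.Divisibility as ℕD
  open import Data.Integer using (ℤ; +_; -[1+_]; ∣_∣; _+_; _*_; -_; _-_)
  open import Data.Integer.Properties using (pos-*; +-injective; +-comm; _≟_; *-cancelˡ-≡; +-0-abelianGroup)
  open import Algebra.Properties.AbelianGroup +-0-abelianGroup using () renaming (∙-cancelʳ to +-cancelʳ-≡)
  open import Data.Integer.Divisibility.Signed using (_∣_; divides; _∣?_; ∣⇒∣ᵤ)
  open import Data.Integer.Tactic.RingSolver using (solve-∀)
  open import Data.Bool using (true; false; if_then_else_)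
  open import Data.List using (List; []; _∷_; length; filter; cartesianProduct; map)
  open import Data.List.Membership.Propositional using (_∈_)
  open import Data.List.Membership.Propositional.Properties using (∈-filter⁺; ∈-filter⁻; ∈-cartesianProduct⁺)
  open import Data.List.Relation.Unary.Any using (here; there)
  open import Data.List.Relation.Unary.All as All using ([]; _∷_)
  open import Data.List.Relation.Unary.AllPairs using ([]; _∷_)
  open import Data.List.Relation.Unary.Unique.Propositional using (Unique)
  open import Data.List.Relation.Unary.Unique.Propositional.Properties using (cartesianProduct⁺) renaming (filter⁺ to filter-unique)
  open import Data.Parity.Base as ℙ using (Parity)
  open import Data.Parity.Properties using (+-homo-+)
  open import Data.Product using (∃; _×_; _,_; proj₁; proj₂)
  open import Data.Sum using (_⊎_; inj₁; inj₂)
  open import Relation.Nullary using (Dec; does; contradiction)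
  open import Relation.Nullary.Decidable using (_×-dec_; from-no; map′)
  open import Relation.Binary.PropositionalEquality using (_≡_; _≢_; refl; sym; trans; cong; cong₂; module ≡-Reasoning)

  range-≤ : ∀ d {t} → t ∈ range d → ∣ t ∣ ℕ.≤ d
  range-≤ zero    (here refl)         = z≤n
  range-≤ (suc d) (here refl)         = ℕ.≤-refl
  range-≤ (suc d) (there (here refl)) = ℕ.≤-refl
  range-≤ (suc d) (there (there t∈))  = ℕ.m≤n⇒m≤1+n (range-≤ d t∈)

  ∈-range : ∀ d t → ∣ t ∣ ℕ.≤ d → t ∈ range d
  ∈-range zero (+ zero) _ = here refl
  ∈-range (suc d) t t≤ with ℕ.m≤n⇒m<n∨m≡n t≤
  ∈-range (suc d) t t≤         | inj₁ (s≤s t≤d) = there (there (∈-range d t t≤d))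
  ∈-range (suc d) (+ _) t≤     | inj₂ refl = here refl
  ∈-range (suc d) -[1+ _ ] t≤  | inj₂ refl = there (here refl)

  range-unique : ∀ d → Unique (range d)
  range-unique zero    = [] ∷ []
  range-unique (suc d) = ((λ ()) ∷ All.tabulate (distinct ℕ.≤-refl)) ∷ All.tabulate (distinct ℕ.≤-refl) ∷ range-unique d
    where
    distinct : ∀ {t u} → suc d ℕ.≤ ∣ t ∣ → u ∈ range d → t ≢ u
    distinct d<t u∈ refl = ℕ.<⇒≱ d<t (range-≤ d u∈)

  quad : ℤ → ℤ → ℤ
  quad X Y = + 2 * (X * X) + + 3 * (Y * Y)

  -- X is normalised to X ≡ 1 (mod 3), which picks one representation out of each pair ±(X, Y).
  record Solution (M : ℕ) (r : ℤ) (xy : ℤ × ℤ) : Set where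
    constructor solution
    field
      equation : quad (proj₁ xy) (proj₂ xy) ≡ + M
      X-mod-3  : + 3 ∣ proj₁ xy - + 1
      Y-mod-3  : + 3 ∣ proj₂ xy - r
  open Solution

  solution? : ∀ M r xy → Dec (Solution M r xy)
  solution? M r (X , Y) = map′ (λ (e , x , y) → solution e x y) (λ s → equation s , X-mod-3 s , Y-mod-3 s)
    ((quad X Y ≟ + M) ×-dec (+ 3 ∣? X - + 1) ×-dec (+ 3 ∣? Y - r))

  solutions : ℕ → ℤ → List (ℤ × ℤ)
  solutions M r = filter (solution? M r) (cartesianProduct (range M) (range M))

  solutions-unique : ∀ M r → Unique (solutions M r)
  solutions-unique M r = filter-unique (solution? M r) (cartesianProduct⁺ (range-unique M) (range-unique M))

  solutions⇒Solution : ∀ {M r xy} → xy ∈ solutions M r → Solution M r xy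
  solutions⇒Solution {M} {r} xy∈ = proj₂ (∈-filter⁻ (solution? M r) {xs = cartesianProduct (range M) (range M)} xy∈)

  square-abs : ∀ X → X * X ≡ + (∣ X ∣ ℕ.* ∣ X ∣)
  square-abs (+ n)    = sym (pos-* n n)
  square-abs -[1+ n ] = refl

  quad-abs : ∀ X Y → quad X Y ≡ + (2 ℕ.* (∣ X ∣ ℕ.* ∣ X ∣) ℕ.+ 3 ℕ.* (∣ Y ∣ ℕ.* ∣ Y ∣))
  quad-abs X Y rewrite square-abs X | square-abs Y =
    cong₂ _+_ (sym (pos-* 2 (∣ X ∣ ℕ.* ∣ X ∣))) (sym (pos-* 3 (∣ Y ∣ ℕ.* ∣ Y ∣)))

  n≤n*n : ∀ n → n ℕ.≤ n ℕ.* n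
  n≤n*n zero    = z≤n
  n≤n*n (suc n) = ℕ.m≤m*n (suc n) (suc n)

  -- The search box is large enough: |X| ≤ X² ≤ M, and likewise for Y.
  Solution⇒solutions : ∀ {M r xy} → Solution M r xy → xy ∈ solutions M r
  Solution⇒solutions {M} {r} {X , Y} sol@(solution eq _ _) = ∈-filter⁺ (solution? M r)
    (∈-cartesianProduct⁺ (∈-range M X X≤M) (∈-range M Y Y≤M)) sol
    where
    x² = ∣ X ∣ ℕ.* ∣ X ∣
    y² = ∣ Y ∣ ℕ.* ∣ Y ∣
    M≡ : 2 ℕ.* x² ℕ.+ 3 ℕ.* y² ≡ M
    M≡ = +-injective (trans (sym (quad-abs X Y)) eq)
    X≤M : ∣ X ∣ ℕ.≤ M
    X≤M = ℕ.≤-trans (n≤n*n ∣ X ∣) (ℕ.≤-trans (ℕ.m≤n*m x² 2) (ℕ.≤-trans (ℕ.m≤m+n (2 ℕ.* x²) (3 ℕ.* y²)) (ℕ.≤-reflexive M≡)))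
    Y≤M : ∣ Y ∣ ℕ.≤ M
    Y≤M = ℕ.≤-trans (n≤n*n ∣ Y ∣) (ℕ.≤-trans (ℕ.m≤n*m y² 3) (ℕ.≤-trans (ℕ.m≤n+m (3 ℕ.* y²) (2 ℕ.* x²)) (ℕ.≤-reflexive M≡)))

  -- Twice the closed form of `pent⁻`, where n = s + d + 1, with the subtracted terms moved to the
  -- left so that the induction stays in the natural numbers.
  pent⁻-closed : ∀ s d → 2 ℕ.* pent⁻ s d ℕ.+ 2 ℕ.* s ℕ.* (s ℕ.+ d) ℕ.+ s ℕ.* (s ℕ.+ 1) ≡ (s ℕ.+ d ℕ.+ 1) ℕ.* (3 ℕ.* s ℕ.+ 3 ℕ.* d ℕ.+ 2)
  pent⁻-closed s zero    = shape s
    where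
    shape : ∀ s → 2 ℕ.* (2 ℕ.* s ℕ.+ 1) ℕ.+ 2 ℕ.* s ℕ.* (s ℕ.+ 0) ℕ.+ s ℕ.* (s ℕ.+ 1) ≡ (s ℕ.+ 0 ℕ.+ 1) ℕ.* (3 ℕ.* s ℕ.+ 3 ℕ.* 0 ℕ.+ 2)
    shape = solve-ℕ
  pent⁻-closed s (suc d) = trans (regroup s d (pent⁻ (suc s) d)) (trans (pent⁻-closed (suc s) d) (shape s d))
    where
    regroup : ∀ s d p → 2 ℕ.* (2 ℕ.* s ℕ.+ d ℕ.+ 2 ℕ.+ p) ℕ.+ 2 ℕ.* s ℕ.* (s ℕ.+ suc d) ℕ.+ s ℕ.* (s ℕ.+ 1) ≡
      2 ℕ.* p ℕ.+ 2 ℕ.* suc s ℕ.* (suc s ℕ.+ d) ℕ.+ suc s ℕ.* (suc s ℕ.+ 1)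
    regroup = solve-ℕ
    shape : ∀ s d → (suc s ℕ.+ d ℕ.+ 1) ℕ.* (3 ℕ.* suc s ℕ.+ 3 ℕ.* d ℕ.+ 2) ≡ (s ℕ.+ suc d ℕ.+ 1) ℕ.* (3 ℕ.* s ℕ.+ 3 ℕ.* suc d ℕ.+ 2)
    shape = solve-ℕ

  pent⁻-square : ∀ d → 24 ℕ.* pent⁻ 0 d ℕ.+ 1 ≡ (6 ℕ.* d ℕ.+ 5) ℕ.* (6 ℕ.* d ℕ.+ 5)
  pent⁻-square d = trans (regroup (pent⁻ 0 d) d) (trans (cong (λ z → 12 ℕ.* z ℕ.+ 1) (pent⁻-closed 0 d)) (shape d))
    where
    regroup : ∀ p d → 24 ℕ.* p ℕ.+ 1 ≡ 12 ℕ.* (2 ℕ.* p ℕ.+ 2 ℕ.* 0 ℕ.* (0 ℕ.+ d) ℕ.+ 0 ℕ.* (0 ℕ.+ 1)) ℕ.+ 1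
    regroup = solve-ℕ
    shape : ∀ d → 12 ℕ.* ((0 ℕ.+ d ℕ.+ 1) ℕ.* (3 ℕ.* 0 ℕ.+ 3 ℕ.* d ℕ.+ 2)) ℕ.+ 1 ≡ (6 ℕ.* d ℕ.+ 5) ℕ.* (6 ℕ.* d ℕ.+ 5)
    shape = solve-ℕ

  pent⁺-square : ∀ d → 24 ℕ.* (pent⁻ 0 d ℕ.+ suc d) ℕ.+ 1 ≡ (6 ℕ.* suc d ℕ.+ 1) ℕ.* (6 ℕ.* suc d ℕ.+ 1)
  pent⁺-square d = trans (regroup (pent⁻ 0 d) d) (trans (cong (λ z → z ℕ.+ 24 ℕ.* suc d) (pent⁻-square d)) (shape d))
    where
    regroup : ∀ p d → 24 ℕ.* (p ℕ.+ suc d) ℕ.+ 1 ≡ 24 ℕ.* p ℕ.+ 1 ℕ.+ 24 ℕ.* suc d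
    regroup = solve-ℕ
    shape : ∀ d → (6 ℕ.* d ℕ.+ 5) ℕ.* (6 ℕ.* d ℕ.+ 5) ℕ.+ 24 ℕ.* suc d ≡ (6 ℕ.* suc d ℕ.+ 1) ℕ.* (6 ℕ.* suc d ℕ.+ 1)
    shape = solve-ℕ

  6t+1 : ℤ → ℤ
  6t+1 t = + 6 * t + + 1

  pent-square : ∀ t → + 24 * + pent t + + 1 ≡ 6t+1 t * 6t+1 t
  pent-square (+ zero)  = refl
  pent-square (+ suc d) = trans (cong (_+ + 1) (sym (pos-* 24 (pent (+ suc d))))) (trans (cong +_ (pent⁺-square d))
    (trans (pos-* (6 ℕ.* suc d ℕ.+ 1) (6 ℕ.* suc d ℕ.+ 1)) (cong (λ z → (z + + 1) * (z + + 1)) (pos-* 6 (suc d)))))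
  pent-square -[1+ d ]  = trans (cong (_+ + 1) (sym (pos-* 24 (pent⁻ 0 d)))) (trans (cong +_ (pent⁻-square d))
    (trans (pos-* (6 ℕ.* d ℕ.+ 5) (6 ℕ.* d ℕ.+ 5)) (trans (cong (λ z → (z + + 5) * (z + + 5)) (pos-* 6 d)) (shape (+ d)))))
    where
    shape : ∀ d → (+ 6 * d + + 5) * (+ 6 * d + + 5) ≡ (+ 6 * (- (+ 1 + d)) + + 1) * (+ 6 * (- (+ 1 + d)) + + 1)
    shape = solve-∀

  pent⁻-≥ : ∀ s d → suc (s ℕ.+ d) ℕ.≤ pent⁻ s d
  pent⁻-≥ s zero = ℕ.≤-trans (ℕ.m≤m+n (suc (s ℕ.+ 0)) s) (ℕ.≤-reflexive (shape s))
    where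
    shape : ∀ s → suc (s ℕ.+ 0) ℕ.+ s ≡ 2 ℕ.* s ℕ.+ 1
    shape = solve-ℕ
  pent⁻-≥ s (suc d) = ℕ.≤-trans (ℕ.≤-trans (ℕ.m≤m+n (suc (s ℕ.+ suc d)) s) (ℕ.≤-reflexive (shape s d))) (ℕ.m≤m+n (2 ℕ.* s ℕ.+ d ℕ.+ 2) _)
    where
    shape : ∀ s d → suc (s ℕ.+ suc d) ℕ.+ s ≡ 2 ℕ.* s ℕ.+ d ℕ.+ 2
    shape = solve-ℕ

  ∣t∣≤pent : ∀ t → ∣ t ∣ ℕ.≤ pent t
  ∣t∣≤pent (+ zero)  = z≤n
  ∣t∣≤pent (+ suc d) = ℕ.m≤n+m (suc d) (pent⁻ 0 d)
  ∣t∣≤pent -[1+ d ]  = pent⁻-≥ 0 d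

  even⊎odd : ∀ z → ∃ λ k → z ≡ + 2 * k ⊎ z ≡ + 2 * k + + 1
  even⊎odd (+ zero) = + 0 , inj₁ refl
  even⊎odd (+ suc n) with even⊎odd (+ n)
  ... | k , inj₁ e = k , inj₂ (trans (+-comm (+ 1) (+ n)) (cong (_+ + 1) e))
  ... | k , inj₂ e = k + + 1 , inj₁ (trans (cong (λ z → + 1 + z) e) (shape k))
    where
    shape : ∀ k → + 1 + (+ 2 * k + + 1) ≡ + 2 * (k + + 1)
    shape = solve-∀
  even⊎odd -[1+ zero ] = -[1+ 0 ] , inj₂ refl
  even⊎odd -[1+ suc n ] with even⊎odd -[1+ n ]
  ... | k , inj₁ e = k - + 1 , inj₂ (trans (cong (λ z → -[1+ 0 ] + z) e) (shape k))
    where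
    shape : ∀ k → -[1+ 0 ] + + 2 * k ≡ + 2 * (k - + 1) + + 1
    shape = solve-∀
  ... | k , inj₂ e = k , inj₁ (trans (cong (λ z → -[1+ 0 ] + z) e) (shape k))
    where
    shape : ∀ k → -[1+ 0 ] + (+ 2 * k + + 1) ≡ + 2 * k
    shape = solve-∀

  -- X and Y are forced to be odd by 2X² + 3Y² = 24n + 5.
  Solution-6t+1 : ∀ {n X Y} → Solution (24 ℕ.* n ℕ.+ 5) (+ 1) (X , Y) → ∃ λ s → ∃ λ t → X ≡ 6t+1 s × Y ≡ 6t+1 t
  Solution-6t+1 {n} {X} {Y} (solution eq (divides a X≡) (divides b Y≡)) with even⊎odd a | even⊎odd b
  ... | k , _ | l , inj₂ refl = contradiction (∣⇒∣ᵤ (divides A even)) (from-no (2 ℕD.∣? 5))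
    where
    A = X * X + + 6 * ((+ 3 * l + + 2) * (+ 3 * l + + 2)) - + 12 * + n
    shape : ∀ X l → + 2 * (X * X) + + 3 * (((+ 2 * l + + 1) * + 3 + + 1) * ((+ 2 * l + + 1) * + 3 + + 1)) ≡
      (X * X + + 6 * ((+ 3 * l + + 2) * (+ 3 * l + + 2))) * + 2
    shape = solve-∀
    shift-eq : ∀ Y → Y ≡ (Y - + 1) + + 1
    shift-eq = solve-∀
    Y-eq : Y ≡ (+ 2 * l + + 1) * + 3 + + 1
    Y-eq = trans (shift-eq Y) (cong (_+ + 1) Y≡)
    total : (X * X + + 6 * ((+ 3 * l + + 2) * (+ 3 * l + + 2))) * + 2 ≡ + 24 * + n + + 5
    total = trans (sym (shape X l)) (trans (cong (λ y → quad X y) (sym Y-eq)) (trans eq (cong (_+ + 5) (pos-* 24 n))))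
    even : + 5 ≡ A * + 2
    even = trans (twist (+ n)) (trans (cong (λ z → z - + 24 * + n) (sym total)) (untwist (X * X + + 6 * ((+ 3 * l + + 2) * (+ 3 * l + + 2))) (+ n)))
      where
      twist : ∀ n → + 5 ≡ (+ 24 * n + + 5) - + 24 * n
      twist = solve-∀
      untwist : ∀ A n → A * + 2 - + 24 * n ≡ (A - + 12 * n) * + 2
      untwist = solve-∀
  ... | k , inj₂ refl | l , inj₁ refl = contradiction (∣⇒∣ᵤ (divides (A - + 6 * + n) even)) (from-no (4 ℕD.∣? 2))
    where
    A = + 2 * ((+ 3 * k + + 2) * (+ 3 * k + + 2)) + + 27 * (l * l) + + 9 * l
    shape : ∀ k l → + 2 * (((+ 2 * k + + 1) * + 3 + + 1) * ((+ 2 * k + + 1) * + 3 + + 1)) + + 3 * (((+ 2 * l) * + 3 + + 1) * ((+ 2 * l) * + 3 + + 1)) ≡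
      (+ 2 * ((+ 3 * k + + 2) * (+ 3 * k + + 2)) + + 27 * (l * l) + + 9 * l) * + 4 + + 3
    shape = solve-∀
    shift-eq : ∀ Y → Y ≡ (Y - + 1) + + 1
    shift-eq = solve-∀
    total : A * + 4 + + 3 ≡ + 24 * + n + + 5
    total = trans (sym (shape k l)) (trans (cong₂ quad (sym (trans (shift-eq X) (cong (_+ + 1) X≡))) (sym (trans (shift-eq Y) (cong (_+ + 1) Y≡))))
      (trans eq (cong (_+ + 5) (pos-* 24 n))))
    even : + 2 ≡ (A - + 6 * + n) * + 4
    even = trans (twist (+ n)) (trans (cong (λ z → z - + 24 * + n - + 3) (sym total)) (untwist A (+ n)))
      where
      twist : ∀ n → + 2 ≡ (+ 24 * n + + 5) - + 24 * n - + 3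
      twist = solve-∀
      untwist : ∀ A n → A * + 4 + + 3 - + 24 * n - + 3 ≡ (A - + 6 * n) * + 4
      untwist = solve-∀
  ... | k , inj₁ refl | l , inj₁ refl = k , l , shift-eq X k X≡ , shift-eq Y l Y≡
    where
    shift-eq : ∀ X k → X - + 1 ≡ (+ 2 * k) * + 3 → X ≡ 6t+1 k
    shift-eq X k e = trans (split X) (trans (cong (_+ + 1) e) (shape k))
      where
      split : ∀ Y → Y ≡ (Y - + 1) + + 1
      split = solve-∀
      shape : ∀ k → (+ 2 * k) * + 3 + + 1 ≡ + 6 * k + + 1
      shape = solve-∀

  quad-pent : ∀ s t → quad (6t+1 s) (6t+1 t) ≡ + 24 * + (2 ℕ.* pent s ℕ.+ 3 ℕ.* pent t) + + 5
  quad-pent s t = trans (cong₂ (λ x y → + 2 * x + + 3 * y) (sym (pent-square s)) (sym (pent-square t)))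
    (trans (shape (+ pent s) (+ pent t)) (cong (λ z → + 24 * z + + 5) (sym (cong₂ _+_ (pos-* 2 (pent s)) (pos-* 3 (pent t))))))
    where
    shape : ∀ a b → + 2 * (+ 24 * a + + 1) + + 3 * (+ 24 * b + + 1) ≡ + 24 * (+ 2 * a + + 3 * b) + + 5
    shape = solve-∀

  6t+1-injective : ∀ {s t} → 6t+1 s ≡ 6t+1 t → s ≡ t
  6t+1-injective {s} {t} e = *-cancelˡ-≡ (+ 6) s t (+-cancelʳ-≡ (+ 1) (+ 6 * s) (+ 6 * t) e)

  pentagonalPairs : ℕ → List (ℤ × ℤ)
  pentagonalPairs n = filter (λ (s , t) → 2 ℕ.* pent s ℕ.+ 3 ℕ.* pent t ℕ.≟ n) (cartesianProduct (range n) (range n))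

  -- Completing squares, 24(2 pent s + 3 pent t) + 5 = 2(6s+1)² + 3(6t+1)², so (s, t) ↦ (6s+1, 6t+1)
  -- is a bijection between the two lists.
  length-pentagonalPairs : ∀ n → length (pentagonalPairs n) ≡ length (solutions (24 ℕ.* n ℕ.+ 5) (+ 1))
  length-pentagonalPairs n = length-≡ (λ (s , t) (X , Y) → X ≡ 6t+1 s × Y ≡ 6t+1 t)
    (filter-unique _ (cartesianProduct⁺ (range-unique n) (range-unique n))) (solutions-unique M (+ 1))
    (λ {(s , t)} st∈ → (6t+1 s , 6t+1 t) , Solution⇒solutions (forward {s} {t} (proj₂ (∈-filter⁻ pent? {xs = cartesianProduct (range n) (range n)} st∈))) , refl , refl)
    backward
    (λ { (refl , refl) (e , e′) → cong₂ _,_ (6t+1-injective e) (6t+1-injective e′) })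
    (λ { (refl , refl) (refl , refl) → refl })
    where
    M = 24 ℕ.* n ℕ.+ 5
    pent? = λ (st : ℤ × ℤ) → 2 ℕ.* pent (proj₁ st) ℕ.+ 3 ℕ.* pent (proj₂ st) ℕ.≟ n
    6t+1-mod : ∀ t → + 6 * t + + 1 - + 1 ≡ (+ 2 * t) * + 3
    6t+1-mod = solve-∀
    forward : ∀ {s t} → 2 ℕ.* pent s ℕ.+ 3 ℕ.* pent t ≡ n → Solution M (+ 1) (6t+1 s , 6t+1 t)
    forward {s} {t} refl = solution (trans (quad-pent s t) (cong (_+ + 5) (sym (pos-* 24 n)))) (divides (+ 2 * s) (6t+1-mod s)) (divides (+ 2 * t) (6t+1-mod t))
    backward : ∀ {xy} → xy ∈ solutions M (+ 1) → ∃ λ st → st ∈ pentagonalPairs n × proj₁ xy ≡ 6t+1 (proj₁ st) × proj₂ xy ≡ 6t+1 (proj₂ st)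
    backward {X , Y} xy∈ with solutions⇒Solution {M} {+ 1} xy∈
    ... | sol with Solution-6t+1 {n} {X} {Y} sol
    ... | s , t , refl , refl = (s , t) , ∈-filter⁺ pent? (∈-cartesianProduct⁺
        (∈-range n s (ℕ.≤-trans (∣t∣≤pent s) (ℕ.≤-trans (ℕ.m≤n*m (pent s) 2) (ℕ.≤-trans (ℕ.m≤m+n (2 ℕ.* pent s) (3 ℕ.* pent t)) (ℕ.≤-reflexive n≡)))))
        (∈-range n t (ℕ.≤-trans (∣t∣≤pent t) (ℕ.≤-trans (ℕ.m≤n*m (pent t) 3) (ℕ.≤-trans (ℕ.m≤n+m (3 ℕ.* pent t) (2 ℕ.* pent s)) (ℕ.≤-reflexive n≡)))))) n≡
      , refl , refl
      where
      n≡ : 2 ℕ.* pent s ℕ.+ 3 ℕ.* pent t ≡ n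
      n≡ = +-injective (*-cancelˡ-≡ (+ 24) _ _ (+-cancelʳ-≡ (+ 5) _ _
             (trans (sym (quad-pent s t)) (trans (equation sol) (cong (_+ + 5) (pos-* 24 n))))))

  shift-one : ∀ k n → shift k one₂ n ≡ parity (if does (k ℕ.≟ n) then 1 else 0)
  shift-one zero    zero    = refl
  shift-one zero    (suc n) = refl
  shift-one (suc k) zero    = refl
  shift-one (suc k) (suc n) = shift-one k n

  ∑-count : {A : Set} (k : A → ℕ) (n : ℕ) (xs : List A) →
    ∑ xs (λ x → shift (k x) one₂ n) ≡ parity (length (filter (λ x → k x ℕ.≟ n) xs))
  ∑-count k n []       = refl
  ∑-count k n (x ∷ xs) = trans (cong₂ ℙ._+_ (shift-one (k x) n) (∑-count k n xs)) step
    where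
    step : parity (if does (k x ℕ.≟ n) then 1 else 0) ℙ.+ parity (length (filter (λ x → k x ℕ.≟ n) xs)) ≡
           parity (length (filter (λ x → k x ℕ.≟ n) (x ∷ xs)))
    step with k x ℕ.≡ᵇ n
    ... | true  = sym (+-homo-+ 1 (length (filter (λ x → k x ℕ.≟ n) xs)))
    ... | false = refl

  ∑-cartesianProduct : {A C : Set} (xs : List A) (ys : List C) (φ : A × C → Parity) →
    ∑ (cartesianProduct xs ys) φ ≡ ∑ xs (λ x → ∑ ys (λ y → φ (x , y)))
  ∑-cartesianProduct []       ys φ = refl
  ∑-cartesianProduct (x ∷ xs) ys φ = trans (∑-++ (map (x ,_) ys) (cartesianProduct xs ys) φ)
    (cong₂ ℙ._+_ (∑-map (x ,_) ys φ) (∑-cartesianProduct xs ys φ))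

  parity-a₁-solutions : ∀ n → parityℤ (a₁ n) ≡ parity (length (solutions (24 ℕ.* n ℕ.+ 5) (+ 1)))
  parity-a₁-solutions n = begin
    parityℤ (a₁ n)
      ≡⟨ parity-a₁ n ⟩
    prod 2 0 n (prod 3 0 n one₂) n
      ≡⟨ pentagonal² n ⟩
    ∑ (range n) (λ s → ∑ (range n) (λ t → shift (2 ℕ.* pent s ℕ.+ 3 ℕ.* pent t) one₂ n))
      ≡⟨ ∑-cartesianProduct (range n) (range n) (λ (s , t) → shift (2 ℕ.* pent s ℕ.+ 3 ℕ.* pent t) one₂ n) ⟨
    ∑ (cartesianProduct (range n) (range n)) (λ (s , t) → shift (2 ℕ.* pent s ℕ.+ 3 ℕ.* pent t) one₂ n)
      ≡⟨ ∑-count (λ (s , t) → 2 ℕ.* pent s ℕ.+ 3 ℕ.* pent t) n (cartesianProduct (range n) (range n)) ⟩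
    parity (length (pentagonalPairs n))
      ≡⟨ cong parity (length-pentagonalPairs n) ⟩
    parity (length (solutions (24 ℕ.* n ℕ.+ 5) (+ 1))) ∎
    where open ≡-Reasoning

-- Rotation of solutions by an element of norm q².

module Rotations where

  open Counting
  open Representations
  open import Data.Nat as ℕ using (ℕ; zero; suc; z≤n; s≤s)
  import Data.Nat.Properties as ℕ
  import Data.Nat.Divisibility as ℕ
  open import Data.Integer using (ℤ; +_; _+_; _*_; -_; _-_; _^_; 1ℤ; NonZero)
  open import Data.Integer.Properties using (^-distribˡ-+-*; *-cancelˡ-≡; *-assoc; *-comm; *-identityˡ; neg-involutive)
  open import Data.Integer.Divisibility.Signed
  open import Data.Integer.Tactic.RingSolver using (solve-∀)
  open import Data.Product using (∃; ∃₂; _×_; _,_; proj₁; proj₂)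
  open import Data.Sum using (_⊎_; inj₁; inj₂; [_,_]′)
  open import Relation.Nullary using (¬_; contradiction)
  open import Relation.Binary.PropositionalEquality using (_≡_; refl; sym; trans; cong; cong₂; subst)

  open Solution

  ∣-≡ : ∀ {d a b} → d ∣ a → a ≡ b → d ∣ b
  ∣-≡ d∣a refl = d∣a

  *-mono-∣ : ∀ {a b c d} → a ∣ b → c ∣ d → a * c ∣ b * d
  *-mono-∣ {a} {c = c} (divides k refl) (divides l refl) = divides (k * l) (shape k a l c)
    where
    shape : ∀ k a l c → (k * a) * (l * c) ≡ (k * l) * (a * c)
    shape = solve-∀

  ^-≤-∣ : ∀ q {m n} → m ℕ.≤ n → q ^ m ∣ q ^ n
  ^-≤-∣ q {n = n} z≤n = divides (q ^ n) (shape (q ^ n))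
    where
    shape : ∀ x → x ≡ x * 1ℤ
    shape = solve-∀
  ^-≤-∣ q (s≤s m≤n) = *-monoʳ-∣ q (^-≤-∣ q m≤n)

  -- The prime ±p, with the sign chosen so that it is ≡ 1 (mod 3).
  record NormalisedPrime (q : ℤ) : Set where
    field
      euclid   : ∀ {a b} → q ∣ a * b → q ∣ a ⊎ q ∣ b
      inverse  : ∀ {a} → ¬ q ∣ a → ∃ λ z → q ∣ a * z - 1ℤ
      q∤2      : ¬ q ∣ + 2
      q∤3      : ¬ q ∣ + 3
      q≡1      : + 3 ∣ q - 1ℤ
      nonZero  : NonZero q

    q∣²⇒q∣ : ∀ {a} → q ∣ a * a → q ∣ a
    q∣²⇒q∣ q∣aa = [ (λ z → z) , (λ z → z) ]′ (euclid q∣aa)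

    q∤6 : ¬ q ∣ + 6
    q∤6 q∣6 = [ q∤2 , q∤3 ]′ (euclid {+ 2} {+ 3} q∣6)

    q∣2* : ∀ {a} → q ∣ + 2 * a → q ∣ a
    q∣2* q∣2a = [ (λ q∣2 → contradiction q∣2 q∤2) , (λ z → z) ]′ (euclid q∣2a)

    *-cancel-q : ∀ {a b} → q * a ≡ q * b → a ≡ b
    *-cancel-q {a} {b} = *-cancelˡ-≡ q a b {{nonZero}}

    *-cancel-q-∣ : ∀ {a b} → q * a ∣ q * b → a ∣ b
    *-cancel-q-∣ {a} {b} = *-cancelˡ-∣ q {a} {b} {{nonZero}}

    q^∣q^*⇒ : ∀ n {x} → q ^ suc n ∣ q ^ n * x → q ∣ x
    q^∣q^*⇒ zero    {x} h = ∣-≡ (∣-trans (∣-reflexive (shape q)) h) (*-identityˡ x)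
      where
      shape : ∀ q → q ≡ q * 1ℤ
      shape = solve-∀
    q^∣q^*⇒ (suc n) {x} h = q^∣q^*⇒ n (*-cancel-q-∣ (∣-≡ h (*-assoc q (q ^ n) x)))

    abstract
      -- Induction on e: once q^i and q^j are taken out, the one remaining q divides one of the two
      -- cofactors.
      q^∣*⇒ : ∀ e {a b} → q ^ e ∣ a * b → ∃₂ λ i j → i ℕ.+ j ≡ e × q ^ i ∣ a × q ^ j ∣ b
      q^∣*⇒ zero {a} {b} _ = 0 , 0 , refl , ^-zero a , ^-zero b
        where
        ^-zero : ∀ x → 1ℤ ∣ x
        ^-zero x = divides x (shape x)
          where
          shape : ∀ x → x ≡ x * 1ℤ
          shape = solve-∀
      q^∣*⇒ (suc e) {a} {b} d with q^∣*⇒ e {a} {b} (∣-trans (^-≤-∣ q (ℕ.n≤1+n e)) d)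
      ... | i , j , refl , divides k refl , divides l refl with euclid {k} {l} (q^∣q^*⇒ (i ℕ.+ j) (subst (q ^ suc (i ℕ.+ j) ∣_) regroup d))
        where
        regroup : (k * q ^ i) * (l * q ^ j) ≡ q ^ (i ℕ.+ j) * (k * l)
        regroup = trans (shape k (q ^ i) l (q ^ j)) (cong (_* (k * l)) (sym (^-distribˡ-+-* q i j)))
          where
          shape : ∀ k a l c → (k * a) * (l * c) ≡ (a * c) * (k * l)
          shape = solve-∀
      ... | inj₁ q∣k = suc i , j , refl , *-monoˡ-∣ (q ^ i) q∣k , divides l refl
      ... | inj₂ q∣l = i , suc j , ℕ.+-suc i j , divides k refl , *-monoˡ-∣ (q ^ j) q∣l

  -- Modulo q^(e+2), s is a root of -6; the ideal generated by q splits as 𝔭𝔭̄, where 𝔭 is the kernel of √-6 ↦ s mod q.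
  -- The element u + v√-6 generates 𝔭².
  record Rotation (q : ℤ) (e : ℕ) (u v s t : ℤ) : Set where
    field
      norm : u * u + + 6 * (v * v) ≡ q * q
      u≡1  : + 3 ∣ u - 1ℤ
      root : q ^ (2 ℕ.+ e) ∣ s * s + + 6
      link : q * q ∣ u + s * v
      t≡-s : t ≡ - s

  -- Conjugation exchanges `𝔭` and `𝔭̄`, so every fact about raising the 𝔭-level yields one about
  -- lowering it. The root t is a parameter tied to `- s` by `t≡-s`, so that conjugating merely
  -- exchanges two parameters.
  conjugate : ∀ {q e u v s t} → Rotation q e u v s t → Rotation q e u (- v) t s
  conjugate {q} {e} {u} {v} {s} record { norm = norm ; u≡1 = u≡1 ; root = root ; link = link ; t≡-s = refl } = record
    { norm = trans (shape₁ u v) norm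
    ; u≡1  = u≡1
    ; root = ∣-≡ root (shape₂ s)
    ; link = ∣-≡ link (shape₃ u s v)
    ; t≡-s = sym (neg-involutive s)
    }
    where
    shape₁ : ∀ u v → u * u + + 6 * (- v * - v) ≡ u * u + + 6 * (v * v)
    shape₁ = solve-∀
    shape₂ : ∀ s → s * s + + 6 ≡ - s * - s + + 6
    shape₂ = solve-∀
    shape₃ : ∀ u s v → u + s * v ≡ u + - s * - v
    shape₃ = solve-∀

  -- 𝔭ⁱ divides 2X + Y√-6
  record Divides (q s : ℤ) (i : ℕ) (xy : ℤ × ℤ) : Set where
    constructor divides𝔭
    field divisibility : q ^ i ∣ + 2 * proj₁ xy + s * proj₂ xy
  open Divides

  -- q (2X′ + Y′√-6) = (u + v√-6) (2X + Y√-6)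
  record Rotates (q u v : ℤ) (xy xy′ : ℤ × ℤ) : Set where
    constructor rotates
    field
      X-eq : q * proj₁ xy′ ≡ u * proj₁ xy - + 3 * v * proj₂ xy
      Y-eq : q * proj₂ xy′ ≡ u * proj₂ xy + + 2 * v * proj₁ xy

  Solution-≡ : ∀ {M r r′ xy} → + 3 ∣ r - r′ → Solution M r xy → Solution M r′ xy
  Solution-≡ {r = r} {r′} {X , Y} d (solution eq x y) = solution eq x (∣-≡ (∣m∣n⇒∣m+n y d) (shape Y r r′))
    where
    shape : ∀ Y r r′ → Y - r + (r - r′) ≡ Y - r′
    shape = solve-∀

  module _ {q : ℤ} (Q : NormalisedPrime q) where
    open NormalisedPrime Q

    module _ {e : ℕ} {u v s t : ℤ} (ρ : Rotation q e u v s t) where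
      open Rotation ρ

      abstract
        -- Multiplying by u - v√-6 recovers q² times the original pair, because the norm is q².
        Rotates-injective : ∀ {β β′ γ} → Rotates q u v β γ → Rotates q u v β′ γ → β ≡ β′
        Rotates-injective {X , Y} {X′ , Y′} {X₁ , Y₁} (rotates x y) (rotates x′ y′) = cong₂ _,_
          (*-cancel-q (*-cancel-q (trans (X-from x y) (sym (X-from x′ y′)))))
          (*-cancel-q (*-cancel-q (trans (Y-from x y) (sym (Y-from x′ y′)))))
          where
          expand : ∀ q X → q * (q * X) ≡ (q * q) * X
          expand = solve-∀
          shapeX : ∀ u v X Y → (u * u + + 6 * (v * v)) * X ≡ u * (u * X - + 3 * v * Y) + + 3 * v * (u * Y + + 2 * v * X)
          shapeX = solve-∀
          shapeY : ∀ u v X Y → (u * u + + 6 * (v * v)) * Y ≡ u * (u * Y + + 2 * v * X) - + 2 * v * (u * X - + 3 * v * Y)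
          shapeY = solve-∀
          X-from : ∀ {X Y} → q * X₁ ≡ u * X - + 3 * v * Y → q * Y₁ ≡ u * Y + + 2 * v * X →
            q * (q * X) ≡ u * (q * X₁) + + 3 * v * (q * Y₁)
          X-from {X} {Y} a b = trans (expand q X) (trans (cong (_* X) (sym norm)) (trans (shapeX u v X Y)
            (cong₂ (λ x y → u * x + + 3 * v * y) (sym a) (sym b))))
          Y-from : ∀ {X Y} → q * X₁ ≡ u * X - + 3 * v * Y → q * Y₁ ≡ u * Y + + 2 * v * X →
            q * (q * Y) ≡ u * (q * Y₁) - + 2 * v * (q * X₁)
          Y-from {X} {Y} a b = trans (expand q Y) (trans (cong (_* Y) (sym norm)) (trans (shapeY u v X Y)
            (cong₂ (λ x y → u * y - + 2 * v * x) (sym a) (sym b))))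

        -- The factor `𝔭̄` of 2X + Y√-6 together with `𝔭²` from u + v√-6 makes the product divisible
        -- by q; the quotient has one `𝔭` more and one `𝔭̄` less. Modulo 3 each of u, X and q is 1,
        -- so X stays normalised and Y moves by 2v.
        rotate : ∀ {M r i j β} → Solution M r β → Divides q s i β → Divides q t (suc j) β → i ℕ.+ suc j ≡ e →
          ∃ λ γ → Rotates q u v β γ × Solution M (r + + 2 * v) γ × Divides q s (suc i) γ × Divides q t j γ
        rotate {M} {r} {i} {j} {X , Y} (solution eq X≡ Y≡) (divides𝔭 q^i) (divides𝔭 q^j) refl = rotated q∣x q∣y t≡-s
          where
          q∣q*q : q ∣ q * q
          q∣q*q = divides q refl
          q∣q^ : ∀ n → q ∣ q ^ suc n
          q∣q^ n = divides (q ^ n) (*-comm q (q ^ n))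
          q∣u+sv : q ∣ u + s * v
          q∣u+sv = ∣-trans q∣q*q link
          q∣2X+tY : q ∣ + 2 * X + t * Y
          q∣2X+tY = ∣-trans (q∣q^ j) q^j
          shape-y : ∀ u v s X Y → (u + s * v) * Y + v * (+ 2 * X + - s * Y) ≡ u * Y + + 2 * v * X
          shape-y = solve-∀
          shape-x : ∀ u v s X Y → + 2 * X * (u + s * v) - s * v * (+ 2 * X + - s * Y) - v * Y * (s * s + + 6) ≡ + 2 * (u * X - + 3 * v * Y)
          shape-x = solve-∀
          q∣y : q ∣ u * Y + + 2 * v * X
          q∣y = ∣-≡ (∣m∣n⇒∣m+n (∣m⇒∣m*n Y q∣u+sv) (∣n⇒∣m*n v q∣2X+tY))
            (trans (cong (λ t → (u + s * v) * Y + v * (+ 2 * X + t * Y)) t≡-s) (shape-y u v s X Y))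
          q∣x : q ∣ u * X - + 3 * v * Y
          q∣x = q∣2* (∣-≡ (∣m∣n⇒∣m-n (∣m∣n⇒∣m-n (∣n⇒∣m*n (+ 2 * X) q∣u+sv) (∣n⇒∣m*n (s * v) q∣2X+tY))
                                     (∣n⇒∣m*n (v * Y) (∣-trans (q∣q^ (suc (i ℕ.+ suc j))) root)))
            (trans (cong (λ t → + 2 * X * (u + s * v) - s * v * (+ 2 * X + t * Y) - v * Y * (s * s + + 6)) t≡-s) (shape-x u v s X Y)))
          rotated : q ∣ u * X - + 3 * v * Y → q ∣ u * Y + + 2 * v * X → t ≡ - s →
            ∃ λ γ → Rotates q u v (X , Y) γ × Solution M (r + + 2 * v) γ × Divides q s (suc i) γ × Divides q t j γ
          rotated (divides X₁ x-eq) (divides Y₁ y-eq) refl =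
            (X₁ , Y₁) , rotates x y , solution eq₁ X₁≡ Y₁≡ , divides𝔭 q^i₁ , divides𝔭 q^j₁
            where
            x : q * X₁ ≡ u * X - + 3 * v * Y
            x = trans (*-comm q X₁) (sym x-eq)
            y : q * Y₁ ≡ u * Y + + 2 * v * X
            y = trans (*-comm q Y₁) (sym y-eq)
            eq₁ : quad X₁ Y₁ ≡ + M
            eq₁ = *-cancel-q (*-cancel-q (trans (scale q X₁ Y₁) (trans (cong₂ quad x y) (trans (composition u v X Y)
              (trans (cong₂ _*_ norm eq) (*-assoc q q (+ M)))))))
              where
              scale : ∀ q X Y → q * (q * quad X Y) ≡ quad (q * X) (q * Y)
              scale q X Y = scale′ q X Y
                where
                scale′ : ∀ q X Y → q * (q * (+ 2 * (X * X) + + 3 * (Y * Y))) ≡ + 2 * (q * X * (q * X)) + + 3 * (q * Y * (q * Y))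
                scale′ = solve-∀
              composition : ∀ u v X Y → quad (u * X - + 3 * v * Y) (u * Y + + 2 * v * X) ≡ (u * u + + 6 * (v * v)) * quad X Y
              composition u v X Y = composition′ u v X Y
                where
                composition′ : ∀ u v X Y →
                  + 2 * ((u * X - + 3 * v * Y) * (u * X - + 3 * v * Y)) + + 3 * ((u * Y + + 2 * v * X) * (u * Y + + 2 * v * X)) ≡
                  (u * u + + 6 * (v * v)) * (+ 2 * (X * X) + + 3 * (Y * Y))
                composition′ = solve-∀
            3∣3* : ∀ z → + 3 ∣ z * + 3
            3∣3* z = divides z refl
            X₁≡ : + 3 ∣ X₁ - + 1
            X₁≡ = ∣-≡ (∣m∣n⇒∣m-n (∣-≡ (∣m∣n⇒∣m-n (∣m∣n⇒∣m-n (∣m∣n⇒∣m+n (∣m⇒∣m*n X u≡1) X≡) q≡1) (3∣3* (v * Y)))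
                (trans (shape₁ q u v X Y) (cong (_- q) (sym x)))) (∣m⇒∣m*n (X₁ - 1ℤ) q≡1)) (shape₂ q X₁)
              where
              shape₁ : ∀ q u v X Y → (u - 1ℤ) * X + (X - 1ℤ) - (q - 1ℤ) - v * Y * + 3 ≡ u * X - + 3 * v * Y - q
              shape₁ = solve-∀
              shape₂ : ∀ q X → q * X - q - (q - 1ℤ) * (X - 1ℤ) ≡ X - 1ℤ
              shape₂ = solve-∀
            Y₁≡ : + 3 ∣ Y₁ - (r + + 2 * v)
            Y₁≡ = ∣-≡ (∣m∣n⇒∣m-n (∣-≡ (∣m∣n⇒∣m+n (∣m∣n⇒∣m+n (∣m⇒∣m*n Y u≡1) Y≡) (∣n⇒∣m*n (+ 2 * v) X≡))
                (trans (shape₁ u v r X Y) (cong (_- (r + + 2 * v)) (sym y)))) (∣m⇒∣m*n Y₁ q≡1)) (shape₂ q (r + + 2 * v) Y₁)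
              where
              shape₁ : ∀ u v r X Y → (u - 1ℤ) * Y + (Y - r) + + 2 * v * (X - 1ℤ) ≡ u * Y + + 2 * v * X - (r + + 2 * v)
              shape₁ = solve-∀
              shape₂ : ∀ q r Y → q * Y - r - (q - 1ℤ) * Y ≡ Y - r
              shape₂ = solve-∀
            -- `link` has modulus q², so the product is examined modulo q^(i+2) before one q is
            -- cancelled; the precision e + 2 of `root` covers this error term.
            root∣ : ∀ {k} → k ℕ.≤ 2 ℕ.+ (i ℕ.+ suc j) → q ^ k ∣ (v * Y) * (s * s + + 6)
            root∣ k≤ = ∣n⇒∣m*n (v * Y) (∣-trans (^-≤-∣ q k≤) root)
            q^i₁ : q ^ suc i ∣ + 2 * X₁ + s * Y₁
            q^i₁ = *-cancel-q-∣ (∣-≡ (∣m∣n⇒∣m-n (∣-trans (∣-reflexive (sym (*-assoc q q (q ^ i)))) (*-mono-∣ link q^i))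
                                                 (root∣ (s≤s (s≤s (ℕ.m≤m+n i (suc j))))))
              (trans (shape₁ u v s X Y) (trans (cong₂ (λ x y → + 2 * x + s * y) (sym x) (sym y)) (shape₂ q s X₁ Y₁))))
              where
              shape₁ : ∀ u v s X Y → (u + s * v) * (+ 2 * X + s * Y) - (v * Y) * (s * s + + 6) ≡ + 2 * (u * X - + 3 * v * Y) + s * (u * Y + + 2 * v * X)
              shape₁ = solve-∀
              shape₂ : ∀ q s X Y → + 2 * (q * X) + s * (q * Y) ≡ q * (+ 2 * X + s * Y)
              shape₂ = solve-∀
            q^j₁ : q ^ j ∣ + 2 * X₁ + - s * Y₁
            q^j₁ = *-cancel-q-∣ (∣-≡ (∣m∣n⇒∣m-n (∣n⇒∣m*n (u - s * v) q^j)
                                                 (root∣ (ℕ.≤-trans (ℕ.m≤n+m (suc j) i) (ℕ.m≤n+m (i ℕ.+ suc j) 2))))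
              (trans (shape₁ u v s X Y) (trans (cong₂ (λ x y → + 2 * x + - s * y) (sym x) (sym y)) (shape₂ q s X₁ Y₁))))
              where
              shape₁ : ∀ u v s X Y → (u - s * v) * (+ 2 * X + - s * Y) - (v * Y) * (s * s + + 6) ≡ + 2 * (u * X - + 3 * v * Y) + - s * (u * Y + + 2 * v * X)
              shape₁ = solve-∀
              shape₂ : ∀ q s X Y → + 2 * (q * X) + - s * (q * Y) ≡ q * (+ 2 * X + - s * Y)
              shape₂ = solve-∀

      module _ {M : ℕ} {m : ℤ} (M≡ : + M ≡ q ^ e * m) where

        abstract
          -- The norm of 2X + Y√-6 is 2M; with s in place of √-6 it is 2M up to a multiple of s² +
          -- 6.
          conjugate-product : ∀ {r X Y} → Solution M r (X , Y) →
            (+ 2 * X + s * Y) * (+ 2 * X + t * Y) ≡ + 2 * + M - Y * Y * (s * s + + 6)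
          conjugate-product {r} {X} {Y} (solution eq _ _) = trans (cong (λ t → (+ 2 * X + s * Y) * (+ 2 * X + t * Y)) t≡-s)
            (trans (shape s X Y) (cong (λ z → + 2 * z - Y * Y * (s * s + + 6)) eq))
            where
            shape : ∀ s X Y → (+ 2 * X + s * Y) * (+ 2 * X + - s * Y) ≡ + 2 * (+ 2 * (X * X) + + 3 * (Y * Y)) - Y * Y * (s * s + + 6)
            shape = solve-∀

          -- Since q^e divides 2M and the error term, its e factors are shared between the two
          -- conjugate factors.
          level : ∀ {r β} → Solution M r β → ∃₂ λ i j → i ℕ.+ j ≡ e × Divides q s i β × Divides q t j β
          level {r} {X , Y} sol with q^∣*⇒ e {+ 2 * X + s * Y} {+ 2 * X + t * Y} (∣-≡ (∣m∣n⇒∣m-n (∣n⇒∣m*n (+ 2) (∣-≡ (∣m⇒∣m*n m ∣-refl) (sym M≡)))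
                   (∣n⇒∣m*n (Y * Y) (∣-trans (^-≤-∣ q (ℕ.m≤n+m e 2)) root))) (sym (conjugate-product sol)))
          ... | i , j , i+j≡e , q^i , q^j = i , j , i+j≡e , divides𝔭 q^i , divides𝔭 q^j

        module _ (q∤m : ¬ q ∣ m) where

          abstract
            -- Otherwise q^(e+1) would divide 2M, although q divides neither 2 nor m. Consequently
            -- the level i of a solution is well defined.
            level-bound : ∀ {r β i j} → Solution M r β → Divides q s i β → Divides q t j β → i ℕ.+ j ℕ.≤ e
            level-bound {r} {X , Y} {i} {j} sol (divides𝔭 q^i) (divides𝔭 q^j) = ℕ.≮⇒≥ λ e<i+j →
              q∤m (q∣2* (q^∣q^*⇒ e (∣-≡ (∣m∣n⇒∣m+n (∣-trans (^-≤-∣ q e<i+j) (∣-≡ (∣-trans (∣-reflexive (^-distribˡ-+-* q i j)) (*-mono-∣ q^i q^j)) (conjugate-product sol)))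
                   (∣n⇒∣m*n (Y * Y) (∣-trans (^-≤-∣ q (ℕ.n≤1+n (suc e))) root)))
                (trans (shape (+ M) (Y * Y * (s * s + + 6))) (trans (cong (+ 2 *_) M≡) (swap (q ^ e) m))))))
              where
              shape : ∀ M A → + 2 * M - A + A ≡ + 2 * M
              shape = solve-∀
              swap : ∀ Q m → + 2 * (Q * m) ≡ Q * (+ 2 * m)
              swap = solve-∀

            level-unique : ∀ {r β i j i′ j′} → Solution M r β → i ℕ.+ j ≡ e → i′ ℕ.+ j′ ≡ e →
              Divides q s i β → Divides q t j β → Divides q s i′ β → Divides q t j′ β → i ≡ i′
            level-unique {i = i} {j} {i′} {j′} sol i+j i′+j′ s-i t-j s-i′ t-j′ = ℕ.≤-antisym
              (ℕ.+-cancelʳ-≤ j′ i i′ (ℕ.≤-trans (level-bound sol s-i t-j′) (ℕ.≤-reflexive (sym i′+j′))))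
              (ℕ.+-cancelʳ-≤ j i′ i (ℕ.≤-trans (level-bound sol s-i′ t-j) (ℕ.≤-reflexive (sym i+j))))

-- Parity of the number of solutions, from the action on levels.

module OrbitCounting where

  open Counting
  open Representations
  open Rotations
  open import Data.Nat as ℕ using (ℕ; zero; suc; s≤s)
  import Data.Nat.Properties as ℕ
  import Data.Nat.Divisibility as ℕ
  open import Data.Integer as ℤ using (ℤ; +_; _+_; _*_; -_; _-_; _^_; 1ℤ)
  open import Data.Integer.Properties using (neg-involutive; neg-injective; ≰⇒>; neg-mono-≤; ≤-antisym; <⇒≤)
  open import Data.Integer.Divisibility.Signed
  open import Data.Integer.Tactic.RingSolver using (solve-∀)
  open import Data.List using (length)
  open import Data.List.Membership.Propositional using (_∈_)
  open import Data.Product using (∃; _×_; _,_; proj₁; proj₂)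
  open import Data.Sum using (_⊎_; inj₁; inj₂)
  open import Relation.Nullary using (¬_; Dec; yes; no; contradiction)
  open import Relation.Nullary.Decidable using (_×-dec_; from-no)
  open import Relation.Binary.PropositionalEquality using (_≡_; _≢_; refl; sym; trans; cong; cong₂; subst)

  open Solution

  -- Y ↦ -Y preserves Y ≡ 0 modulo 3 and has no fixed point, since Y = 0 would make M even.
  2∣length-solutions-0 : ∀ {M} → ¬ 2 ℕ.∣ M → 2 ℕ.∣ length (solutions M (+ 0))
  2∣length-solutions-0 {M} 2∤M = 2∣length (λ (X , Y) → + 0 ℤ.≤? Y) Conj Conj (solutions-unique M (+ 0))
    (λ {β} β∈ 0≤Y → conj β , conj-∈ β∈ , (λ 0≤-Y → nonzero β∈ (≤-antisym (neg-cancel 0≤-Y) 0≤Y)) , reflects)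
    (λ {β} β∈ 0≰Y → conj β , conj-∈ β∈ , neg-mono-≤ (<⇒≤ (≰⇒> 0≰Y)) , reflects)
    conj-injective conj-injective
    where
    conj : ℤ × ℤ → ℤ × ℤ
    conj (X , Y) = X , - Y
    data Conj (β γ : ℤ × ℤ) : Set where
      reflected : conj β ≡ γ → Conj β γ
    reflects : ∀ {β} → Conj β (conj β)
    reflects = reflected refl
    neg-cancel : ∀ {Y} → + 0 ℤ.≤ - Y → Y ℤ.≤ + 0
    neg-cancel {Y} le = subst (ℤ._≤ + 0) (neg-involutive Y) (neg-mono-≤ le)
    conj-injective : ∀ {β β′ γ} → Conj β γ → Conj β′ γ → β ≡ β′
    conj-injective (reflected refl) (reflected e) = cong₂ _,_ (cong proj₁ (sym e)) (neg-injective (cong proj₂ (sym e)))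
    conj-∈ : ∀ {β} → β ∈ solutions M (+ 0) → conj β ∈ solutions M (+ 0)
    conj-∈ {X , Y} β∈ with solutions⇒Solution {M} {+ 0} β∈
    ... | solution eq X≡ Y≡ = Solution⇒solutions (solution (trans (shape X Y) eq) X≡ (∣-≡ (∣m⇒∣-m Y≡) (shape′ Y)))
      where
      shape : ∀ X Y → + 2 * (X * X) + + 3 * (- Y * - Y) ≡ + 2 * (X * X) + + 3 * (Y * Y)
      shape = solve-∀
      shape′ : ∀ Y → - (Y - + 0) ≡ - Y - + 0
      shape′ = solve-∀
    nonzero : ∀ {X Y} → (X , Y) ∈ solutions M (+ 0) → Y ≢ + 0
    nonzero {X} β∈ refl with solutions⇒Solution {M} {+ 0} β∈
    ... | solution eq _ _ = 2∤M (∣⇒∣ᵤ (divides (X * X) (trans (sym eq) (shape X))))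
      where
      shape : ∀ X → + 2 * (X * X) + + 0 ≡ X * X * + 2
      shape = solve-∀

  2∣2+ : ∀ {n} → 2 ℕ.∣ n → 2 ℕ.∣ suc (suc n)
  2∣2+ = ℕ.∣m∣n⇒∣m+n {2} {2} ℕ.∣-refl

  2∣⊎2∣suc : ∀ n → 2 ℕ.∣ n ⊎ 2 ℕ.∣ suc n
  2∣⊎2∣suc zero = inj₁ (2 ℕ.∣0)
  2∣⊎2∣suc (suc n) with 2∣⊎2∣suc n
  ... | inj₁ d = inj₂ (2∣2+ d)
  ... | inj₂ d = inj₁ d

  ¬2∣n×2∣suc : ∀ {n} → 2 ℕ.∣ n → ¬ 2 ℕ.∣ suc n
  ¬2∣n×2∣suc {n} d d′ = from-no (2 ℕ.∣? 1) (ℕ.∣m+n∣m⇒∣n (subst (2 ℕ.∣_) (ℕ.+-comm 1 n) d′) d)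

  module _ {q : ℤ} (Q : NormalisedPrime q) {e : ℕ} {u v s t : ℤ} (ρ : Rotation q e u v s t)
    {M : ℕ} {m : ℤ} (M≡ : + M ≡ q ^ e * m) (q∤m : ¬ q ∣ m) where
    open NormalisedPrime Q

    private
      ρ̄ = conjugate ρ
      v̄ = - v

      unique : ∀ {r β i j i′ j′} → Solution M r β → i ℕ.+ j ≡ e → i′ ℕ.+ j′ ≡ e →
        Divides q s i β → Divides q t j β → Divides q s i′ β → Divides q t j′ β → i ≡ i′
      unique = level-unique Q ρ {M} {m} M≡ q∤m

      rotate⁻ : ∀ {r i j β} → Solution M r β → Divides q s (suc i) β → Divides q t j β → suc i ℕ.+ j ≡ e →
        ∃ λ γ → Rotates q u v̄ β γ × Solution M (r + + 2 * v̄) γ × Divides q s i γ × Divides q t (suc j) γ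
      rotate⁻ {i = i} {j} sol ds dt eq with rotate Q ρ̄ sol dt ds (trans (ℕ.+-comm j (suc i)) eq)
      ... | γ , rot , sol′ , dt′ , ds′ = γ , rot , sol′ , ds′ , dt′

    -- On 𝔭-adic levels the rotation acts as i ↦ i + 1; cutting the e + 1 levels into blocks of three
    -- and closing each block up cyclically gives a permutation that shifts Y mod 3 by 2v.
    data Cycles (r : ℤ) (β γ : ℤ × ℤ) : Set where
      up   : ∀ {i j} → Solution M r γ → i ℕ.+ j ≡ e → Divides q s i γ → Divides q t j γ →
             ¬ 3 ℕ.∣ i → Rotates q u v β γ → Cycles r β γ
      down : ∀ {i j δ} → Solution M r γ → i ℕ.+ j ≡ e → Divides q s i γ → Divides q t j γ →
             3 ℕ.∣ i → Rotates q u v̄ β δ → Rotates q u v̄ δ γ → Cycles r β γ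

    -- The level of γ is unique, so whether 3 divides it tells which constructor produced γ.
    Cycles-injective : ∀ {r β β′ γ} → Cycles r β γ → Cycles r β′ γ → β ≡ β′
    Cycles-injective (up _ _ _ _ _ R) (up _ _ _ _ _ R′) = Rotates-injective Q ρ R R′
    Cycles-injective (up sol eq a b 3∤i _) (down _ eq′ a′ b′ 3∣i _ _) =
      contradiction (subst (3 ℕ.∣_) (sym (unique sol eq eq′ a b a′ b′)) 3∣i) 3∤i
    Cycles-injective (down sol eq a b 3∣i _ _) (up _ eq′ a′ b′ 3∤i _) =
      contradiction (subst (3 ℕ.∣_) (unique sol eq eq′ a b a′ b′) 3∣i) 3∤i
    Cycles-injective (down _ _ _ _ _ R₁ R₂) (down _ _ _ _ _ R₁′ R₂′) =
      Rotates-injective Q ρ̄ R₁ (subst (Rotates q u v̄ _) (sym (Rotates-injective Q ρ̄ R₂ R₂′)) R₁′)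

    -- Two backward rotations move Y by -4v, which is 2v modulo 3, just as one forward rotation
    -- does. Because 3 divides e + 1, the top level e ends a block, so wherever a forward rotation
    -- is called for it exists.
    cycle : 3 ℕ.∣ suc e → + 3 ∣ + 2 * v - 1ℤ → ∀ {r r′ β} → + 3 ∣ r + 1ℤ - r′ → Solution M r β → ∃ λ γ → Solution M r′ γ × Cycles r′ β γ
    cycle 3∣e+1 2v≡1 {r} {r′} r≡ sol with level Q ρ {M} {m} M≡ sol
    ... | i , j , i+j , ds , dt with 3 ℕ.∣? suc i
    cycle 3∣e+1 2v≡1 r≡ sol | zero , j , i+j , ds , dt | yes 3∣ = contradiction 3∣ (from-no (3 ℕ.∣? 1))
    cycle 3∣e+1 2v≡1 r≡ sol | suc zero , j , i+j , ds , dt | yes 3∣ = contradiction 3∣ (from-no (3 ℕ.∣? 2))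
    cycle 3∣e+1 2v≡1 {r} {r′} r≡ sol | suc (suc i) , j , i+j , ds , dt | yes 3∣
      with rotate⁻ sol ds dt i+j
    ... | δ , R₁ , sol₁ , ds₁ , dt₁ with rotate⁻ sol₁ ds₁ dt₁ (trans (ℕ.+-suc (suc i) j) i+j)
    ... | γ , R₂ , sol₂ , ds₂ , dt₂ = γ , sol′ , down sol′ (trans (ℕ.+-suc i (suc j)) (trans (cong suc (ℕ.+-suc i j)) i+j)) ds₂ dt₂
        (ℕ.∣m+n∣m⇒∣n 3∣ ℕ.∣-refl) R₁ R₂
      where
      shape : ∀ r r′ v → r + 1ℤ - r′ - (+ 2 * v - 1ℤ) * + 2 - + 3 ≡ r + + 2 * - v + + 2 * - v - r′
      shape = solve-∀
      sol′ : Solution M r′ γ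
      sol′ = Solution-≡ (∣-≡ (∣m∣n⇒∣m-n (∣m∣n⇒∣m-n r≡ (∣m⇒∣m*n (+ 2) 2v≡1)) ∣-refl) (shape r r′ v)) sol₂
    cycle 3∣e+1 2v≡1 r≡ sol | i , zero , i+j , ds , dt | no 3∤ = contradiction (subst (λ e → 3 ℕ.∣ suc e) (trans (sym i+j) (ℕ.+-identityʳ i)) 3∣e+1) 3∤
    cycle 3∣e+1 2v≡1 {r} {r′} r≡ sol | i , suc j , i+j , ds , dt | no 3∤ with rotate Q ρ sol ds dt i+j
    ... | γ , R , sol₁ , ds₁ , dt₁ = γ , sol′ , up sol′ (trans (sym (ℕ.+-suc i j)) i+j) ds₁ dt₁ 3∤ R
      where
      shape : ∀ r r′ v → r + 1ℤ - r′ + (+ 2 * v - 1ℤ) ≡ r + + 2 * v - r′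
      shape = solve-∀
      sol′ : Solution M r′ γ
      sol′ = Solution-≡ (∣-≡ (∣m∣n⇒∣m+n r≡ 2v≡1) (shape r r′ v)) sol₁

    -- The injections from residue 0 to 1 to 2 and back to 0 force the three classes to be equally
    -- large, and the class of 0 is even.
    2∣length-cyclic : 3 ℕ.∣ suc e → + 3 ∣ + 2 * v - 1ℤ → ¬ 2 ℕ.∣ M → 2 ℕ.∣ length (solutions M (+ 1))
    2∣length-cyclic 3∣e+1 2v≡1 2∤M = subst (2 ℕ.∣_) (ℕ.≤-antisym (step (+ 0) (+ 1) (divides (+ 0) refl))
        (ℕ.≤-trans (step (+ 1) (+ 2) (divides (+ 0) refl)) (step (+ 2) (+ 0) (divides (+ 1) refl)))) (2∣length-solutions-0 2∤M)
      where
      step : ∀ r r′ → + 3 ∣ r + 1ℤ - r′ → length (solutions M r) ℕ.≤ length (solutions M r′)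
      step r r′ r≡ = length-≤ (Cycles r′) (solutions-unique M r)
        (λ β∈ → let γ , sol , c = cycle 3∣e+1 2v≡1 r≡ (solutions⇒Solution {M} {r} β∈) in γ , Solution⇒solutions sol , c) Cycles-injective

    -- Writing the second exponent as e - i leaves one bounded number to search for, which makes
    -- `EvenLevel` decidable.
    AtLevel : ℕ → ℤ × ℤ → Set
    AtLevel i β = (q ^ i ∣ + 2 * proj₁ β + s * proj₂ β) × (q ^ (e ℕ.∸ i) ∣ + 2 * proj₁ β + t * proj₂ β)

    atLevel? : ∀ i β → Dec (AtLevel i β)
    atLevel? i (X , Y) = (q ^ i ∣? + 2 * X + s * Y) ×-dec (q ^ (e ℕ.∸ i) ∣? + 2 * X + t * Y)

    atLevel : ∀ {i j β} → i ℕ.+ j ≡ e → Divides q s i β → Divides q t j β → AtLevel i β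
    atLevel {i} {j} {X , Y} eq (divides𝔭 ds) (divides𝔭 dt) = ds , subst (λ j → q ^ j ∣ + 2 * X + t * Y) (trans (sym (ℕ.m+n∸m≡n i j)) (cong (ℕ._∸ i) eq)) dt

    atLevel-unique : ∀ {r i j i′ β} → Solution M r β → i ℕ.+ j ≡ e → Divides q s i β → Divides q t j β → i′ ℕ.≤ e → AtLevel i′ β → i ≡ i′
    atLevel-unique sol i+j ds dt i′≤e (ds′ , dt′) = unique sol i+j (ℕ.m+[n∸m]≡n i′≤e) ds dt (divides𝔭 ds′) (divides𝔭 dt′)

    EvenLevel : ℤ × ℤ → Set
    EvenLevel β = ∃ λ i → i ℕ.< suc e × (2 ℕ.∣ i × AtLevel i β)

    evenLevel? : ∀ β → Dec (EvenLevel β)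
    evenLevel? β = ℕ.anyUpTo? (λ i → (2 ℕ.∣? i) ×-dec atLevel? i β) (suc e)

    -- As e is odd, the levels 0, ..., e pair up as 2i and 2i + 1, and rotating back and forth
    -- matches each pair; since 3 divides v, the residue of Y is kept.
    2∣length-paired : 2 ℕ.∣ suc e → + 3 ∣ v → ∀ r → 2 ℕ.∣ length (solutions M r)
    2∣length-paired 2∣e+1 v≡0 r = 2∣length evenLevel? (Rotates q u v) (Rotates q u v̄) (solutions-unique M r)
      raise lower (Rotates-injective Q ρ) (Rotates-injective Q ρ̄)
      where
      shape : ∀ r v → v * - (+ 2) ≡ r - (r + + 2 * v)
      shape = solve-∀
      fix : ∀ {v γ} → + 3 ∣ v → Solution M (r + + 2 * v) γ → Solution M r γ
      fix {v} d = Solution-≡ (∣-≡ (∣m⇒∣m*n (+ 2) d) (shape′ r v))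
        where
        shape′ : ∀ r v → v * + 2 ≡ r + + 2 * v - r
        shape′ = solve-∀
      raise : ∀ {β} → β ∈ solutions M r → EvenLevel β → ∃ λ γ → γ ∈ solutions M r × ¬ EvenLevel γ × Rotates q u v β γ
      raise β∈ (i , s≤s i≤e , 2∣i , ds , dt) with e ℕ.∸ i | ℕ.m+[n∸m]≡n i≤e
      ... | zero | i+j = contradiction (subst (λ e → 2 ℕ.∣ suc e) (trans (sym i+j) (ℕ.+-identityʳ i)) 2∣e+1) (¬2∣n×2∣suc 2∣i)
      ... | suc j | i+j with rotate Q ρ (solutions⇒Solution {M} {r} β∈) (divides𝔭 ds) (divides𝔭 dt) i+j
      ... | γ , R , sol , ds′ , dt′ = γ , Solution⇒solutions (fix v≡0 sol) , odd , R
        where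
        odd : ¬ EvenLevel γ
        odd (i′ , s≤s i′≤e , 2∣i′ , at) = ¬2∣n×2∣suc 2∣i
          (subst (2 ℕ.∣_) (sym (atLevel-unique sol (trans (sym (ℕ.+-suc i j)) i+j) ds′ dt′ i′≤e at)) 2∣i′)
      lower : ∀ {β} → β ∈ solutions M r → ¬ EvenLevel β → ∃ λ γ → γ ∈ solutions M r × EvenLevel γ × Rotates q u v̄ β γ
      lower β∈ odd with level Q ρ {M} {m} M≡ (solutions⇒Solution {M} {r} β∈)
      ... | i , j , i+j , ds , dt with 2∣⊎2∣suc i
      ... | inj₁ 2∣i = contradiction (i , s≤s (ℕ.≤-trans (ℕ.m≤m+n i j) (ℕ.≤-reflexive i+j)) , 2∣i , atLevel i+j ds dt) odd
      lower β∈ odd | zero , j , i+j , ds , dt | inj₂ 2∣1 = contradiction 2∣1 (from-no (2 ℕ.∣? 1))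
      lower β∈ odd | suc i , j , i+j , ds , dt | inj₂ 2∣2+i with rotate⁻ (solutions⇒Solution {M} {r} β∈) ds dt i+j
      ... | γ , R , sol , ds′ , dt′ = γ , Solution⇒solutions (fix (∣m⇒∣-m v≡0) sol)
        , (i , s≤s (ℕ.≤-trans (ℕ.m≤m+n i (suc j)) (ℕ.≤-reflexive i+j′)) , ℕ.∣m+n∣m⇒∣n {2} {2} 2∣2+i ℕ.∣-refl , atLevel i+j′ ds′ dt′) , R
        where
        i+j′ = trans (ℕ.+-suc i j) i+j

-- The case M = 5q², and inert primes.

module ThreeOrbits where

  open Counting
  open Representations
  open Rotations
  open OrbitCounting
  open import Data.Nat as ℕ using (ℕ; zero; suc)
  import Data.Nat.Properties as ℕ
  import Data.Nat.Divisibility as ℕ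
  open import Data.Integer using (ℤ; +_; _+_; _*_; -_; _-_; _^_; 1ℤ)
  open import Data.Integer.Properties using (*-comm; *-identityʳ)
  open import Data.Integer.Divisibility.Signed
  open import Data.Integer.Tactic.RingSolver using (solve-∀)
  open import Data.List using (List; length; filter)
  open import Data.List.Membership.Propositional using (_∈_)
  open import Data.List.Membership.Propositional.Properties using (∈-filter⁺; ∈-filter⁻)
  open import Data.List.Relation.Unary.Unique.Propositional.Properties using () renaming (filter⁺ to filter-unique)
  open import Data.Product using (∃; ∃₂; _×_; _,_; proj₁; proj₂)
  open import Data.Sum using ([_,_]′)
  open import Relation.Nullary using (¬_; Dec; yes; no; contradiction; ¬?)
  open import Relation.Nullary.Decidable using (_×-dec_; from-no; map′)
  open import Relation.Binary.PropositionalEquality using (_≡_; _≢_; refl; sym; trans; cong; cong₂; subst)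

  open Solution

  record Divisible (q : ℤ) (xy : ℤ × ℤ) : Set where
    constructor divisible
    field
      q∣X : q ∣ proj₁ xy
      q∣Y : q ∣ proj₂ xy

  divisible? : ∀ q xy → Dec (Divisible q xy)
  divisible? q (X , Y) = map′ (λ (x , y) → divisible x y) (λ (divisible x y) → x , y) ((q ∣? X) ×-dec (q ∣? Y))

  quad-scale : ∀ q X Y → quad (X * q) (Y * q) ≡ q * (q * quad X Y)
  quad-scale q X Y = shape q X Y
    where
    shape : ∀ q X Y → + 2 * (X * q * (X * q)) + + 3 * (Y * q * (Y * q)) ≡ q * (q * (+ 2 * (X * X) + + 3 * (Y * Y)))
    shape = solve-∀

  data Scales (q : ℤ) : (β γ : ℤ × ℤ) → Set where
    scales : ∀ {X Y} → Scales q (X * q , Y * q) (X , Y)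

  module _ {q : ℤ} (Q : NormalisedPrime q) {M : ℕ} (M≡ : + M ≡ q ^ 2 * + 5) where
    open NormalisedPrime Q

    abstract
      -- Division by q is a bijection onto the solutions for M = 5, a list that evaluates to a
      -- single element, (1, 1).
      divisible-solutions : length (filter (divisible? q) (solutions M (+ 1))) ≡ 1
      divisible-solutions = length-≡ (Scales q) {ys = solutions 5 (+ 1)} (filter-unique (divisible? q) (solutions-unique M (+ 1))) (solutions-unique 5 (+ 1))
        (λ β∈ → let β∈′ , d = ∈-filter⁻ (divisible? q) {xs = solutions M (+ 1)} β∈ in shrink (solutions⇒Solution {M} {+ 1} β∈′) d)
        (λ γ∈ → grow (solutions⇒Solution {5} {+ 1} γ∈))
        injective (λ { scales R → functional R })
        where
        shape₀ : ∀ q x → q * (q * 1ℤ) * x ≡ q * (q * x)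
        shape₀ = solve-∀
        shape₁ : ∀ q k → k * q - 1ℤ - (q - 1ℤ) * k ≡ k - 1ℤ
        shape₁ = solve-∀
        shape₂ : ∀ q k → k - 1ℤ + (q - 1ℤ) * k ≡ k * q - 1ℤ
        shape₂ = solve-∀
        shrink : ∀ {β} → Solution M (+ 1) β → Divisible q β → ∃ λ γ → γ ∈ solutions 5 (+ 1) × Scales q β γ
        shrink (solution eq X≡ Y≡) (divisible (divides k refl) (divides l refl)) = (k , l) ,
          Solution⇒solutions (solution (*-cancel-q (*-cancel-q (trans (sym (quad-scale q k l)) (trans eq (trans M≡ (shape₀ q (+ 5)))))))
            (∣-≡ (∣m∣n⇒∣m-n X≡ (∣m⇒∣m*n k q≡1)) (shape₁ q k)) (∣-≡ (∣m∣n⇒∣m-n Y≡ (∣m⇒∣m*n l q≡1)) (shape₁ q l))) , scales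
        grow : ∀ {γ} → Solution 5 (+ 1) γ → ∃ λ β → β ∈ filter (divisible? q) (solutions M (+ 1)) × Scales q β γ
        grow {X , Y} (solution eq X≡ Y≡) = (X * q , Y * q) , ∈-filter⁺ (divisible? q)
          (Solution⇒solutions (solution (trans (quad-scale q X Y) (trans (cong (λ z → q * (q * z)) eq) (trans (sym (shape₀ q (+ 5))) (sym M≡))))
            (∣-≡ (∣m∣n⇒∣m+n X≡ (∣m⇒∣m*n X q≡1)) (shape₂ q X)) (∣-≡ (∣m∣n⇒∣m+n Y≡ (∣m⇒∣m*n Y q≡1)) (shape₂ q Y))))
          (divisible (divides X refl) (divides Y refl)) , scales
        injective : ∀ {β β′ γ} → Scales q β γ → Scales q β′ γ → β ≡ β′
        injective scales scales = refl
        functional : ∀ {X Y γ} → Scales q (X * q , Y * q) γ → (X , Y) ≡ γ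
        functional {X} {Y} {X′ , Y′} R = cong₂ _,_ (cancel (cong proj₁ (invert R))) (cancel (cong proj₂ (invert R)))
          where
          invert : ∀ {β X Y} → Scales q β (X , Y) → β ≡ (X * q , Y * q)
          invert scales = refl
          cancel : ∀ {a b} → a * q ≡ b * q → a ≡ b
          cancel {a} {b} e = *-cancel-q (trans (*-comm q a) (trans e (*-comm b q)))

    odd-length : 2 ℕ.∣ length (filter (λ β → ¬? (divisible? q β)) (solutions M (+ 1))) → ¬ 2 ℕ.∣ length (solutions M (+ 1))
    odd-length even 2∣ = from-no (2 ℕ.∣? 1) (ℕ.∣m+n∣m⇒∣n (subst (2 ℕ.∣_) total 2∣) even)
      where
      prims = length (filter (λ β → ¬? (divisible? q β)) (solutions M (+ 1)))
      total : length (solutions M (+ 1)) ≡ prims ℕ.+ 1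
      total = trans (sym (length-partition (divisible? q) (solutions M (+ 1))))
        (trans (cong (λ n → n ℕ.+ prims) divisible-solutions) (ℕ.+-comm 1 prims))

    module _ {u v s t : ℤ} (ρ : Rotation q 2 u v s t) (q∤5 : ¬ q ∣ + 5) (v≡0 : + 3 ∣ v) where
      open Rotation ρ

      private
        unique : ∀ {r β i j i′ j′} → Solution M r β → i ℕ.+ j ≡ 2 → i′ ℕ.+ j′ ≡ 2 →
          Divides q s i β → Divides q t j β → Divides q s i′ β → Divides q t j′ β → i ≡ i′
        unique = level-unique Q ρ {M} {+ 5} M≡ q∤5

        q^0∣ : ∀ {s β} → Divides q s 0 β
        q^0∣ {s} {X , Y} = divides𝔭 (divides (+ 2 * X + s * Y) (sym (*-identityʳ _)))

        q^1⇒q : ∀ {z} → q ^ 1 ∣ z → q ∣ z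
        q^1⇒q = ∣-trans (∣-reflexive (sym (*-identityʳ q)))

        q⇒q^1 : ∀ {z} → q ∣ z → q ^ 1 ∣ z
        q⇒q^1 = ∣-trans (∣-reflexive (*-identityʳ q))

        Divisible⇒level : ∀ {s β} → Divisible q β → Divides q s 1 β
        Divisible⇒level {s} (divisible x y) = divides𝔭 (q⇒q^1 (∣m∣n⇒∣m+n (∣n⇒∣m*n (+ 2) x) (∣n⇒∣m*n s y)))

        -- The sum of the two conjugate factors is 4X, so q divides X and hence sY; and q cannot
        -- divide s, because it does not divide 6.
        level⇒Divisible : ∀ {β} → Divides q s 1 β → Divides q t 1 β → Divisible q β
        level⇒Divisible {X , Y} (divides𝔭 ds) (divides𝔭 dt) = divisible q∣X q∣Y
          where
          shape : ∀ s X Y → + 2 * X + s * Y + (+ 2 * X + - s * Y) ≡ + 2 * (+ 2 * X)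
          shape = solve-∀
          shape′ : ∀ s X Y → + 2 * X + s * Y - + 2 * X ≡ s * Y
          shape′ = solve-∀
          shape″ : ∀ s → s * s + + 6 - s * s ≡ + 6
          shape″ = solve-∀
          q∣X : q ∣ X
          q∣X = q∣2* (q∣2* (∣-≡ (∣m∣n⇒∣m+n (q^1⇒q ds) (q^1⇒q dt)) (trans (cong (λ t → + 2 * X + s * Y + (+ 2 * X + t * Y)) t≡-s) (shape s X Y))))
          q∤s : ¬ q ∣ s
          q∤s q∣s = q∤6 (∣-≡ (∣m∣n⇒∣m-n (∣-trans (divides (q ^ 3) (*-comm q (q ^ 3))) root) (∣m⇒∣m*n s q∣s)) (shape″ s))
          q∣Y : q ∣ Y
          q∣Y = [ (λ q∣s → contradiction q∣s q∤s) , (λ z → z) ]′ (euclid (∣-≡ (∣m∣n⇒∣m-n (q^1⇒q ds) (∣n⇒∣m*n (+ 2) q∣X)) (shape′ s X Y)))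

        rotate⁻ : ∀ {r i j β} → Solution M r β → Divides q s (suc i) β → Divides q t j β → suc i ℕ.+ j ≡ 2 →
          ∃ λ γ → Rotates q u (- v) β γ × Solution M (r + + 2 * - v) γ × Divides q s i γ × Divides q t (suc j) γ
        rotate⁻ {i = i} {j} sol ds dt eq =
          let γ , rot , sol′ , dt′ , ds′ = rotate Q (conjugate ρ) sol dt ds (trans (ℕ.+-comm j (suc i)) eq) in γ , rot , sol′ , ds′ , dt′

        -- Two rotations lead across the middle level, from one outer level to the other.
        data Twice (w : ℤ) (β γ : ℤ × ℤ) : Set where
          twice : ∀ {δ} → Rotates q u w β δ → Rotates q u w δ γ → Twice w β γ

        top? : ∀ β → Dec (q ^ 2 ∣ + 2 * proj₁ β + s * proj₂ β)
        top? (X , Y) = q ^ 2 ∣? + 2 * X + s * Y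

        fix : ∀ {v γ} → + 3 ∣ v → Solution M (+ 1 + + 2 * v + + 2 * v) γ → Solution M (+ 1) γ
        fix {v} d = Solution-≡ (∣-≡ (∣m⇒∣m*n (+ 4) d) (shape v))
          where
          shape : ∀ v → v * + 4 ≡ + 1 + + 2 * v + + 2 * v - + 1
          shape = solve-∀

        not-divisible : ∀ {r β i j} → Solution M r β → i ℕ.+ j ≡ 2 → Divides q s i β → Divides q t j β → i ≢ 1 → ¬ Divisible q β
        not-divisible sol i+j ds dt i≢1 d = i≢1 (unique sol i+j refl ds dt (Divisible⇒level d) (Divisible⇒level d))

        primitives : List (ℤ × ℤ)
        primitives = filter (λ β → ¬? (divisible? q β)) (solutions M (+ 1))

      -- The primitive solutions sit on the two levels 𝔭² and 𝔭̄².
      2∣length-primitive : 2 ℕ.∣ length (filter (λ β → ¬? (divisible? q β)) (solutions M (+ 1)))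
      2∣length-primitive = 2∣length top? (Twice (- v)) (Twice v) (filter-unique (λ β → ¬? (divisible? q β)) (solutions-unique M (+ 1)))
        (λ β∈ top → let sol , prim = info β∈ in lower sol prim top (level Q ρ {M} {+ 5} M≡ sol))
        (λ β∈ ¬top → let sol , prim = info β∈ in raise sol prim ¬top (level Q ρ {M} {+ 5} M≡ sol))
        (λ { (twice R₁ R₂) (twice R₁′ R₂′) → Rotates-injective Q (conjugate ρ) R₁ (subst (Rotates q u (- v) _) (sym (Rotates-injective Q (conjugate ρ) R₂ R₂′)) R₁′) })
        (λ { (twice R₁ R₂) (twice R₁′ R₂′) → Rotates-injective Q ρ R₁ (subst (Rotates q u v _) (sym (Rotates-injective Q ρ R₂ R₂′)) R₁′) })
        where
        info : ∀ {β} → β ∈ primitives → Solution M (+ 1) β × ¬ Divisible q β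
        info β∈ = let β∈′ , prim = ∈-filter⁻ (λ β → ¬? (divisible? q β)) {xs = solutions M (+ 1)} β∈ in solutions⇒Solution {M} {+ 1} β∈′ , prim
        member : ∀ {β} → Solution M (+ 1) β → ¬ Divisible q β → β ∈ primitives
        member sol prim = ∈-filter⁺ (λ β → ¬? (divisible? q β)) (Solution⇒solutions sol) prim
        lower : ∀ {β} → Solution M (+ 1) β → ¬ Divisible q β → q ^ 2 ∣ + 2 * proj₁ β + s * proj₂ β →
          (∃₂ λ i j → i ℕ.+ j ≡ 2 × Divides q s i β × Divides q t j β) →
          ∃ λ γ → γ ∈ primitives × ¬ (q ^ 2 ∣ + 2 * proj₁ γ + s * proj₂ γ) × Twice (- v) β γ
        lower sol prim top (0 , 2 , refl , ds , dt) = contradiction (unique sol refl refl ds dt (divides𝔭 top) q^0∣) λ ()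
        lower sol prim top (1 , 1 , refl , ds , dt) = contradiction (level⇒Divisible ds dt) prim
        lower sol prim top (2 , 0 , refl , ds , dt) =
          let δ , R₁ , sol₁ , ds₁ , dt₁ = rotate⁻ sol ds dt refl
              γ , R₂ , sol₂ , ds₂ , dt₂ = rotate⁻ sol₁ ds₁ dt₁ refl
          in γ , member (fix (∣m⇒∣-m v≡0) sol₂) (not-divisible sol₂ refl ds₂ dt₂ λ ())
               , (λ top′ → contradiction (unique sol₂ refl refl ds₂ dt₂ (divides𝔭 top′) q^0∣) λ ()) , twice R₁ R₂
        raise : ∀ {β} → Solution M (+ 1) β → ¬ Divisible q β → ¬ q ^ 2 ∣ + 2 * proj₁ β + s * proj₂ β →
          (∃₂ λ i j → i ℕ.+ j ≡ 2 × Divides q s i β × Divides q t j β) →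
          ∃ λ γ → γ ∈ primitives × (q ^ 2 ∣ + 2 * proj₁ γ + s * proj₂ γ) × Twice v β γ
        raise sol prim ¬top (2 , 0 , refl , ds , dt) = contradiction (Divides.divisibility ds) ¬top
        raise sol prim ¬top (1 , 1 , refl , ds , dt) = contradiction (level⇒Divisible ds dt) prim
        raise sol prim ¬top (0 , 2 , refl , ds , dt) =
          let δ , R₁ , sol₁ , ds₁ , dt₁ = rotate Q ρ sol ds dt refl
              γ , R₂ , sol₂ , ds₂ , dt₂ = rotate Q ρ sol₁ ds₁ dt₁ refl
          in γ , member (fix v≡0 sol₂) (not-divisible sol₂ refl ds₂ dt₂ λ ()) , Divides.divisibility ds₂ , twice R₁ R₂

  module _ {q : ℤ} (Q : NormalisedPrime q) (inert : ∀ s → ¬ q ∣ s * s + + 6) where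
    open NormalisedPrime Q

    -- If q did not divide Y, then 2X/Y would be a root of -6 modulo q, because 2(2X² + 3Y²) = (2X)²
    -- + 6Y².
    inert-divisible : ∀ {X Y} → q ∣ quad X Y → Divisible q (X , Y)
    inert-divisible {X} {Y} q∣ = by-cases (q ∣? Y)
      where
      shape : ∀ X Y → + 2 * (X * X) + + 3 * (Y * Y) - Y * (+ 3 * Y) ≡ + 2 * (X * X)
      shape = solve-∀
      shape′ : ∀ X Y z → + 2 * (z * z) * (+ 2 * (X * X) + + 3 * (Y * Y)) - (Y * z - 1ℤ) * (+ 6 * (Y * z + 1ℤ)) ≡ (+ 2 * X * z) * (+ 2 * X * z) + + 6
      shape′ = solve-∀
      by-cases : Dec (q ∣ Y) → Divisible q (X , Y)
      by-cases (yes q∣Y) = divisible (q∣²⇒q∣ (q∣2* (∣-≡ (∣m∣n⇒∣m-n q∣ (∣m⇒∣m*n (+ 3 * Y) q∣Y)) (shape X Y)))) q∣Y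
      by-cases (no q∤Y) = let z , q∣Yz-1 = inverse q∤Y in contradiction
        (∣-≡ (∣m∣n⇒∣m-n (∣n⇒∣m*n (+ 2 * (z * z)) q∣) (∣m⇒∣m*n (+ 6 * (Y * z + 1ℤ)) q∣Yz-1)) (shape′ X Y z)) (inert (+ 2 * X * z))

    -- Descent: q divides both coordinates, and taking it out lowers the odd number e by two until,
    -- at e = 1, q would divide m.
    inert-insoluble : ∀ e {m X Y} → 2 ℕ.∣ suc e → ¬ q ∣ m → quad X Y ≢ q ^ e * m
    inert-insoluble zero    2∣1 = contradiction 2∣1 (from-no (2 ℕ.∣? 1))
    inert-insoluble (suc e) {m} {X} {Y} 2∣2+e q∤m eq = descend e {X} {Y} 2∣2+e eq (inert-divisible {X} {Y} (∣-≡ (divides (q ^ e * m) (shape q (q ^ e) m)) (sym eq)))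
      where
      shape : ∀ q a m → q * a * m ≡ a * m * q
      shape = solve-∀
      shape₁ : ∀ q m → q * 1ℤ * m ≡ q * m
      shape₁ = solve-∀
      shape₂ : ∀ q a m → q * (q * a) * m ≡ q * (q * (a * m))
      shape₂ = solve-∀
      descend : ∀ e {X Y} → 2 ℕ.∣ suc (suc e) → quad X Y ≡ q ^ suc e * m → ¬ Divisible q (X , Y)
      descend zero 2∣ eq (divisible (divides k refl) (divides l refl)) =
        q∤m (∣-≡ (divides (quad k l) (*-comm q (quad k l))) (*-cancel-q (trans (sym (quad-scale q k l)) (trans eq (shape₁ q m)))))
      descend (suc e) 2∣ eq (divisible (divides k refl) (divides l refl)) =
        inert-insoluble e {m} {k} {l} (ℕ.∣m+n∣m⇒∣n {2} {2} 2∣ ℕ.∣-refl) q∤m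
          (*-cancel-q (*-cancel-q (trans (sym (quad-scale q k l)) (trans eq (shape₂ q (q ^ e) m)))))

-- Inverses, residues modulo 3 and the sign of q.

module PrimeSplitting where

  open Representations using (square-abs)
  open Rotations
  open import Data.Nat as ℕ using (ℕ; zero; suc; z≤n; s≤s)
  import Data.Nat.Properties as ℕ
  import Data.Nat.Divisibility as ℕ
  import Data.Nat.DivMod as ℕ
  open import Data.Nat.GCD using (module Bézout)
  open import Data.Nat.Coprimality using (Coprime; coprime-Bézout)
  open import Data.Nat.Primality using (Prime; prime⇒irreducible; prime⇒nonZero; euclidsLemma)
  open import Data.Nat.Induction using (<-rec)
  open import Data.Nat.Tactic.RingSolver using () renaming (solve-∀ to solve-ℕ)
  open import Data.Integer as ℤ using (ℤ; +_; -[1+_]; _+_; _*_; -_; _-_; _^_; 0ℤ; 1ℤ)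
  open import Data.Integer.Properties using (*-comm; abs-*; pos-*; ∣-i∣≡∣i∣; +-injective; neg-involutive; m-n≡m⊖n; ⊖-≥; ∣i∣≡0⇒i≡0; ∣i-j∣≡∣j-i∣)
  open import Data.Integer.DivMod using (_%ℕ_; _/ℕ_; a≡a%ℕn+[a/ℕn]*n; n%ℕd<d)
  open import Data.Integer.Divisibility.Signed
  open import Data.Integer.Tactic.RingSolver using (solve-∀)
  open import Data.Product using (∃; ∃₂; _×_; _,_; proj₁; proj₂)
  open import Data.Sum using (_⊎_; inj₁; inj₂; [_,_]′)
  open import Relation.Nullary using (¬_; Dec; yes; no; contradiction)
  open import Relation.Nullary.Decidable using (from-no)
  open import Relation.Binary.PropositionalEquality using (_≡_; _≢_; refl; sym; trans; cong; cong₂; subst; subst₂)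

  prime∧∤⇒coprime : ∀ {p n} → Prime p → ¬ p ℕ.∣ n → Coprime p n
  prime∧∤⇒coprime {p} pr p∤n (d∣p , d∣n) with prime⇒irreducible pr d∣p
  ... | inj₁ d≡1  = d≡1
  ... | inj₂ refl = contradiction d∣n p∤n

  inverse-mod-prime : ∀ {p a} → Prime p → ¬ p ℕ.∣ a → ∃ λ z → + p ∣ + a * z - 1ℤ
  inverse-mod-prime {p} {a} pr p∤a with coprime-Bézout (prime∧∤⇒coprime pr p∤a)
  ... | Bézout.+- x y eq = - + y , divides (- + x) (trans (shape (+ a) (+ y)) (trans (cong -_ cast) (shape′ (+ x) (+ p))))
    where
    cast : 1ℤ + + y * + a ≡ + x * + p
    cast = trans (cong (λ z → 1ℤ + z) (sym (pos-* y a))) (trans (cong +_ eq) (pos-* x p))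
    shape : ∀ a y → a * - y - 1ℤ ≡ - (1ℤ + y * a)
    shape = solve-∀
    shape′ : ∀ x p → - (x * p) ≡ - x * p
    shape′ = solve-∀
  ... | Bézout.-+ x y eq = + y , divides (+ x) (trans (cong (_- 1ℤ) (trans (*-comm (+ a) (+ y)) (sym cast))) (shape (+ x * + p)))
    where
    cast : 1ℤ + + x * + p ≡ + y * + a
    cast = trans (cong (λ z → 1ℤ + z) (sym (pos-* x p))) (trans (cong +_ eq) (pos-* y a))
    shape : ∀ a → 1ℤ + a - 1ℤ ≡ a
    shape = solve-∀

  mod3-ℕ : ∀ n → + 3 ∣ + n ⊎ + 3 ∣ + n - 1ℤ ⊎ + 3 ∣ + n + 1ℤ
  mod3-ℕ zero = inj₁ (divides (+ 0) refl)
  mod3-ℕ (suc n) with mod3-ℕ n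
  ... | inj₁ d        = inj₂ (inj₁ (∣-≡ d (shape (+ n))))
    where
    shape : ∀ n → n ≡ 1ℤ + n - 1ℤ
    shape = solve-∀
  ... | inj₂ (inj₁ d) = inj₂ (inj₂ (∣-≡ (∣m∣n⇒∣m+n d ∣-refl) (shape (+ n))))
    where
    shape : ∀ n → n - 1ℤ + + 3 ≡ 1ℤ + n + 1ℤ
    shape = solve-∀
  ... | inj₂ (inj₂ d) = inj₁ (∣-≡ d (shape (+ n)))
    where
    shape : ∀ n → n + 1ℤ ≡ 1ℤ + n
    shape = solve-∀

  mod3 : ∀ z → + 3 ∣ z ⊎ + 3 ∣ z - 1ℤ ⊎ + 3 ∣ z + 1ℤ
  mod3 (+ n) = mod3-ℕ n
  mod3 -[1+ n ] with mod3-ℕ (suc n)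
  ... | inj₁ d        = inj₁ (∣m⇒∣-m d)
  ... | inj₂ (inj₁ d) = inj₂ (inj₂ (∣-≡ (∣m⇒∣-m d) (shape (+ suc n))))
    where
    shape : ∀ n → - (n - 1ℤ) ≡ - n + 1ℤ
    shape = solve-∀
  ... | inj₂ (inj₂ d) = inj₂ (inj₁ (∣-≡ (∣m⇒∣-m d) (shape (+ suc n))))
    where
    shape : ∀ n → - (n + 1ℤ) ≡ - n - 1ℤ
    shape = solve-∀

  normalisedPrime : ∀ {p q} → Prime p → 5 ℕ.≤ p → ℤ.∣ q ∣ ≡ p → + 3 ∣ q - 1ℤ → NormalisedPrime q
  normalisedPrime {p} {q} pr 5≤p refl q≡1 = record
    { euclid   = λ {a} {b} d → [ (λ x → inj₁ (∣ᵤ⇒∣ x)) , (λ x → inj₂ (∣ᵤ⇒∣ x)) ]′ (euclidsLemma ℤ.∣ a ∣ ℤ.∣ b ∣ pr (subst (p ℕ.∣_) (abs-* a b) (∣⇒∣ᵤ d)))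
    ; inverse  = λ {a} q∤a → inv a (inverse-mod-prime pr (λ d → q∤a (∣ᵤ⇒∣ d)))
    ; q∤2      = λ d → ℕ.<⇒≱ (s≤s (s≤s (s≤s z≤n))) (ℕ.≤-trans 5≤p (ℕ.∣⇒≤ (∣⇒∣ᵤ d)))
    ; q∤3      = λ d → ℕ.<⇒≱ (s≤s (s≤s (s≤s (s≤s z≤n)))) (ℕ.≤-trans 5≤p (ℕ.∣⇒≤ (∣⇒∣ᵤ d)))
    ; q≡1      = q≡1
    ; nonZero  = prime⇒nonZero pr
    }
    where
    inv : ∀ a → (∃ λ z → + p ∣ + ℤ.∣ a ∣ * z - 1ℤ) → ∃ λ z → q ∣ a * z - 1ℤ
    inv (+ n)    (z , d) = z , ∣-trans m∣∣m∣ d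
    inv -[1+ n ] (z , d) = - z , ∣-trans m∣∣m∣ (∣-≡ d (shape (+ suc n) z))
      where
      shape : ∀ n z → n * z - 1ℤ ≡ - n * - z - 1ℤ
      shape = solve-∀

  prime∧3∣⇒≡3 : ∀ {p} → Prime p → 3 ℕ.∣ p → p ≡ 3
  prime∧3∣⇒≡3 pr 3∣p with prime⇒irreducible pr 3∣p
  ... | inj₂ 3≡p = sym 3≡p

  normalise : ∀ {p} → Prime p → 5 ℕ.≤ p → ∃ λ q → (q ≡ + p ⊎ q ≡ - + p) × NormalisedPrime q
  normalise {p} pr 5≤p with mod3 (+ p)
  ... | inj₁ d        = contradiction (subst (5 ℕ.≤_) (prime∧3∣⇒≡3 pr (∣⇒∣ᵤ d)) 5≤p) (ℕ.<⇒≱ (s≤s (s≤s (s≤s (s≤s z≤n)))))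
  ... | inj₂ (inj₁ d) = + p , inj₁ refl , normalisedPrime pr 5≤p refl d
  ... | inj₂ (inj₂ d) = - + p , inj₂ refl , normalisedPrime pr 5≤p (∣-i∣≡∣i∣ (+ p)) (∣-≡ (∣m⇒∣-m d) (shape (+ p)))
    where
    shape : ∀ n → - (n + 1ℤ) ≡ - n - 1ℤ
    shape = solve-∀

  -- Reduction of forms of determinant 6 and the element of norm q².

  -- The form a X² + 2b XY + c Y² of determinant 6 is equivalent to a diagonal form d X² + f Y² with d f = 6.
  record Diagonal (a b c : ℤ) : Set where
    field
      d f x y z w : ℤ
      df    : d * f ≡ + 6
      a-eq  : a ≡ d * (x * x) + f * (y * y)
      c-eq  : c ≡ d * (z * z) + f * (w * w)
      b-eq  : b ≡ d * (x * z) - f * (y * w)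
      det   : x * w + y * z ≡ 1ℤ

  -- The diagonalising variables are xX + zY and -yX + wY; with this choice of sign `b-eq` and `det`
  -- are symmetric under exchanging (x, y) with (z, w).
  Diagonal-swap : ∀ {a b c} → Diagonal a b c → Diagonal c b a
  Diagonal-swap D = record
    { d = d ; f = f ; x = z ; y = w ; z = x ; w = y ; df = df ; a-eq = c-eq ; c-eq = a-eq
    ; b-eq = trans b-eq (shape d f x y z w) ; det = trans (shape′ x y z w) det }
    where
    open Diagonal D
    shape : ∀ d f x y z w → d * (x * z) - f * (y * w) ≡ d * (z * x) - f * (w * y)
    shape = solve-∀
    shape′ : ∀ x y z w → z * y + w * x ≡ x * w + y * z
    shape′ = solve-∀

  -- The substitution of X + kY for X.
  Diagonal-translate : ∀ {a b c} k → Diagonal a b c → Diagonal a (b + k * a) (c + + 2 * k * b + k * k * a)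
  Diagonal-translate k record { d = d ; f = f ; x = x ; y = y ; z = z ; w = w ; df = df ; a-eq = refl ; c-eq = refl ; b-eq = refl ; det = det } = record
    { d = d ; f = f ; x = x ; y = y ; z = z + k * x ; w = w - k * y ; df = df ; a-eq = refl
    ; c-eq = shape₁ d f x y z w k ; b-eq = shape₂ d f x y z w k ; det = trans (shape₃ x y z w k) det }
    where
    shape₁ : ∀ d f x y z w k → d * (z * z) + f * (w * w) + + 2 * k * (d * (x * z) - f * (y * w)) + k * k * (d * (x * x) + f * (y * y)) ≡
      d * ((z + k * x) * (z + k * x)) + f * ((w - k * y) * (w - k * y))
    shape₁ = solve-∀
    shape₂ : ∀ d f x y z w k → d * (x * z) - f * (y * w) + k * (d * (x * x) + f * (y * y)) ≡ d * (x * (z + k * x)) - f * (y * (w - k * y))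
    shape₂ = solve-∀
    shape₃ : ∀ x y z w k → x * (w - k * y) + y * (z + k * x) ≡ x * w + y * z
    shape₃ = solve-∀

  balanced-remainder : ∀ b n → ∃₂ λ r k → b ≡ r + k * + suc n × 2 ℕ.* ℤ.∣ r ∣ ℕ.≤ suc n
  balanced-remainder b n with 2 ℕ.* (b %ℕ suc n) ℕ.≤? suc n
  ... | yes le = + (b %ℕ suc n) , b /ℕ suc n , a≡a%ℕn+[a/ℕn]*n b (suc n) , le
  ... | no gt = + ρ - + suc n , b /ℕ suc n + 1ℤ , trans (a≡a%ℕn+[a/ℕn]*n b (suc n)) (shape (+ ρ) (b /ℕ suc n) (+ suc n)) , bound
    where
    ρ = b %ℕ suc n
    shape : ∀ r k a → r + k * a ≡ r - a + (k + 1ℤ) * a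
    shape = solve-∀
    ρ<a : ρ ℕ.≤ suc n
    ρ<a = ℕ.<⇒≤ (n%ℕd<d b (suc n))
    abs-eq : ℤ.∣ + ρ - + suc n ∣ ≡ suc n ℕ.∸ ρ
    abs-eq = trans (∣i-j∣≡∣j-i∣ (+ ρ) (+ suc n)) (cong ℤ.∣_∣ (trans (m-n≡m⊖n (suc n) ρ) (⊖-≥ ρ<a)))
    bound : 2 ℕ.* ℤ.∣ + ρ - + suc n ∣ ℕ.≤ suc n
    bound = ℕ.≤-trans (ℕ.≤-reflexive (trans (cong (2 ℕ.*_) abs-eq) (ℕ.*-distribˡ-∸ 2 (suc n) ρ)))
      (ℕ.≤-trans (ℕ.∸-monoʳ-≤ (2 ℕ.* suc n) (ℕ.<⇒≤ (ℕ.≰⇒> gt))) (ℕ.≤-reflexive (trans (cong (ℕ._∸ suc n) (shape′ (suc n))) (ℕ.m+n∸m≡n (suc n) (suc n)))))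
      where
      shape′ : ∀ n → 2 ℕ.* n ≡ n ℕ.+ n
      shape′ = solve-ℕ

  -- A reduced form (2∣r∣ ≤ a ≤ c) of determinant 6 has a² ≤ 8, which leaves only diagonal forms.
  reduced⇒r≡0 : ∀ a r c → a ℕ.* c ≡ r ℕ.* r ℕ.+ 6 → 2 ℕ.* r ℕ.≤ a → a ℕ.≤ c → r ≡ 0
  reduced⇒r≡0 a zero c eq 2r≤a a≤c = refl
  reduced⇒r≡0 (suc (suc (suc a))) (suc r) c eq 2r≤a a≤c = contradiction bound (ℕ.<⇒≱ big)
    where
    A = suc (suc (suc a))
    R = suc r
    bound : 4 ℕ.* (A ℕ.* A) ℕ.≤ A ℕ.* A ℕ.+ 24
    bound = ℕ.≤-trans (ℕ.*-monoʳ-≤ 4 (ℕ.≤-trans (ℕ.*-monoʳ-≤ A a≤c) (ℕ.≤-reflexive eq)))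
      (ℕ.≤-trans (ℕ.≤-reflexive (shape R)) (ℕ.+-monoˡ-≤ 24 (ℕ.*-mono-≤ 2r≤a 2r≤a)))
      where
      shape : ∀ r → 4 ℕ.* (r ℕ.* r ℕ.+ 6) ≡ 2 ℕ.* r ℕ.* (2 ℕ.* r) ℕ.+ 24
      shape = solve-ℕ
    big : A ℕ.* A ℕ.+ 24 ℕ.< 4 ℕ.* (A ℕ.* A)
    big = ℕ.≤-trans (ℕ.m≤m+n _ (2 ℕ.+ 18 ℕ.* a ℕ.+ 3 ℕ.* (a ℕ.* a))) (ℕ.≤-reflexive (shape a))
      where
      shape : ∀ a → suc ((3 ℕ.+ a) ℕ.* (3 ℕ.+ a) ℕ.+ 24) ℕ.+ (2 ℕ.+ 18 ℕ.* a ℕ.+ 3 ℕ.* (a ℕ.* a)) ≡ 4 ℕ.* ((3 ℕ.+ a) ℕ.* (3 ℕ.+ a))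
      shape = solve-ℕ
  reduced⇒r≡0 2 (suc zero) c eq 2r≤a a≤c = contradiction (ℕ.divides c (trans (sym eq) (ℕ.*-comm 2 c))) (from-no (2 ℕ.∣? 7))
  reduced⇒r≡0 2 (suc (suc r)) c eq (s≤s (s≤s 2r≤0)) a≤c = contradiction 2r≤0 (ℕ.<⇒≱ (ℕ.≤-trans (s≤s z≤n) (ℕ.≤-reflexive (sym (shape r)))))
    where
    shape : ∀ r → r ℕ.+ suc (suc (r ℕ.+ 0)) ≡ suc (suc (r ℕ.+ r))
    shape = solve-ℕ
  reduced⇒r≡0 1 (suc r) c eq (s≤s 2r≤0) a≤c = contradiction 2r≤0 (ℕ.<⇒≱ (ℕ.≤-trans (s≤s z≤n) (ℕ.≤-reflexive (sym (ℕ.+-suc r (r ℕ.+ 0))))))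

  -- Gauss reduction by recursion on a: a translation achieves 2|b| ≤ a, and if c < a the outer
  -- coefficients are exchanged. Once a ≤ c, the middle coefficient is 0 and the form is itself
  -- diagonal.
  diagonalise : ∀ a b c → + a * c ≡ b * b + + 6 → Diagonal (+ a) b c
  diagonalise = <-rec (λ a → ∀ b c → + a * c ≡ b * b + + 6 → Diagonal (+ a) b c) step
    where
    positive : ∀ r → r * r + + 6 ≡ + (ℤ.∣ r ∣ ℕ.* ℤ.∣ r ∣ ℕ.+ 6)
    positive r = cong (_+ + 6) (square-abs r)
    step : ∀ a → (∀ {a′} → a′ ℕ.< a → ∀ b c → + a′ * c ≡ b * b + + 6 → Diagonal (+ a′) b c) →
      ∀ b c → + a * c ≡ b * b + + 6 → Diagonal (+ a) b c
    step zero rec b c eq = contradiction (trans eq (positive b)) 0≢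
      where
      0≢ : ∀ {n} → 0ℤ ≢ + (n ℕ.+ 6)
      0≢ {n} e = ℕ.1+n≢0 {n ℕ.+ 5} (trans (sym (ℕ.+-suc n 5)) (sym (+-injective e)))
    step (suc n) rec b c eq = main (balanced-remainder b n)
      where
      a = + suc n
      main : (∃₂ λ r k → b ≡ r + k * a × 2 ℕ.* ℤ.∣ r ∣ ℕ.≤ suc n) → Diagonal a b c
      main (r , k , refl , 2r≤a) = subst (Diagonal a (r + k * a)) (shape₂ c k r a) (Diagonal-translate k (reduced c₀ eq₀))
        where
        c₀ = c - + 2 * k * r - k * k * a
        shape₁ : ∀ a c k r → a * (c - + 2 * k * r - k * k * a) ≡ a * c - (+ 2 * k * r * a + k * k * a * a)
        shape₁ = solve-∀
        shape₂ : ∀ c k r a → c - + 2 * k * r - k * k * a + + 2 * k * r + k * k * a ≡ c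
        shape₂ = solve-∀
        shape₃ : ∀ k r a → (r + k * a) * (r + k * a) + + 6 - (+ 2 * k * r * a + k * k * a * a) ≡ r * r + + 6
        shape₃ = solve-∀
        eq₀ : a * c₀ ≡ r * r + + 6
        eq₀ = trans (shape₁ a c k r) (trans (cong (_- (+ 2 * k * r * a + k * k * a * a)) eq) (shape₃ k r a))
        reduced : ∀ c₀ → a * c₀ ≡ r * r + + 6 → Diagonal a r c₀
        reduced -[1+ m ] eq₀ with () ← trans eq₀ (positive r)
        reduced (+ m) eq₀ = by-size (m ℕ.<? suc n)
          where
          by-size : Dec (m ℕ.< suc n) → Diagonal a r (+ m)
          by-size (yes m<a) = Diagonal-swap (rec m<a r a (trans (*-comm (+ m) a) eq₀))
          by-size (no m≮a) = record
            { d = a ; f = + m ; x = 1ℤ ; y = 0ℤ ; z = 0ℤ ; w = 1ℤ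
            ; df = trans eq₀ (cong (λ r → r * r + + 6) r≡0)
            ; a-eq = shape₄ a (+ m) ; c-eq = shape₅ a (+ m) ; b-eq = trans r≡0 (shape₆ a (+ m)) ; det = refl }
            where
            r≡0 : r ≡ 0ℤ
            r≡0 = ∣i∣≡0⇒i≡0 (reduced⇒r≡0 (suc n) ℤ.∣ r ∣ m (+-injective (trans (pos-* (suc n) m) (trans eq₀ (positive r)))) 2r≤a (ℕ.≮⇒≥ m≮a))
            shape₄ : ∀ a m → a ≡ a * (1ℤ * 1ℤ) + m * (0ℤ * 0ℤ)
            shape₄ = solve-∀
            shape₅ : ∀ a m → m ≡ a * (0ℤ * 0ℤ) + m * (1ℤ * 1ℤ)
            shape₅ = solve-∀
            shape₆ : ∀ a m → 0ℤ ≡ a * (1ℤ * 0ℤ) - m * (0ℤ * 1ℤ)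
            shape₆ = solve-∀

  -- The condition `q∤v` excludes q itself, which generates 𝔭𝔭̄ rather than the square of `𝔭` or of
  -- its conjugate.
  record Norm² (q : ℤ) : Set where
    constructor norm²
    field
      u v  : ℤ
      norm : u * u + + 6 * (v * v) ≡ q * q
      u≡1  : + 3 ∣ u - 1ℤ
      q∤v  : ¬ q ∣ v

  module _ {q : ℤ} (Q : NormalisedPrime q) where
    open NormalisedPrime Q

    -- From a = dx² + fy² and df = 6 one gets a² = (dx² - fy²)² + 6(2xy)². If q divided 2xy, it
    -- would divide both x and y, since q divides a but neither d nor f; this contradicts `det`.
    Diagonal⇒Norm² : ∀ {a b c} → q ∣ a → Diagonal a b c → ∃₂ λ u v → u * u + + 6 * (v * v) ≡ a * a × ¬ q ∣ v
    Diagonal⇒Norm² {a} q∣a D = d * (x * x) - f * (y * y) , + 2 * (x * y) , norm , q∤v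
      where
      open Diagonal D
      shape : ∀ d f x y → (d * (x * x) - f * (y * y)) * (d * (x * x) - f * (y * y)) + d * f * (+ 2 * (x * y) * (+ 2 * (x * y))) ≡
        (d * (x * x) + f * (y * y)) * (d * (x * x) + f * (y * y))
      shape = solve-∀
      norm : (d * (x * x) - f * (y * y)) * (d * (x * x) - f * (y * y)) + + 6 * (+ 2 * (x * y) * (+ 2 * (x * y))) ≡ a * a
      norm = trans (cong (λ k → (d * (x * x) - f * (y * y)) * (d * (x * x) - f * (y * y)) + k * (+ 2 * (x * y) * (+ 2 * (x * y)))) (sym df))
        (trans (shape d f x y) (sym (cong₂ _*_ a-eq a-eq)))
      q∣sum : q ∣ d * (x * x) + f * (y * y)
      q∣sum = ∣-≡ q∣a a-eq
      q∤d : ¬ q ∣ d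
      q∤d q∣d = q∤6 (∣-≡ (∣m⇒∣m*n f q∣d) df)
      q∤f : ¬ q ∣ f
      q∤f q∣f = q∤6 (∣-≡ (∣n⇒∣m*n d q∣f) df)
      q∤1 : ¬ q ∣ 1ℤ
      q∤1 q∣1 = q∤2 (∣n⇒∣m*n (+ 2) q∣1)
      shape₁ : ∀ a b → a + b - a ≡ b
      shape₁ = solve-∀
      shape₂ : ∀ a b → a + b - b ≡ a
      shape₂ = solve-∀
      not-both : q ∣ x → ¬ q ∣ y
      not-both q∣x q∣y = q∤1 (∣-≡ (∣m∣n⇒∣m+n (∣m⇒∣m*n w q∣x) (∣m⇒∣m*n z q∣y)) det)
      x⇒y : q ∣ x → q ∣ y
      x⇒y q∣x = [ (λ h → contradiction h q∤f) , q∣²⇒q∣ ]′ (euclid (∣-≡ (∣m∣n⇒∣m-n q∣sum (∣n⇒∣m*n d (∣m⇒∣m*n x q∣x))) (shape₁ (d * (x * x)) (f * (y * y)))))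
      y⇒x : q ∣ y → q ∣ x
      y⇒x q∣y = [ (λ h → contradiction h q∤d) , q∣²⇒q∣ ]′ (euclid (∣-≡ (∣m∣n⇒∣m-n q∣sum (∣n⇒∣m*n f (∣m⇒∣m*n y q∣y))) (shape₂ (d * (x * x)) (f * (y * y)))))
      q∤v : ¬ q ∣ + 2 * (x * y)
      q∤v q∣v = [ (λ q∣x → not-both q∣x (x⇒y q∣x)) , (λ q∣y → not-both (y⇒x q∣y) q∣y) ]′ (euclid (q∣2* q∣v))

    -- Modulo 3 the norm equation reads u² ≡ q² ≡ 1, so u is ±1 and its sign can be chosen.
    normalise-u : (∃₂ λ u v → u * u + + 6 * (v * v) ≡ q * q × ¬ q ∣ v) → Norm² q
    normalise-u (u , v , norm , q∤v) with mod3 u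
    ... | inj₁ 3∣u = contradiction (∣⇒∣ᵤ 3∣1) (from-no (3 ℕ.∣? 1))
      where
      shape : ∀ q x → x - q * q + (q - 1ℤ) * (q + 1ℤ) ≡ x - 1ℤ
      shape = solve-∀
      shape₁ : ∀ u v → u * u + + 6 * (v * v) ≡ u * u + (+ 2 * (v * v)) * + 3
      shape₁ = solve-∀
      3∣qq : + 3 ∣ q * q
      3∣qq = ∣-≡ (∣m∣n⇒∣m+n (∣m⇒∣m*n u 3∣u) (divides (+ 2 * (v * v)) refl)) (trans (sym (shape₁ u v)) norm)
      shape₂ : ∀ q → q * q - (q - 1ℤ) * (q + 1ℤ) ≡ 1ℤ
      shape₂ = solve-∀
      3∣1 : + 3 ∣ 1ℤ
      3∣1 = ∣-≡ (∣m∣n⇒∣m-n 3∣qq (∣m⇒∣m*n (q + 1ℤ) q≡1)) (shape₂ q)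
    ... | inj₂ (inj₁ d) = norm² u v norm d q∤v
    ... | inj₂ (inj₂ d) = norm² (- u) v (trans (shape u v) norm) (∣-≡ (∣m⇒∣-m d) (shape′ u)) q∤v
      where
      shape : ∀ u v → - u * - u + + 6 * (v * v) ≡ u * u + + 6 * (v * v)
      shape = solve-∀
      shape′ : ∀ n → - (n + 1ℤ) ≡ - n - 1ℤ
      shape′ = solve-∀

    module _ (N : Norm² q) where
      open Norm² N

      -- Hensel lifting of the root -u/v of z² + 6 modulo q².
      root-of-−6 : ∀ n → ∃ λ s → q ^ (2 ℕ.+ n) ∣ s * s + + 6 × q * q ∣ u + s * v
      -- `w` inverts v modulo q²: it is the Newton step from the inverse z modulo q, with vw - 1 =
      -- -(vz - 1)².
      root-of-−6 zero = let z , d = inverse q∤v ; w = z * (+ 2 - v * z) ; dd = ∣-≡ (∣m⇒∣-m (*-mono-∣ d d)) (shape₁ v z)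
        in - u * w , ∣-≡ (∣-trans (∣-reflexive (shape₀ q)) (∣m∣n⇒∣m-n (∣m⇒∣m*n (w * w) (∣-reflexive (sym norm))) (∣m⇒∣m*n (+ 6 * (v * w + 1ℤ)) dd))) (shape₂ u v w)
           , ∣-≡ (∣m⇒∣m*n (- u) dd) (shape₃ u v w)
        where
        shape₀ : ∀ q → q * (q * 1ℤ) ≡ q * q
        shape₀ = solve-∀
        shape₁ : ∀ v z → - ((v * z - 1ℤ) * (v * z - 1ℤ)) ≡ v * (z * (+ 2 - v * z)) - 1ℤ
        shape₁ = solve-∀
        shape₂ : ∀ u v w → (u * u + + 6 * (v * v)) * (w * w) - (v * w - 1ℤ) * (+ 6 * (v * w + 1ℤ)) ≡ - u * w * (- u * w) + + 6
        shape₂ = solve-∀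
        shape₃ : ∀ u v w → (v * w - 1ℤ) * - u ≡ u + - u * w * v
        shape₃ = solve-∀
      root-of-−6 (suc n) = let s , r , l = root-of-−6 n in lift s r l
        where
        P = q ^ (2 ℕ.+ n)
        q∣P : q ∣ P
        q∣P = divides (q ^ suc n) (*-comm q (q ^ suc n))
        qq∣P : q * q ∣ P
        qq∣P = divides (q ^ n) (shape q (q ^ n))
          where
          shape : ∀ q x → q * (q * x) ≡ x * (q * q)
          shape = solve-∀
        lift : ∀ s → P ∣ s * s + + 6 → q * q ∣ u + s * v → ∃ λ s → q ^ (3 ℕ.+ n) ∣ s * s + + 6 × q * q ∣ u + s * v
        lift s (divides m m-eq) l = s′
            , ∣-≡ (*-monoˡ-∣ P (∣m∣n⇒∣m-n (∣n⇒∣m*n (w * w) q∣P) (∣n⇒∣m*n m q∣2sz-1)))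
                (trans (shape₁ m s z P) (trans (cong (λ x → x + (+ 2 * s * w * P + w * w * P * P)) (sym m-eq)) (shape₂ s w P)))
            , ∣-≡ (∣m∣n⇒∣m+n l (∣n⇒∣m*n (w * v) qq∣P)) (shape₃ u s v w P)
          where
          q∤s : ¬ q ∣ + 2 * s
          q∤s q∣2s = q∤6 (∣-≡ (∣m∣n⇒∣m-n (∣-trans q∣P (divides m m-eq)) (∣m⇒∣m*n s (q∣2* q∣2s))) (shape s))
            where
            shape : ∀ s → s * s + + 6 - s * s ≡ + 6
            shape = solve-∀
          z = proj₁ (inverse q∤s)
          q∣2sz-1 = proj₂ (inverse q∤s)
          -- With s² + 6 = mP, the correction has to satisfy m + 2sw ≡ 0 modulo q, and z inverts 2s.
          w = - (m * z)
          s′ = s + w * P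
          shape₁ : ∀ m s z P → (- (m * z) * - (m * z) * P - m * (+ 2 * s * z - 1ℤ)) * P ≡ m * P + (+ 2 * s * - (m * z) * P + - (m * z) * - (m * z) * P * P)
          shape₁ = solve-∀
          shape₂ : ∀ s w P → s * s + + 6 + (+ 2 * s * w * P + w * w * P * P) ≡ (s + w * P) * (s + w * P) + + 6
          shape₂ = solve-∀
          shape₃ : ∀ u s v w P → u + s * v + w * v * P ≡ u + (s + w * P) * v
          shape₃ = solve-∀

      rotation : ∀ e → ∃₂ λ s t → Rotation q e u v s t
      rotation e = let s , r , l = root-of-−6 e in s , - s , record { norm = norm ; u≡1 = u≡1 ; root = r ; link = l ; t≡-s = refl }

  -- When p splits, v mod 3 decides whether the generator u + v√-6 of 𝔭² acts on Y mod 3 trivially or by a 3-cycle.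
  data Behaviour (q : ℤ) : Set where
    inert   : (∀ s → ¬ q ∣ s * s + + 6) → Behaviour q
    trivial : (N : Norm² q) → + 3 ∣ Norm².v N → Behaviour q
    cyclic  : (N : Norm² q) → + 3 ∣ + 2 * Norm².v N - 1ℤ → Behaviour q

  -- If v ≡ 1 modulo 3, passing to the conjugate replaces v by -v, so the cyclic case always has 2v
  -- ≡ 1.
  split-behaviour : ∀ {q} → Norm² q → Behaviour q
  split-behaviour N@(norm² u v norm u≡1 q∤v) with mod3 v
  ... | inj₁ d        = trivial N d
  ... | inj₂ (inj₁ d) = cyclic (norm² u (- v) (trans (shape u v) norm) u≡1 (λ h → q∤v (∣-≡ (∣m⇒∣-m h) (neg-involutive v))))
        (∣-≡ (∣m∣n⇒∣m-n (∣n⇒∣m*n (- (+ 2)) d) ∣-refl) (shape′ v))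
    where
    shape : ∀ u v → u * u + + 6 * (- v * - v) ≡ u * u + + 6 * (v * v)
    shape = solve-∀
    shape′ : ∀ v → - (+ 2) * (v - 1ℤ) - + 3 ≡ + 2 * - v - 1ℤ
    shape′ = solve-∀
  ... | inj₂ (inj₂ d) = cyclic N (∣-≡ (∣m∣n⇒∣m-n (∣n⇒∣m*n (+ 2) d) ∣-refl) (shape v))
    where
    shape : ∀ v → + 2 * (v + 1ℤ) - + 3 ≡ + 2 * v - 1ℤ
    shape = solve-∀

  -- A root s < p with s² + 6 = cp gives the form pX² + 2sXY + cY² of determinant 6, to which the
  -- reduction applies; if the finite search fails, p is inert.
  p-behaviour : ∀ {p q} → Prime p → (q ≡ + p ⊎ q ≡ - + p) → NormalisedPrime q → Behaviour q
  p-behaviour {p} {q} pr q≡±p Q with ℕ.anyUpTo? (λ s → p ℕ.∣? s ℕ.* s ℕ.+ 6) p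
  ... | yes (s , _ , ℕ.divides c eq) = split-behaviour (normalise-u Q (square q≡±p (Diagonal⇒Norm² Q (associate q≡±p) (diagonalise p (+ s) (+ c)
          (trans (*-comm (+ p) (+ c)) (trans (sym (pos-* c p)) (trans (cong +_ (sym eq)) (cong (_+ + 6) (pos-* s s)))))))))
    where
    associate : (q ≡ + p ⊎ q ≡ - + p) → q ∣ + p
    associate (inj₁ refl) = ∣-refl
    associate (inj₂ refl) = divides (- 1ℤ) (shape (+ p))
      where
      shape : ∀ p → p ≡ - 1ℤ * - p
      shape = solve-∀
    square : (q ≡ + p ⊎ q ≡ - + p) → (∃₂ λ u v → u * u + + 6 * (v * v) ≡ + p * + p × ¬ q ∣ v) → ∃₂ λ u v → u * u + + 6 * (v * v) ≡ q * q × ¬ q ∣ v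
    square (inj₁ refl) x = x
    square (inj₂ refl) (u , v , norm , q∤v) = u , v , trans norm (shape (+ p)) , q∤v
      where
      shape : ∀ p → p * p ≡ - p * - p
      shape = solve-∀
  ... | no none = inert λ s d → none (ℤ.∣ s ∣ ℕ.% p , ℕ.m%n<n ℤ.∣ s ∣ p , reduce ℤ.∣ s ∣ (abs-∣ s q≡±p d))
    where
    instance _ = prime⇒nonZero pr
    abs-∣ : ∀ s → (q ≡ + p ⊎ q ≡ - + p) → q ∣ s * s + + 6 → p ℕ.∣ ℤ.∣ s ∣ ℕ.* ℤ.∣ s ∣ ℕ.+ 6
    abs-∣ s q≡±p d = subst₂ ℕ._∣_ (abs-q q≡±p) (cong (λ z → ℤ.∣ z + + 6 ∣) (square-abs s)) (∣⇒∣ᵤ d)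
      where
      abs-q : (q ≡ + p ⊎ q ≡ - + p) → ℤ.∣ q ∣ ≡ p
      abs-q (inj₁ refl) = refl
      abs-q (inj₂ refl) = ∣-i∣≡∣i∣ (+ p)
    reduce : ∀ n → p ℕ.∣ n ℕ.* n ℕ.+ 6 → p ℕ.∣ (n ℕ.% p) ℕ.* (n ℕ.% p) ℕ.+ 6
    reduce n d = ℕ.∣m+n∣m⇒∣n (subst (p ℕ.∣_) (trans (cong (λ n → n ℕ.* n ℕ.+ 6) (ℕ.m≡m%n+[m/n]*n n p)) (shape (n ℕ.% p) (n ℕ./ p) p)) d)
                             (ℕ.n∣m*n (2 ℕ.* (n ℕ.% p) ℕ.* (n ℕ./ p) ℕ.+ (n ℕ./ p) ℕ.* (n ℕ./ p) ℕ.* p))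
      where
      shape : ∀ r k p → (r ℕ.+ k ℕ.* p) ℕ.* (r ℕ.+ k ℕ.* p) ℕ.+ 6 ≡ (2 ℕ.* r ℕ.* k ℕ.+ k ℕ.* k ℕ.* p) ℕ.* p ℕ.+ (r ℕ.* r ℕ.+ 6)
      shape = solve-ℕ

-- Application to `w₁` and to the arithmetic progressions.

open Counting
open Representations
open Rotations
open OrbitCounting
open ThreeOrbits
open PrimeSplitting
open PartitionParity using (parityℤ; parityℤ-+; parityℤ--; parity-B)
open import Data.Nat as ℕ using (z≤n; s≤s; suc; zero; parity)
import Data.Nat.Properties as ℕ
import Data.Nat.Divisibility as ℕ
import Data.Nat.DivMod as ℕ
open import Data.Nat.Primality using (euclidsLemma; prime⇒nonZero; prime⇒irreducible)
open import Data.Nat.Tactic.RingSolver using () renaming (solve-∀ to solve-ℕ)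
open import Data.Integer using (0ℤ; 1ℤ)
open import Data.Integer.Properties using (pos-*; abs-*; ∣-i∣≡∣i∣)
import Data.Integer.Properties as ℤ
open import Data.Integer.DivMod using (_%ℕ_; _/ℕ_; a≡a%ℕn+[a/ℕn]*n; n%ℕd<d)
open import Data.Integer.Divisibility.Signed as ℤ∣ using (divides; ∣⇒∣ᵤ; ∣ᵤ⇒∣; ∣m⇒∣m*n; ∣m⇒∣-m; ∣m∣n⇒∣m+n; ∣m∣n⇒∣m-n; ∣-refl)
open import Data.Integer.Tactic.RingSolver using (solve-∀)
open import Data.Bool using (true; false; if_then_else_)
open import Data.Bool.ListAction using (any)
open import Data.List using (List; []; _∷_; length; filter; upTo)
open import Data.List.Membership.Propositional using (_∈_)
open import Data.List.Membership.Propositional.Properties using (∈-filter⁻)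
open import Data.List.Relation.Unary.Any using (here)
open import Data.Parity.Base as ℙ using (0ℙ; 1ℙ)
open import Data.Parity.Properties using () renaming (*-homo-* to parity-*; *-zeroʳ to ℙ-*-zeroʳ; +-identityʳ to ℙ-+-identityʳ)
open import Data.Product using (∃; _,_; proj₁; proj₂)
open import Data.Sum using (_⊎_; inj₁; inj₂; [_,_]′)
open import Relation.Nullary using (Dec; yes; no; contradiction; ¬?)
open import Relation.Nullary.Decidable using (from-no; from-yes; _→-dec_)
open import Relation.Binary.PropositionalEquality using (_≡_; _≢_; refl; sym; trans; cong; cong₂; subst)

open import Defs
open import Data.Nat using (ℕ; _+_; _*_; _∸_; _^_; _≤_)
open import Data.Nat.DivMod using (_/_)
open import Data.Nat.Divisibility using (_∣_)
open import Data.Nat.Primality using (Prime)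
open import Data.Integer as ℤ using (ℤ; +_)
open import Data.Integer.Divisibility as ℤD using ()
open import Data.Product using (_×_)
open import Relation.Nullary using (¬_)

2∣⇒parity≡0 : ∀ {n} → 2 ∣ n → parity n ≡ 0ℙ
2∣⇒parity≡0 (ℕ.divides k refl) = trans (parity-* k 2) (ℙ-*-zeroʳ (parity k))

parity≡0⇒2∣ : ∀ n → parity n ≡ 0ℙ → 2 ∣ n
parity≡0⇒2∣ zero          _ = 2 ℕ.∣0
parity≡0⇒2∣ (suc (suc n)) e = ℕ.∣m∣n⇒∣m+n {2} {2} ℕ.∣-refl (parity≡0⇒2∣ n e)

¬2∣⇒parity≡1 : ∀ {n} → ¬ 2 ∣ n → parity n ≡ 1ℙ
¬2∣⇒parity≡1 {n} 2∤n with parity n in eq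
... | 0ℙ = contradiction (parity≡0⇒2∣ n eq) 2∤n
... | 1ℙ = refl

2∣B : ∀ n {M} → 24 * n + 5 ≡ M → 2 ∣ length (solutions M (+ 1)) → 2 ∣ B 4 3 n
2∣B n refl d = parity≡0⇒2∣ (B 4 3 n) (trans (parity-B n) (trans (parity-a₁-solutions n) (2∣⇒parity≡0 d)))

-- Both nonzero values, 1 and -1, are odd: modulo 2 the symbol records only whether p divides a.
legendre-odd : ∀ a p → .{{_ : ℕ.NonZero p}} → ¬ (+ p) ℤ∣.∣ a → parityℤ (legendre a p) ≡ 1ℙ
legendre-odd a p@(suc _) p∤a with a %ℕ p in eq
... | zero = contradiction (divides (a /ℕ p) (trans (a≡a%ℕn+[a/ℕn]*n a p) (trans (cong (λ r → + r ℤ.+ a /ℕ p ℤ.* + p) eq) (ℤ.+-identityˡ (a /ℕ p ℤ.* + p))))) p∤a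
... | suc _ with any (λ x → ((+ (x * x)) ℤ.- a) %ℕ p ℕ.≡ᵇ 0) (upTo p)
...   | true  = refl
...   | false = refl

legendre-even : ∀ a p → .{{_ : ℕ.NonZero p}} → (+ p) ℤ∣.∣ a → parityℤ (legendre a p) ≡ 0ℙ
legendre-even a p@(suc _) p∣a = cong (λ r → parityℤ (if r ℕ.≡ᵇ 0 then 0ℤ else (if any (λ x → ((+ (x * x)) ℤ.- a) %ℕ p ℕ.≡ᵇ 0) (upTo p) then 1ℤ else ℤ.-1ℤ))) (remainder≡0 (a %ℕ p) (n%ℕd<d a p) p∣r)
  where
  shape : ∀ r k → r ℤ.+ k ℤ.- k ≡ r
  shape = solve-∀
  p∣r : p ∣ a %ℕ p
  p∣r = ∣⇒∣ᵤ (∣-≡ (∣m∣n⇒∣m-n p∣a (divides (a /ℕ p) refl)) (trans (cong (ℤ._- (a /ℕ p ℤ.* + p)) (a≡a%ℕn+[a/ℕn]*n a p)) (shape (+ (a %ℕ p)) (a /ℕ p ℤ.* + p))))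
  remainder≡0 : ∀ r → r ℕ.< p → p ∣ r → r ≡ 0
  remainder≡0 zero    _   _   = refl
  remainder≡0 (suc r) r<p p∣r = contradiction r<p (ℕ.≤⇒≯ (ℕ.∣⇒≤ p∣r))

prime∤ : ∀ {p n} → Prime p → 5 ≤ p → n ℕ.< 5 → .{{_ : ℕ.NonZero n}} → ¬ p ∣ n
prime∤ pr 5≤p n<5 d = ℕ.<⇒≱ n<5 (ℕ.≤-trans 5≤p (ℕ.∣⇒≤ d))

prime∤6 : ∀ {p} → Prime p → 5 ≤ p → ¬ p ∣ 6
prime∤6 pr 5≤p d = [ prime∤ pr 5≤p (s≤s (s≤s (s≤s z≤n))) , prime∤ pr 5≤p (s≤s (s≤s (s≤s (s≤s z≤n)))) ]′ (euclidsLemma 2 3 pr d)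

prime∤24 : ∀ {p} → Prime p → 5 ≤ p → ¬ p ∣ 24
prime∤24 pr 5≤p d = [ prime∤ pr 5≤p (s≤s (s≤s (s≤s (s≤s (s≤s z≤n))))) , prime∤6 pr 5≤p ]′ (euclidsLemma 4 6 pr d)

-- The shape `suc (J * 24)` lets N ∸ 1 compute to J * 24, so that the divisions by 24 become exact.
_≡1[24]_ : ℕ → ℕ → Set
N ≡1[24] J = N ≡ suc (J * 24)

squares-mod-24 : ∀ {r} → r ℕ.< 24 → ¬ 2 ∣ r → ¬ 3 ∣ r → r * r ℕ.% 24 ≡ 1
squares-mod-24 = from-yes (ℕ.allUpTo? (λ r → ¬? (2 ℕ.∣? r) →-dec (¬? (3 ℕ.∣? r) →-dec (r * r ℕ.% 24 ℕ.≟ 1))) 24)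

square-residue : ∀ {r} k → r * r ℕ.% 24 ≡ 1 → ∃ λ J → ((r + k * 24) * (r + k * 24)) ≡1[24] J
square-residue {r} k e = 2 * r * k + k * k * 24 + r * r / 24 , trans (shape r k) (trans
  (cong (λ x → x + (2 * r * k + k * k * 24) * 24) (trans (ℕ.m≡m%n+[m/n]*n (r * r) 24) (cong (λ x → x + r * r / 24 * 24) e)))
  (shape′ (r * r / 24) (2 * r * k + k * k * 24)))
  where
  shape : ∀ r k → (r + k * 24) * (r + k * 24) ≡ r * r + (2 * r * k + k * k * 24) * 24
  shape = solve-ℕ
  shape′ : ∀ a b → 1 + a * 24 + b * 24 ≡ suc ((b + a) * 24)
  shape′ = solve-ℕ

abstract
  square≡1[24] : ∀ {p} → Prime p → 5 ≤ p → ∃ λ J → (p * p) ≡1[24] J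
  square≡1[24] {p} pr 5≤p = subst (λ x → ∃ λ J → (x * x) ≡1[24] J) (sym (ℕ.m≡m%n+[m/n]*n p 24))
    (square-residue {p ℕ.% 24} (p / 24) (squares-mod-24 {p ℕ.% 24} (ℕ.m%n<n p 24)
      (small-∤ 2 (s≤s (s≤s (s≤s z≤n))) (ℕ.divides 12 refl)) (small-∤ 3 (s≤s (s≤s (s≤s (s≤s z≤n)))) (ℕ.divides 8 refl))))
    where
    small-∤ : ∀ d → .{{_ : ℕ.NonTrivial d}} → d ℕ.< 5 → d ∣ 24 → ¬ d ∣ p ℕ.% 24
    small-∤ d d<5 d∣24 d∣r = [ ℕ.nonTrivial⇒≢1 , (λ d≡p → ℕ.<⇒≱ d<5 (ℕ.≤-trans 5≤p (ℕ.≤-reflexive (sym d≡p)))) ]′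
      (prime⇒irreducible pr (subst (d ∣_) (sym (ℕ.m≡m%n+[m/n]*n p 24)) (ℕ.∣m∣n⇒∣m+n d∣r (ℕ.∣n⇒∣m*n (p / 24) d∣24))))

power≡1[24] : ∀ {N J} i → N ≡1[24] J → ∃ λ J′ → (N ^ i) ≡1[24] J′
power≡1[24] zero refl = 0 , refl
power≡1[24] {J = J} (suc i) refl with power≡1[24] {J = J} i refl
... | J′ , e = J + J′ + J * J′ * 24 , trans (cong (λ x → suc (J * 24) * x) e) (shape J J′)
  where
  shape : ∀ a b → suc (a * 24) * suc (b * 24) ≡ suc ((a + b + a * b * 24) * 24)
  shape = solve-ℕ

even-power≡1[24] : ∀ {p} E → Prime p → 5 ≤ p → 2 ∣ E → ∃ λ J → (p ^ E) ≡1[24] J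
even-power≡1[24] {p} E pr 5≤p (ℕ.divides i refl) =
  let J , e = square≡1[24] pr 5≤p
      J′ , e′ = power≡1[24] {J = J} i e
  in J′ , trans (trans (cong (p ^_) (ℕ.*-comm i 2)) (trans (sym (ℕ.^-*-assoc p 2 i)) (cong (λ x → (p * x) ^ i) (ℕ.*-identityʳ p)))) e′

offset : ∀ {N J} → N ≡1[24] J → 5 * (N ∸ 1) / 24 ≡ 5 * J
offset {J = J} refl = trans (cong (λ x → x / 24) (sym (ℕ.*-assoc 5 J 24))) (ℕ.m*n/n≡m (5 * J) 24)

-- This is the number represented by the form for the argument of `B`. When p does not divide n, the
-- cofactor 24n + 5p is prime to p and the exponent of p is exactly e.
index₁ : ∀ p e n {J} → (p ^ suc e) ≡1[24] J → 24 * (p ^ e * n + 5 * (p ^ suc e ∸ 1) / 24) + 5 ≡ p ^ e * (24 * n + 5 * p)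
index₁ p e n {J} E≡ = trans (cong (λ x → 24 * (p ^ e * n + x) + 5) (offset {p ^ suc e} {J} E≡))
  (trans (shape (p ^ e) n J) (trans (cong (λ x → p ^ e * (24 * n) + 5 * x) (sym E≡)) (shape′ (p ^ e) n p)))
  where
  shape : ∀ a n J → 24 * (a * n + 5 * J) + 5 ≡ a * (24 * n) + 5 * suc (J * 24)
  shape = solve-ℕ
  shape′ : ∀ a n p → a * (24 * n) + 5 * (p * a) ≡ a * (24 * n + 5 * p)
  shape′ = solve-ℕ

-- Here the exponent of p is exactly e unless p divides 24n + 5.
index₂ : ∀ p e n {J} → (p ^ e) ≡1[24] J → 24 * (p ^ e * n + 5 * (p ^ e ∸ 1) / 24) + 5 ≡ p ^ e * (24 * n + 5)
index₂ p e n {J} E≡ = trans (cong (λ x → 24 * (p ^ e * n + x) + 5) (offset {p ^ e} {J} E≡))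
  (trans (shape (p ^ e) n J) (trans (cong (λ x → p ^ e * (24 * n) + 5 * x) (sym E≡)) (shape′ (p ^ e) n)))
  where
  shape : ∀ a n J → 24 * (a * n + 5 * J) + 5 ≡ a * (24 * n) + 5 * suc (J * 24)
  shape = solve-ℕ
  shape′ : ∀ a n → a * (24 * n) + 5 * a ≡ a * (24 * n + 5)
  shape′ = solve-ℕ

2∤24n+5 : ∀ n → ¬ 2 ∣ 24 * n + 5
2∤24n+5 n d = from-no (2 ℕ.∣? 5) (ℕ.∣m+n∣m⇒∣n d (ℕ.∣m⇒∣m*n n (ℕ.divides 12 refl)))

empty⇒2∣length : {A : Set} (xs : List A) → (∀ {x} → ¬ x ∈ xs) → 2 ∣ length xs
empty⇒2∣length []      _ = 2 ℕ.∣0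
empty⇒2∣length (x ∷ _) h = contradiction (here refl) h

-- Both Legendre symbols are odd: p does not divide 6, and if it divided 5J, then 5p² = 24(5J) + 5
-- would give p = 5.
parity-w₁ : ∀ {p J} → Prime p → 5 ≤ p → p ≢ 5 → (p * p) ≡1[24] J →
  parityℤ (w₁ p) ≡ parity (length (solutions (24 * (5 * J) + 5) (+ 1))) ℙ.+ 1ℙ
parity-w₁ {p} {J} pr 5≤p p≢5 pp≡ = trans (cong (λ m → parityℤ (a₁ m ℤ.+ legendre (ℤ.- (+ 6)) p ℤ.* legendre (ℤ.- (+ m)) p)) (offset {p * p} {J} pp≡))
  (trans (parityℤ-+ (a₁ (5 * J)) _) (cong₂ ℙ._+_ (parity-a₁-solutions (5 * J))
    (trans (cong parity (abs-* (legendre (ℤ.- (+ 6)) p) (legendre (ℤ.- (+ (5 * J))) p))) (trans (parity-* ℤ.∣ legendre (ℤ.- (+ 6)) p ∣ ℤ.∣ legendre (ℤ.- (+ (5 * J))) p ∣)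
      (cong₂ ℙ._*_ (legendre-odd (ℤ.- (+ 6)) p (λ d → prime∤6 pr 5≤p (∣⇒∣ᵤ d)))
                   (legendre-odd (ℤ.- (+ (5 * J))) p (λ d → p∤5J (subst (p ∣_) (∣-i∣≡∣i∣ (+ (5 * J))) (∣⇒∣ᵤ d)))))))))
  where
  instance _ = prime⇒nonZero pr
  p∤5J : ¬ p ∣ 5 * J
  p∤5J d = p≢5 (ℕ.≤-antisym (ℕ.∣⇒≤ (ℕ.∣m+n∣m⇒∣n (subst (p ∣_) (trans (cong (5 *_) pp≡) (shape J)) (ℕ.∣n⇒∣m*n 5 (ℕ.m∣m*n p))) (ℕ.∣n⇒∣m*n 24 d))) 5≤p)
    where
    shape : ∀ J → 5 * suc (J * 24) ≡ 24 * (5 * J) + 5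
    shape = solve-ℕ

-- Trading p for q = ±p changes at most the sign of the cofactor.
valuation : ∀ {p q} → (q ≡ + p ⊎ q ≡ ℤ.- (+ p)) → ∀ e m → ∃ λ m′ → + (p ^ e * m) ≡ q ℤ.^ e ℤ.* m′ × (q ℤ∣.∣ m′ → p ∣ m)
valuation {p} {q} q≡±p zero m = + m , trans (cong +_ (ℕ.*-identityˡ m)) (sym (ℤ.*-identityˡ (+ m))) , λ d → subst (_∣ m) (abs-q q≡±p) (∣⇒∣ᵤ d)
  where
  abs-q : (q ≡ + p ⊎ q ≡ ℤ.- (+ p)) → ℤ.∣ q ∣ ≡ p
  abs-q (inj₁ refl) = refl
  abs-q (inj₂ refl) = ∣-i∣≡∣i∣ (+ p)
valuation {p} {q} q≡±p (suc e) m with valuation q≡±p e m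
... | m′ , eq , q∣m′⇒ = sign q≡±p
  where
  pos-step : + (p ^ suc e * m) ≡ + p ℤ.* (q ℤ.^ e ℤ.* m′)
  pos-step = trans (cong +_ (ℕ.*-assoc p (p ^ e) m)) (trans (pos-* p (p ^ e * m)) (cong (λ z → + p ℤ.* z) eq))
  shape : ∀ p a m → p ℤ.* (a ℤ.* m) ≡ p ℤ.* a ℤ.* m
  shape = solve-∀
  shape′ : ∀ p a m → p ℤ.* (a ℤ.* m) ≡ (ℤ.- p) ℤ.* a ℤ.* (ℤ.- m)
  shape′ = solve-∀
  sign : (q ≡ + p ⊎ q ≡ ℤ.- (+ p)) → ∃ λ m″ → + (p ^ suc e * m) ≡ q ℤ.^ suc e ℤ.* m″ × (q ℤ∣.∣ m″ → p ∣ m)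
  sign (inj₁ q≡) = m′ , trans pos-step (trans (shape (+ p) (q ℤ.^ e) m′) (cong (λ x → x ℤ.* q ℤ.^ e ℤ.* m′) (sym q≡))) , q∣m′⇒
  sign (inj₂ q≡) = ℤ.- m′ , trans pos-step (trans (shape′ (+ p) (q ℤ.^ e) m′) (cong (λ x → x ℤ.* q ℤ.^ e ℤ.* (ℤ.- m′)) (sym q≡)))
    , λ d → q∣m′⇒ (∣-≡ (∣m⇒∣-m d) (ℤ.neg-involutive m′))

module _ {p : ℕ} (pr : Prime p) (5≤p : 5 ≤ p) {q : ℤ} (q≡±p : q ≡ + p ⊎ q ≡ ℤ.- (+ p)) (Q : NormalisedPrime q) where

  cyclic⇒2∣length : ∀ {e m n} (N : Norm² q) → + 3 ℤ∣.∣ + 2 ℤ.* Norm².v N ℤ.- 1ℤ → 3 ∣ suc e → 24 * n + 5 ≡ p ^ e * m → ¬ p ∣ m →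
    2 ∣ length (solutions (24 * n + 5) (+ 1))
  cyclic⇒2∣length {e} {m} {n} N 2v≡1 3∣ M≡ p∤m =
    let m′ , M≡′ , h = valuation q≡±p e m
        s , t , ρ = rotation Q N e
    in 2∣length-cyclic Q ρ {24 * n + 5} {m′} (trans (cong +_ M≡) M≡′) (λ d → p∤m (h d)) 3∣ 2v≡1 (2∤24n+5 n)

  trivial⇒2∣length : ∀ {e m M} (N : Norm² q) → + 3 ℤ∣.∣ Norm².v N → 2 ∣ suc e → M ≡ p ^ e * m → ¬ p ∣ m →
    2 ∣ length (solutions M (+ 1))
  trivial⇒2∣length {e} {m} {M} N v≡0 2∣ M≡ p∤m =
    let m′ , M≡′ , h = valuation q≡±p e m
        s , t , ρ = rotation Q N e
    in 2∣length-paired Q ρ {M} {m′} (trans (cong +_ M≡) M≡′) (λ d → p∤m (h d)) 2∣ v≡0 (+ 1)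

  inert⇒2∣length : ∀ {e m M} → (∀ s → ¬ q ℤ∣.∣ s ℤ.* s ℤ.+ + 6) → 2 ∣ suc e → M ≡ p ^ e * m → ¬ p ∣ m →
    2 ∣ length (solutions M (+ 1))
  inert⇒2∣length {e} {m} {M} none 2∣ M≡ p∤m =
    let m′ , M≡′ , h = valuation q≡±p e m
    in empty⇒2∣length (solutions M (+ 1)) λ {β} β∈ →
         inert-insoluble Q none e {m′} {proj₁ β} {proj₂ β} 2∣ (λ d → p∤m (h d))
           (trans (Solution.equation (solutions⇒Solution {M} {+ 1} β∈)) (trans (cong +_ M≡) M≡′))

  module _ (p≢5 : p ≢ 5) {J : ℕ} (pp≡ : (p * p) ≡1[24] J) where
    private
      M₅ = 24 * (5 * J) + 5

      M₅≡ : M₅ ≡ p ^ 2 * 5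
      M₅≡ = trans (shape J) (trans (cong (_* 5) (sym pp≡)) (cong (λ x → p * x * 5) (sym (ℕ.*-identityʳ p))))
        where
        shape : ∀ J → 24 * (5 * J) + 5 ≡ suc (J * 24) * 5
        shape = solve-ℕ

      M₅≡q²5 : + M₅ ≡ q ℤ.^ 2 ℤ.* + 5
      M₅≡q²5 = trans (cong +_ M₅≡) (trans (cong (λ x → + (p * x * 5)) (ℕ.*-identityʳ p)) (trans (pos-* (p * p) 5) (trans (cong (ℤ._* + 5) (pos-* p p)) (sign q≡±p))))
        where
        shape : ∀ p → p ℤ.* p ℤ.* + 5 ≡ p ℤ.* (p ℤ.* 1ℤ) ℤ.* + 5
        shape = solve-∀
        shape′ : ∀ p → p ℤ.* p ℤ.* + 5 ≡ (ℤ.- p) ℤ.* ((ℤ.- p) ℤ.* 1ℤ) ℤ.* + 5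
        shape′ = solve-∀
        sign : (q ≡ + p ⊎ q ≡ ℤ.- (+ p)) → + p ℤ.* + p ℤ.* + 5 ≡ q ℤ.* (q ℤ.* 1ℤ) ℤ.* + 5
        sign (inj₁ refl) = shape (+ p)
        sign (inj₂ refl) = shape′ (+ p)

      p∤5 : ¬ p ∣ 5
      p∤5 d = p≢5 (ℕ.≤-antisym (ℕ.∣⇒≤ d) 5≤p)

      abs-q : (q ≡ + p ⊎ q ≡ ℤ.- (+ p)) → ℤ.∣ q ∣ ≡ p
      abs-q (inj₁ refl) = refl
      abs-q (inj₂ refl) = ∣-i∣≡∣i∣ (+ p)

      q∤5 : ¬ q ℤ∣.∣ + 5
      q∤5 d = p∤5 (subst (_∣ 5) (abs-q q≡±p) (∣⇒∣ᵤ d))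

    -- For 5p² the exponent is e = 2, so 3 divides e + 1 and the count is even; the Legendre product
    -- contributes the 1.
    cyclic⇒w₁-odd : (N : Norm² q) → + 3 ℤ∣.∣ + 2 ℤ.* Norm².v N ℤ.- 1ℤ → ¬ 2 ∣ ℤ.∣ w₁ p ∣
    cyclic⇒w₁-odd N 2v≡1 d = contradiction (trans (sym (2∣⇒parity≡0 d)) (trans (parity-w₁ {p} {J} pr 5≤p p≢5 pp≡)
      (cong (ℙ._+ 1ℙ) (2∣⇒parity≡0 (cyclic⇒2∣length {2} {5} {5 * J} N 2v≡1 (ℕ.divides 1 refl) M₅≡ p∤5))))) λ ()

    odd⇒w₁-even : ¬ 2 ∣ length (solutions M₅ (+ 1)) → 2 ∣ ℤ.∣ w₁ p ∣
    odd⇒w₁-even odd = parity≡0⇒2∣ ℤ.∣ w₁ p ∣ (trans (parity-w₁ {p} {J} pr 5≤p p≢5 pp≡) (cong (ℙ._+ 1ℙ) (¬2∣⇒parity≡1 odd)))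

    -- The solutions not divisible by q are even in number, and the single divisible one makes the
    -- count odd.
    trivial⇒w₁-even : (N : Norm² q) → + 3 ℤ∣.∣ Norm².v N → 2 ∣ ℤ.∣ w₁ p ∣
    trivial⇒w₁-even N v≡0 = let s , t , ρ = rotation Q N 2 in
      odd⇒w₁-even (odd-length Q M₅≡q²5 (2∣length-primitive Q {M₅} M₅≡q²5 ρ q∤5 v≡0))

    -- Every solution is divisible by an inert q, so only the one coming from M = 5 remains.
    inert⇒w₁-even : (∀ s → ¬ q ℤ∣.∣ s ℤ.* s ℤ.+ + 6) → 2 ∣ ℤ.∣ w₁ p ∣
    inert⇒w₁-even none = odd⇒w₁-even (odd-length Q M₅≡q²5 (empty⇒2∣length (filter (λ β → ¬? (divisible? q β)) (solutions M₅ (+ 1))) λ {β} β∈ →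
      let β∈′ , prim = ∈-filter⁻ (λ β → ¬? (divisible? q β)) {xs = solutions M₅ (+ 1)} β∈
      in prim (inert-divisible Q none {proj₁ β} {proj₂ β} (∣-≡ (divides (q ℤ.* + 5) (shape q))
           (trans (sym M₅≡q²5) (sym (Solution.equation (solutions⇒Solution {M₅} {+ 1} β∈′))))))))
      where
      shape : ∀ q → q ℤ.* (q ℤ.* 1ℤ) ℤ.* + 5 ≡ q ℤ.* + 5 ℤ.* q
      shape = solve-∀

-- For p = 5 the number 5(p² - 1)/24 is 5 itself, so the second Legendre symbol is 0; the parity is
-- settled by evaluation.
w₁[5]-odd : ¬ 2 ∣ ℤ.∣ w₁ 5 ∣
w₁[5]-odd = from-no (2 ℕ.∣? ℤ.∣ w₁ 5 ∣)

-- 5² = 1² + 6·2²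
norm²-5 : ∀ {q} → (q ≡ + 5 ⊎ q ≡ ℤ.- (+ 5)) → ∃ λ (N : Norm² q) → + 3 ℤ∣.∣ + 2 ℤ.* Norm².v N ℤ.- 1ℤ
norm²-5 (inj₁ refl) = norm² (+ 1) (+ 2) refl (divides (+ 0) refl) (λ d → from-no (5 ℕ.∣? 2) (∣⇒∣ᵤ d)) , divides (+ 1) refl
norm²-5 (inj₂ refl) = norm² (+ 1) (+ 2) refl (divides (+ 0) refl) (λ d → from-no (5 ℕ.∣? 2) (∣⇒∣ᵤ d)) , divides (+ 1) refl

-- An even `w₁` excludes the cyclic case; an inert prime and one with 3 dividing v both give an even
-- count for odd e.
w₁-even⇒2∣length : ∀ {p e m M} → Prime p → 5 ≤ p → 2 ∣ ℤ.∣ w₁ p ∣ → 2 ∣ suc e → M ≡ p ^ e * m → ¬ p ∣ m →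
  2 ∣ length (solutions M (+ 1))
w₁-even⇒2∣length {p} {e} {m} {M} pr 5≤p w-even 2∣ M≡ p∤m = by-cases (p ℕ.≟ 5) (normalise pr 5≤p)
  where
  by-behaviour : ∀ {q} → p ≢ 5 → (q ≡ + p ⊎ q ≡ ℤ.- (+ p)) → NormalisedPrime q → Behaviour q → 2 ∣ length (solutions M (+ 1))
  by-behaviour p≢5 q≡±p Q (inert h)     = inert⇒2∣length pr 5≤p q≡±p Q {e} h 2∣ M≡ p∤m
  by-behaviour p≢5 q≡±p Q (trivial N h) = trivial⇒2∣length pr 5≤p q≡±p Q {e} N h 2∣ M≡ p∤m
  by-behaviour p≢5 q≡±p Q (cyclic N h)  = contradiction w-even (cyclic⇒w₁-odd pr 5≤p q≡±p Q p≢5 {proj₁ (square≡1[24] pr 5≤p)} (proj₂ (square≡1[24] pr 5≤p)) N h)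
  by-cases : Dec (p ≡ 5) → (∃ λ q → (q ≡ + p ⊎ q ≡ ℤ.- (+ p)) × NormalisedPrime q) → 2 ∣ length (solutions M (+ 1))
  by-cases (yes p≡5) _ = contradiction (subst (λ p → 2 ∣ ℤ.∣ w₁ p ∣) p≡5 w-even) w₁[5]-odd
  by-cases (no p≢5) (q , q≡±p , Q) = by-behaviour p≢5 q≡±p Q (p-behaviour pr q≡±p Q)

-- An odd `w₁` leaves only the cyclic case, which for p = 5 is exhibited by `norm²-5`.
w₁-odd⇒2∣length : ∀ {p e m n} → Prime p → 5 ≤ p → ¬ 2 ∣ ℤ.∣ w₁ p ∣ → 3 ∣ suc e → 24 * n + 5 ≡ p ^ e * m → ¬ p ∣ m →
  2 ∣ length (solutions (24 * n + 5) (+ 1))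
w₁-odd⇒2∣length {p} {e} {m} {n} pr 5≤p w-odd 3∣ M≡ p∤m = by-cases (p ℕ.≟ 5) (normalise pr 5≤p)
  where
  by-behaviour : ∀ {q} → p ≢ 5 → (q ≡ + p ⊎ q ≡ ℤ.- (+ p)) → NormalisedPrime q → Behaviour q → 2 ∣ length (solutions (24 * n + 5) (+ 1))
  by-behaviour p≢5 q≡±p Q (inert h)     = contradiction (inert⇒w₁-even pr 5≤p q≡±p Q p≢5 {proj₁ (square≡1[24] pr 5≤p)} (proj₂ (square≡1[24] pr 5≤p)) h) w-odd
  by-behaviour p≢5 q≡±p Q (trivial N h) = contradiction (trivial⇒w₁-even pr 5≤p q≡±p Q p≢5 {proj₁ (square≡1[24] pr 5≤p)} (proj₂ (square≡1[24] pr 5≤p)) N h) w-odd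
  by-behaviour p≢5 q≡±p Q (cyclic N h)  = cyclic⇒2∣length pr 5≤p q≡±p Q {e} {m} {n} N h 3∣ M≡ p∤m
  by-cases : Dec (p ≡ 5) → (∃ λ q → (q ≡ + p ⊎ q ≡ ℤ.- (+ p)) × NormalisedPrime q) → 2 ∣ length (solutions (24 * n + 5) (+ 1))
  by-cases (yes p≡5) (q , q≡±p , Q) =
    let N , h = norm²-5 (subst (λ p → q ≡ + p ⊎ q ≡ ℤ.- (+ p)) p≡5 q≡±p) in cyclic⇒2∣length pr 5≤p q≡±p Q {e} {m} {n} N h 3∣ M≡ p∤m
  by-cases (no p≢5) (q , q≡±p , Q) = by-behaviour p≢5 q≡±p Q (p-behaviour pr q≡±p Q)

p∤24n+5p : ∀ {p n} → Prime p → 5 ≤ p → ¬ p ∣ n → ¬ p ∣ 24 * n + 5 * p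
p∤24n+5p {p} {n} pr 5≤p p∤n d = [ prime∤24 pr 5≤p , p∤n ]′ (euclidsLemma 24 n pr
  (ℕ.∣m+n∣m⇒∣n (subst (p ∣_) (ℕ.+-comm (24 * n) (5 * p)) d) (ℕ.n∣m*n 5)))

-- Four times the argument of the Legendre symbol is p² - (24n + 5), and p does not divide 4.
p∣24n+5⇒ : ∀ {p n J} → Prime p → 5 ≤ p → (p * p) ≡1[24] J → p ∣ 24 * n + 5 →
  + p ℤ∣.∣ (ℤ.- (+ (6 * n))) ℤ.- + 1 ℤ.+ + ((p * p ∸ 1) / 4)
p∣24n+5⇒ {p} {n} {J} pr 5≤p pp≡ d = subst (λ x → + p ℤ∣.∣ (ℤ.- (+ (6 * n))) ℤ.- + 1 ℤ.+ + x) (sym quarter) (∣ᵤ⇒∣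
    ([ (λ p∣4 → contradiction p∣4 (prime∤ pr 5≤p (s≤s (s≤s (s≤s (s≤s (s≤s z≤n))))))) , (λ h → h) ]′
      (euclidsLemma 4 ℤ.∣ a ∣ pr (subst (p ∣_) (abs-* (+ 4) a) (∣⇒∣ᵤ p∣4a)))))
  where
  a = (ℤ.- (+ (6 * n))) ℤ.- + 1 ℤ.+ + (6 * J)
  quarter : (p * p ∸ 1) / 4 ≡ 6 * J
  quarter = trans (cong (λ x → (x ∸ 1) / 4) pp≡) (trans (cong (λ x → x / 4) (shape J)) (ℕ.m*n/n≡m (6 * J) 4))
    where
    shape : ∀ J → J * 24 ≡ 6 * J * 4
    shape = solve-ℕ
  shape : ∀ n J → (+ 1 ℤ.+ J ℤ.* + 24) ℤ.- (+ 24 ℤ.* n ℤ.+ + 5) ≡ + 4 ℤ.* ((ℤ.- (+ 6 ℤ.* n)) ℤ.- + 1 ℤ.+ + 6 ℤ.* J)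
  shape = solve-∀
  cast₁ : + (p * p) ≡ + 1 ℤ.+ + J ℤ.* + 24
  cast₁ = trans (cong +_ pp≡) (cong (λ x → + 1 ℤ.+ x) (pos-* J 24))
  cast₂ : + (24 * n + 5) ≡ + 24 ℤ.* + n ℤ.+ + 5
  cast₂ = cong (ℤ._+ + 5) (pos-* 24 n)
  p∣4a : + p ℤ∣.∣ + 4 ℤ.* a
  p∣4a = ∣-≡ (∣m∣n⇒∣m-n (∣ᵤ⇒∣ {+ p} {+ (p * p)} (ℕ.m∣m*n p)) (∣ᵤ⇒∣ {+ p} {+ (24 * n + 5)} d))
    (trans (cong₂ ℤ._-_ cast₁ cast₂) (trans (shape (+ n) (+ J))
      (cong₂ (λ x y → + 4 ℤ.* ((ℤ.- x) ℤ.- + 1 ℤ.+ y)) (sym (pos-* 6 n)) (sym (pos-* 6 J)))))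

-- With `w₁` odd the congruence says that the symbol is odd, hence nonzero, and by `p∣24n+5⇒` it
-- would vanish if p divided 24n + 5.
legendre-condition : ∀ {p n} → Prime p → 5 ≤ p → ¬ 2 ∣ ℤ.∣ w₁ p ∣ →
  2 ∣ ℤ.∣ w₁ p ℤ.- legendre ((ℤ.- (+ (6 * n))) ℤ.- + 1 ℤ.+ + ((p * p ∸ 1) / 4)) p ∣ → ¬ p ∣ 24 * n + 5
legendre-condition {p} {n} pr 5≤p w-odd 2∣w-l p∣ = w-odd (parity≡0⇒2∣ ℤ.∣ w₁ p ∣
  (trans (sym (ℙ-+-identityʳ _)) (trans (cong (parityℤ (w₁ p) ℙ.+_) (sym (legendre-even l p (p∣24n+5⇒ {p} {n} {proj₁ (square≡1[24] pr 5≤p)} pr 5≤p (proj₂ (square≡1[24] pr 5≤p)) p∣))))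
    (trans (sym (parityℤ-- (w₁ p) (legendre l p))) (2∣⇒parity≡0 2∣w-l)))))
  where
  instance _ = prime⇒nonZero pr
  l = (ℤ.- (+ (6 * n))) ℤ.- + 1 ℤ.+ + ((p * p ∸ 1) / 4)

theorem1p10 : (p : ℕ) → Prime p → 5 ≤ p →
    ((+ 2 ℤD.∣ w₁ p) →
    (n k : ℕ) → ¬ (p ∣ n) →
    2 ∣ B 4 3 (p ^ (4 * k + 3) * n + 5 * (p ^ (4 * k + 4) ∸ 1) / 24))
    × ((¬ (+ 2 ℤD.∣ w₁ p)) →
    (n k : ℕ) → ¬ (p ∣ n) →
    2 ∣ B 4 3 (p ^ (6 * k + 5) * n + 5 * (p ^ (6 * k + 6) ∸ 1) / 24))
    × ((¬ (+ 2 ℤD.∣ w₁ p)) →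
    (n k : ℕ) →
    (+ 2 ℤD.∣ (w₁ p ℤ.- legendre ((ℤ.- (+ (6 * n))) ℤ.- + 1 ℤ.+ + ((p * p ∸ 1) / 4)) p)) →
    2 ∣ B 4 3 (p ^ (6 * k + 2) * n + 5 * (p ^ (6 * k + 2) ∸ 1) / 24))
theorem1p10 p pr 5≤p = part₁ , part₂ , part₃
  where
  part₁ : (+ 2 ℤD.∣ w₁ p) → (n k : ℕ) → ¬ (p ∣ n) → 2 ∣ B 4 3 (p ^ (4 * k + 3) * n + 5 * (p ^ (4 * k + 4) ∸ 1) / 24)
  part₁ w-even n k p∤n = subst (λ E → 2 ∣ B 4 3 (p ^ (4 * k + 3) * n + 5 * (p ^ E ∸ 1) / 24)) (sym (ℕ.+-suc (4 * k) 3))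
    (2∣B (p ^ e * n + 5 * (p ^ suc e ∸ 1) / 24) M≡
      (w₁-even⇒2∣length {e = e} pr 5≤p w-even 2∣ refl (p∤24n+5p pr 5≤p p∤n)))
    where
    e = 4 * k + 3
    2∣ : 2 ∣ suc e
    2∣ = ℕ.divides (2 * k + 2) (shape k)
      where
      shape : ∀ k → suc (4 * k + 3) ≡ (2 * k + 2) * 2
      shape = solve-ℕ
    E≡ = even-power≡1[24] (suc e) pr 5≤p 2∣
    M≡ = index₁ p e n {proj₁ E≡} (proj₂ E≡)
  part₂ : ¬ (+ 2 ℤD.∣ w₁ p) → (n k : ℕ) → ¬ (p ∣ n) → 2 ∣ B 4 3 (p ^ (6 * k + 5) * n + 5 * (p ^ (6 * k + 6) ∸ 1) / 24)
  part₂ w-odd n k p∤n = subst (λ E → 2 ∣ B 4 3 (p ^ (6 * k + 5) * n + 5 * (p ^ E ∸ 1) / 24)) (sym (ℕ.+-suc (6 * k) 5))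
    (2∣B N refl (w₁-odd⇒2∣length {e = e} {n = N} pr 5≤p w-odd (ℕ.divides (2 * k + 2) (shape k)) M≡ (p∤24n+5p pr 5≤p p∤n)))
    where
    e = 6 * k + 5
    N = p ^ e * n + 5 * (p ^ suc e ∸ 1) / 24
    shape : ∀ k → suc (6 * k + 5) ≡ (2 * k + 2) * 3
    shape = solve-ℕ
    shape′ : ∀ k → suc (6 * k + 5) ≡ (3 * k + 3) * 2
    shape′ = solve-ℕ
    E≡ = even-power≡1[24] (suc e) pr 5≤p (ℕ.divides (3 * k + 3) (shape′ k))
    M≡ = index₁ p e n {proj₁ E≡} (proj₂ E≡)
  part₃ : ¬ (+ 2 ℤD.∣ w₁ p) → (n k : ℕ) →
    (+ 2 ℤD.∣ (w₁ p ℤ.- legendre ((ℤ.- (+ (6 * n))) ℤ.- + 1 ℤ.+ + ((p * p ∸ 1) / 4)) p)) →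
    2 ∣ B 4 3 (p ^ (6 * k + 2) * n + 5 * (p ^ (6 * k + 2) ∸ 1) / 24)
  part₃ w-odd n k cond = 2∣B N refl (w₁-odd⇒2∣length {e = e} {n = N} pr 5≤p w-odd (ℕ.divides (2 * k + 1) (shape k)) M≡
    (legendre-condition {n = n} pr 5≤p w-odd cond))
    where
    e = 6 * k + 2
    N = p ^ e * n + 5 * (p ^ e ∸ 1) / 24
    shape : ∀ k → suc (6 * k + 2) ≡ (2 * k + 1) * 3
    shape = solve-ℕ
    shape′ : ∀ k → 6 * k + 2 ≡ (3 * k + 1) * 2
    shape′ = solve-ℕ
    E≡ = even-power≡1[24] e pr 5≤p (ℕ.divides (3 * k + 1) (shape′ k))
    M≡ = index₂ p e n {proj₁ E≡} (proj₂ E≡)
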